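{- Let $k\geq 1$ be an integer. If a graph $H$ is KNRS and regular, then its $2k$-subdivision $H^{(2k)}$ is also KNRS.
   Context: All graphs are finite and simple. For graphs $H,G$, the homomorphism density $t(H,G)$ is the probability that a uniformly random map $f:V(H)\to V(G)$ satisfies $f(u)f(v)\in E(G)$ for every $uv\in E(H)$. For an integer $s\geq1$, the $s$-subdivision $H^{(s)}$ of $H$ is obtained by replacing each edge $uv$ of $H$ by a path of length $s+1$ between $u$ and $v$, the paths being internally vertex-disjoint. An $n$-vertex graph $G$ is $(\rho,d)$-dense if every vertex subset $X$ with $|X|\geq\rho n$ spans at least $\frac d2|X|^2$ edges. A graph $H$ is KNRS if for all reals $d,\varepsilon>0$ there is $\rho=\rho(d,H,\varepsilon)>0$ such that $t(H,G)\geq(1-\varepsilon)d^{|E(H)|}$ for every sufficiently large $(\rho,d)$-dense graph $G$. -}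

module Defs where

open import Data.Bool using (Bool; true; false; _∧_; _∨_; if_then_else_)
open import Data.Nat as ℕ using (ℕ; zero; suc; _<ᵇ_; _≡ᵇ_)
open import Data.Fin as Fin using (Fin; toℕ; splitAt; remQuot)
open import Data.Fin.Subset using (Subset; ∣_∣)
open import Data.List using (List; []; _∷_; map; concatMap; allFin; length; lookup)
open import Data.Vec using (Vec)
import Data.Vec as Vec
open import Data.Product using (_×_; _,_; proj₁; proj₂; Σ; ∃; ∃-syntax)
open import Data.Sum using (_⊎_; inj₁; inj₂)
open import Data.Integer using (+_)
open import Data.Rational using (ℚ; _/_; _*_; _-_; _≤_; _<_; 0ℚ; 1ℚ; ½)
open import Relation.Binary.PropositionalEquality using (_≡_)

Graph : ℕ → Set
Graph n = Fin n → Fin n → Bool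

IsSimple : ∀ {n} → Graph n → Set
IsSimple {n} G = (∀ (i j : Fin n) → G i j ≡ G j i) × (∀ (i : Fin n) → G i i ≡ false)

countTrue : List Bool → ℕ
countTrue [] = 0
countTrue (true ∷ bs) = suc (countTrue bs)
countTrue (false ∷ bs) = countTrue bs

edgeList : ∀ {n} → Graph n → List (Fin n × Fin n)
edgeList {n} G =
  concatMap (λ i → concatMap (λ j →
    if (G i j ∧ (toℕ i <ᵇ toℕ j)) then (i , j) ∷ [] else []) (allFin n)) (allFin n)

numEdges : ∀ {n} → Graph n → ℕ
numEdges G = length (edgeList G)

spannedEdges : ∀ {n} → Graph n → Subset n → ℕ
spannedEdges G X = countTrue (map (λ e → Vec.lookup X (proj₁ e) ∧ Vec.lookup X (proj₂ e)) (edgeList G))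

degree : ∀ {n} → Graph n → Fin n → ℕ
degree {n} G v = countTrue (map (G v) (allFin n))

IsRegular : ∀ {n} → Graph n → Set
IsRegular {n} G = ∃[ r ] (∀ (v : Fin n) → degree G v ≡ r)

consF : ∀ {m n} → Fin n → (Fin m → Fin n) → Fin (suc m) → Fin n
consF x f Fin.zero = x
consF x f (Fin.suc i) = f i

allMaps : ∀ m n → List (Fin m → Fin n)
allMaps zero n = (λ ()) ∷ []
allMaps (suc m) n = concatMap (λ x → map (consF x) (allMaps m n)) (allFin n)

eqFin : ∀ {n} → Fin n → Fin n → Bool
eqFin i j = toℕ i ≡ᵇ toℕ j

allB : List Bool → Bool
allB [] = true
allB (b ∷ bs) = b ∧ allB bs

isHom : ∀ {m n} → Graph m → Graph n → (Fin m → Fin n) → Bool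
isHom H G f = allB (map (λ e → G (f (proj₁ e)) (f (proj₂ e))) (edgeList H))

homCount : ∀ {m n} → Graph m → Graph n → ℕ
homCount {m} {n} H G = countTrue (map (isHom H G) (allMaps m n))

fromℕ : ℕ → ℚ
fromℕ a = (+ a) / 1

-- a / b as a rational (convention: 0 if b = 0; irrelevant below).
ratio : ℕ → ℕ → ℚ
ratio a zero = 0ℚ
ratio a (suc b) = (+ a) / suc b

t : ∀ {m n} → Graph m → Graph n → ℚ
t {m} {n} H G = ratio (homCount H G) (n ℕ.^ m)

_^ℚ_ : ℚ → ℕ → ℚ
q ^ℚ zero = 1ℚ
q ^ℚ suc k = q * (q ^ℚ k)

IsDense : ℚ → ℚ → ∀ {n} → Graph n → Set
IsDense ρ d {n} G = (X : Subset n) → ρ * fromℕ n ≤ fromℕ ∣ X ∣ →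
  ½ * d * fromℕ (∣ X ∣ ℕ.* ∣ X ∣) ≤ fromℕ (spannedEdges G X)

-- KNRS property (reals d, ε, ρ rendered as rationals).
KNRS : ∀ {m} → Graph m → Set
KNRS H = (d ε : ℚ) → 0ℚ < d → 0ℚ < ε →
  ∃[ ρ ] (0ℚ < ρ × ∃[ N ] (∀ (n : ℕ) → N ℕ.≤ n → (G : Graph n) → IsSimple G →
    IsDense ρ d G → (1ℚ - ε) * (d ^ℚ numEdges H) ≤ t H G))

-- s-subdivision.  Vertices: Fin (m + e * s), e = |E(H)|; the first m are the
-- original vertices, vertex (k , p) of Fin e × Fin s is the p-th internal vertex
-- (p = 0 .. s-1) of the path replacing the k-th edge (a , b), running a → b.
SubdivVertex : ℕ → ℕ → ℕ → Set
SubdivVertex m e s = Fin m ⊎ (Fin e × Fin s)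

subdivAdj : ∀ {m} (H : Graph m) (s : ℕ) →
  SubdivVertex m (numEdges H) s → SubdivVertex m (numEdges H) s → Bool
subdivAdj H s (inj₁ i) (inj₁ j) = false
subdivAdj H s (inj₁ i) (inj₂ (k , p)) =
  ((toℕ p ≡ᵇ 0) ∧ eqFin i (proj₁ (lookup (edgeList H) k)))
  ∨ ((suc (toℕ p) ≡ᵇ s) ∧ eqFin i (proj₂ (lookup (edgeList H) k)))
subdivAdj H s (inj₂ (k , p)) (inj₁ j) =
  ((toℕ p ≡ᵇ 0) ∧ eqFin j (proj₁ (lookup (edgeList H) k)))
  ∨ ((suc (toℕ p) ≡ᵇ s) ∧ eqFin j (proj₂ (lookup (edgeList H) k)))
subdivAdj H s (inj₂ (k , p)) (inj₂ (k' , p')) =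
  eqFin k k' ∧ ((suc (toℕ p) ≡ᵇ toℕ p') ∨ (suc (toℕ p') ≡ᵇ toℕ p))

decode : ∀ {m} e s → Fin (m ℕ.+ e ℕ.* s) → SubdivVertex m e s
decode {m} e s v with splitAt m v
... | inj₁ i = inj₁ i
... | inj₂ w = inj₂ (remQuot {e} s w)

subdivision : (s : ℕ) → ∀ {m} (H : Graph m) → Graph (m ℕ.+ numEdges H ℕ.* s)
subdivision s H v w = subdivAdj H s (decode (numEdges H) s v) (decode (numEdges H) s w)

{-# OPTIONS --safe #-}
module Submission where

-- Let T be the normalised adjacency operator of G and δ = T^k 1 the density of walks of length k.
-- A path of length 2k+1 is an edge with two walks of length k attached to its ends, so, H being
-- r-regular, t(H^(2k), G) is the integral of ∏ δ(x_i)^r ∏ q(x_i, x_j), where q(x, y) is the probability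
-- that the endpoints of random k-walks from x and y are adjacent.  Local density gives
-- E δ ≥ (d(1-θ))^k, hence E δ^r ≥ (d(1-θ))^(kr).  With respect to the measure proportional to δ^r the
-- kernel q inherits local density from G, because the endpoint of the walk has bounded density.
-- KNRS applies to graphs, so q is realised by a graph: a vertex is a point x together with a label
-- a < s and s independent samples u_0, …, u_{s-1} of walk endpoints, and (x, a, u), (y, b, v) are
-- joined when u_b and v_a are adjacent in G.  Its density of H is that of q up to m²/s, the chance
-- of a repeated label, and it is locally dense because a set of its vertices is, on average over the
-- s samples, almost uncorrelated with a single sample.

open import Defs

-- The number of subdivision vertices is even, so every path has a middle edge rather than a middle
-- vertex, and it is on this edge that the local density of `G` is spent. Regularity makes the walk
-- factors collect at every vertex to one common power, so a single measure serves for all vertices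
-- of `H`, which stay independent. The obstacle is that the hypothesis on `H` concerns 0/1 adjacency
-- under the uniform vertex measure, whereas the argument produces a rational kernel under a
-- non-uniform measure. Both are realised exactly and without choosing a random graph: weights
-- become multiplicities of points, and every possible table of samples occurs as a vertex. A vertex
-- holds one sample for each label of the other vertex because a single sample shared by all its
-- edges would correlate these edges. All means are finite and rational, so Jensen and
-- Cauchy-Schwarz enter as nonnegativity of explicit squares, and error terms are kept as squares
-- instead of roots.

-- Rational arithmetic, powers and Bernoulli's inequality.

module Rationals where
  open import Data.Bool using (Bool; true; false; _∧_)
  open import Data.Nat as ℕ using (ℕ; zero; suc; NonZero)
  import Data.Nat.Properties as ℕP
  open import Data.Integer using (+_)
  import Data.Integer as ℤ
  import Data.Integer.Properties as ℤP
  open import Data.Maybe using (Maybe; just; nothing)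
  open import Data.Product using (_,_; ∃-syntax)
  open import Data.Rational hiding (NonZero)
  open import Data.Rational.Properties
  import Data.Rational.Unnormalised as ℚᵘ
  import Data.Rational.Unnormalised.Properties as ℚᵘP
  open import Data.Sum using (inj₁; inj₂)
  open import Relation.Binary.PropositionalEquality
  open import Relation.Nullary using (yes; no)
  open import Tactic.RingSolver using (solve-∀)
  open import Tactic.RingSolver.Core.AlmostCommutativeRing using (AlmostCommutativeRing; fromCommutativeRing)

  isZero? : (x : ℚ) → Maybe (0ℚ ≡ x)
  isZero? x with 0ℚ ≟ x
  ... | yes p = just p
  ... | no _  = nothing

  ℚ-ring : AlmostCommutativeRing _ _
  ℚ-ring = fromCommutativeRing +-*-commutativeRing isZero?

  -- Most polynomial inequalities below go through this: the difference is exhibited as an explicit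
  -- nonnegative `x`, and the identity is left to the ring solver.
  ≤-add : ∀ {a b x} → 0ℚ ≤ x → b ≡ a + x → a ≤ b
  ≤-add {a} {b} {x} 0≤x refl = subst (_≤ a + x) (+-identityʳ a) (+-monoʳ-≤ a 0≤x)

  0≤- : ∀ {a b} → a ≤ b → 0ℚ ≤ b - a
  0≤- {a} {b} a≤b = subst (_≤ b - a) (+-inverseʳ a) (+-monoˡ-≤ (- a) a≤b)

  0≤-⁻¹ : ∀ {a b} → 0ℚ ≤ b - a → a ≤ b
  0≤-⁻¹ {a} {b} h = ≤-add h (eq a b)
    where
    eq : ∀ a b → b ≡ a + (b - a)
    eq = solve-∀ ℚ-ring

  0≤+ : ∀ {a b} → 0ℚ ≤ a → 0ℚ ≤ b → 0ℚ ≤ a + b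
  0≤+ = +-mono-≤

  *-monoˡ : ∀ {a b c} → 0ℚ ≤ c → a ≤ b → c * a ≤ c * b
  *-monoˡ {c = c} 0≤c = *-monoˡ-≤-nonNeg c {{nonNegative 0≤c}}

  *-monoʳ : ∀ {a b c} → 0ℚ ≤ c → a ≤ b → a * c ≤ b * c
  *-monoʳ {c = c} 0≤c = *-monoʳ-≤-nonNeg c {{nonNegative 0≤c}}

  0≤* : ∀ {a b} → 0ℚ ≤ a → 0ℚ ≤ b → 0ℚ ≤ a * b
  0≤* {a} {b} 0≤a 0≤b = subst (_≤ a * b) (*-zeroʳ a) (*-monoˡ 0≤a 0≤b)

  0<* : ∀ {a b} → 0ℚ < a → 0ℚ < b → 0ℚ < a * b
  0<* {a} {b} 0<a 0<b = subst (_< a * b) (*-zeroʳ a) (*-monoʳ-<-pos a {{positive 0<a}} 0<b)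

  *-mono : ∀ {a b c d} → 0ℚ ≤ a → a ≤ b → 0ℚ ≤ c → c ≤ d → a * c ≤ b * d
  *-mono 0≤a a≤b 0≤c c≤d = ≤-trans (*-monoʳ 0≤c a≤b) (*-monoˡ (≤-trans 0≤a a≤b) c≤d)

  *-cancelˡ-≤ : ∀ {a b c} → 0ℚ < c → c * a ≤ c * b → a ≤ b
  *-cancelˡ-≤ {c = c} 0<c = *-cancelˡ-≤-pos c {{positive 0<c}}

  *-≤1 : ∀ {a b} → 0ℚ ≤ a → a ≤ 1ℚ → 0ℚ ≤ b → b ≤ 1ℚ → a * b ≤ 1ℚ
  *-≤1 = *-mono

  *-≤ˡ : ∀ {a b} → 0ℚ ≤ a → b ≤ 1ℚ → a * b ≤ a
  *-≤ˡ {a} {b} 0≤a b≤1 = subst (a * b ≤_) (*-identityʳ a) (*-monoˡ 0≤a b≤1)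

  *-≤ʳ : ∀ {a b} → 0ℚ ≤ b → a ≤ 1ℚ → a * b ≤ b
  *-≤ʳ {a} {b} 0≤b a≤1 = subst (a * b ≤_) (*-identityˡ b) (*-monoʳ 0≤b a≤1)

  0≤² : ∀ a → 0ℚ ≤ a * a
  0≤² a with ≤-total 0ℚ a
  ... | inj₁ 0≤a = 0≤* 0≤a 0≤a
  ... | inj₂ a≤0 = subst (0ℚ ≤_) (neg² a) (0≤* (neg-antimono-≤ a≤0) (neg-antimono-≤ a≤0))
    where
    neg² : ∀ a → (- a) * (- a) ≡ a * a
    neg² = solve-∀ ℚ-ring

  ²-≤1 : ∀ {a} → - 1ℚ ≤ a → a ≤ 1ℚ → a * a ≤ 1ℚ
  ²-≤1 {a} l u = ≤-add (0≤* (0≤- l) (0≤- u)) (eq a)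
    where
    eq : ∀ a → 1ℚ ≡ a * a + (a - (- 1ℚ)) * (1ℚ - a)
    eq = solve-∀ ℚ-ring

  0≤1 : 0ℚ ≤ 1ℚ
  0≤1 = nonNegative⁻¹ 1ℚ

  0≤½ : 0ℚ ≤ ½
  0≤½ = nonNegative⁻¹ ½

  0<½ : 0ℚ < ½
  0<½ = positive⁻¹ ½

  toℚᵘ-fromℕ : ∀ a → toℚᵘ (fromℕ a) ℚᵘ.≃ ℚᵘ.mkℚᵘ (+ a) 0
  toℚᵘ-fromℕ a = toℚᵘ-fromℚᵘ (ℚᵘ.mkℚᵘ (+ a) 0)

  fromℕ-+ : ∀ a b → fromℕ (a ℕ.+ b) ≡ fromℕ a + fromℕ b
  fromℕ-+ a b = toℚᵘ-injective (ℚᵘP.≃-trans (toℚᵘ-fromℕ (a ℕ.+ b))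
    (ℚᵘP.≃-trans (ℚᵘ.*≡* eq) (ℚᵘP.≃-sym
      (ℚᵘP.≃-trans (toℚᵘ-homo-+ (fromℕ a) (fromℕ b)) (ℚᵘP.+-cong (toℚᵘ-fromℕ a) (toℚᵘ-fromℕ b))))))
    where
    eq : (+ (a ℕ.+ b)) ℤ.* (+ 1) ≡ ((+ a) ℤ.* (+ 1) ℤ.+ (+ b) ℤ.* (+ 1)) ℤ.* (+ 1)
    eq = cong (ℤ._* (+ 1)) (sym (cong₂ ℤ._+_ (ℤP.*-identityʳ (+ a)) (ℤP.*-identityʳ (+ b))))

  fromℕ-* : ∀ a b → fromℕ (a ℕ.* b) ≡ fromℕ a * fromℕ b
  fromℕ-* a b = toℚᵘ-injective (ℚᵘP.≃-trans (toℚᵘ-fromℕ (a ℕ.* b))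
    (ℚᵘP.≃-trans (ℚᵘ.*≡* (cong (ℤ._* (+ 1)) (ℤP.pos-* a b))) (ℚᵘP.≃-sym
      (ℚᵘP.≃-trans (toℚᵘ-homo-* (fromℕ a) (fromℕ b)) (ℚᵘP.*-cong (toℚᵘ-fromℕ a) (toℚᵘ-fromℕ b))))))

  fromℕ-injective : ∀ {a b} → fromℕ a ≡ fromℕ b → a ≡ b
  fromℕ-injective {a} {b} eq = ℤP.+-injective (trans (sym (ℤP.*-identityʳ (+ a)))
    (trans (ℚᵘP.drop-*≡* (ℚᵘP.≃-trans (ℚᵘP.≃-sym (toℚᵘ-fromℕ a))
      (ℚᵘP.≃-trans (toℚᵘ-cong eq) (toℚᵘ-fromℕ b)))) (ℤP.*-identityʳ (+ b))))

  /-fromℕ : ∀ a b → ((+ a) / suc b) * fromℕ (suc b) ≡ fromℕ a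
  /-fromℕ a b = toℚᵘ-injective (ℚᵘP.≃-trans (toℚᵘ-homo-* ((+ a) / suc b) (fromℕ (suc b)))
    (ℚᵘP.≃-trans (ℚᵘP.*-cong (toℚᵘ-fromℚᵘ (ℚᵘ.mkℚᵘ (+ a) b)) (toℚᵘ-fromℕ (suc b)))
    (ℚᵘP.≃-trans (ℚᵘ.*≡* (trans (ℤP.*-identityʳ ((+ a) ℤ.* (+ suc b)))
       (cong (λ z → (+ a) ℤ.* (+ z)) (sym (ℕP.*-identityʳ (suc b))))))
    (ℚᵘP.≃-sym (toℚᵘ-fromℕ a)))))

  -- Opaque copies of fromℕ and of division, which unfold to gcd computations; recip 0 = 0.
  opaque
    ι : ℕ → ℚ
    ι = fromℕ

    ι-fromℕ : ∀ n → ι n ≡ fromℕ n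
    ι-fromℕ n = refl

    recip : ℕ → ℚ
    recip zero    = 0ℚ
    recip (suc n) = (+ 1) / suc n

    recip-0 : recip 0 ≡ 0ℚ
    recip-0 = refl

    recip-1 : recip 1 ≡ 1ℚ
    recip-1 = refl

    ι-0 : ι 0 ≡ 0ℚ
    ι-0 = refl

    ι-1 : ι 1 ≡ 1ℚ
    ι-1 = refl

    ι-+ : ∀ a b → ι (a ℕ.+ b) ≡ ι a + ι b
    ι-+ = fromℕ-+

    ι-* : ∀ a b → ι (a ℕ.* b) ≡ ι a * ι b
    ι-* = fromℕ-*

    ι-injective : ∀ {a b} → ι a ≡ ι b → a ≡ b
    ι-injective = fromℕ-injective

    /-ι : ∀ a b → ((+ a) / suc b) * ι (suc b) ≡ ι a
    /-ι = /-fromℕ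

    recip-inverse : ∀ n .{{_ : NonZero n}} → recip n * ι n ≡ 1ℚ
    recip-inverse (suc n) = /-ι 1 n

  ι-suc : ∀ a → ι (suc a) ≡ 1ℚ + ι a
  ι-suc a = trans (ι-+ 1 a) (cong (_+ ι a) ι-1)

  0≤ι : ∀ a → 0ℚ ≤ ι a
  0≤ι zero = ≤-reflexive (sym ι-0)
  0≤ι (suc a) = subst (0ℚ ≤_) (sym (ι-suc a)) (0≤+ 0≤1 (0≤ι a))

  ι-mono : ∀ {a b} → a ℕ.≤ b → ι a ≤ ι b
  ι-mono {a} {b} a≤b = ≤-add (0≤ι (b ℕ.∸ a))
    (trans (cong ι (sym (ℕP.m+[n∸m]≡n a≤b))) (ι-+ a (b ℕ.∸ a)))

  1≤ι : ∀ n .{{_ : NonZero n}} → 1ℚ ≤ ι n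
  1≤ι (suc n) = subst (_≤ ι (suc n)) ι-1 (ι-mono {1} {suc n} (ℕ.s≤s ℕ.z≤n))

  0<ι : ∀ n .{{_ : NonZero n}} → 0ℚ < ι n
  0<ι n = <-≤-trans (positive⁻¹ 1ℚ) (1≤ι n)

  ι-recip : ∀ n .{{_ : NonZero n}} → ι n * recip n ≡ 1ℚ
  ι-recip n = trans (*-comm (ι n) (recip n)) (recip-inverse n)

  recip-unique : ∀ n .{{_ : NonZero n}} x {y} → x * ι n ≡ y → x ≡ y * recip n
  recip-unique n x refl = trans (sym (*-identityʳ x)) (trans (cong (x *_) (sym (recip-inverse n)))
    (eq x (recip n) (ι n)))
    where
    eq : ∀ x r n → x * (r * n) ≡ x * n * r
    eq = solve-∀ ℚ-ring

  ratio-recip : ∀ a b → ratio a b ≡ ι a * recip b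
  ratio-recip a zero    = sym (trans (cong (ι a *_) recip-0) (*-zeroʳ (ι a)))
  ratio-recip a (suc b) = recip-unique (suc b) ((+ a) / suc b) (/-ι a b)

  0≤recip : ∀ n → 0ℚ ≤ recip n
  0≤recip zero    = ≤-reflexive (sym recip-0)
  0≤recip n@(suc _) = *-cancelˡ-≤ (0<ι n) (subst₂ _≤_ (sym (*-zeroʳ (ι n))) (sym (ι-recip n)) 0≤1)

  recip-* : ∀ a b → recip (a ℕ.* b) ≡ recip a * recip b
  recip-* zero b = trans recip-0 (sym (trans (cong (_* recip b) recip-0) (*-zeroˡ (recip b))))
  recip-* a@(suc _) zero = trans (trans (cong recip (ℕP.*-zeroʳ a)) recip-0)
    (sym (trans (cong (recip a *_) recip-0) (*-zeroʳ (recip a))))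
  recip-* a@(suc _) b@(suc _) = trans (sym (*-identityˡ _)) (sym (recip-unique (a ℕ.* b) (recip a * recip b)
    (trans (cong (recip a * recip b *_) (ι-* a b))
    (trans (eq (recip a) (recip b) (ι a) (ι b))
      (cong₂ _*_ (recip-inverse a) (recip-inverse b))))))
    where
    eq : ∀ x y a b → x * y * (a * b) ≡ (x * a) * (y * b)
    eq = solve-∀ ℚ-ring

  recip-antitone : ∀ {a b} .{{_ : NonZero a}} → a ℕ.≤ b → recip b ≤ recip a
  recip-antitone {a@(suc _)} {b@(suc _)} a≤b = *-cancelˡ-≤ (0<* (0<ι a) (0<ι b))
    (subst₂ _≤_ (sym (trans (eq (ι a) (ι b) (recip b))
                  (trans (cong (_* ι a) (recip-inverse b)) (*-identityˡ _))))
                (sym (trans (eq′ (ι a) (ι b) (recip a))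
                  (trans (cong (_* ι b) (recip-inverse a)) (*-identityˡ _))))
      (ι-mono a≤b))
    where
    eq : ∀ a b r → a * b * r ≡ (r * b) * a
    eq = solve-∀ ℚ-ring
    eq′ : ∀ a b r → a * b * r ≡ (r * a) * b
    eq′ = solve-∀ ℚ-ring

  -- A positive rational has numerator at least 1, so the reciprocal of its own denominator is
  -- already small enough. The field `d` stores the denominator minus one.
  archimedean : ∀ {q} → 0ℚ < q → ∃[ n ] (recip (suc n) ≤ q)
  archimedean {mkℚ (+ zero) d c} 0<q with () ← positive 0<q
  archimedean {q@(mkℚ (+ suc k) d c)} 0<q = d , *-cancelˡ-≤ (0<ι (suc d))
    (subst₂ _≤_ (sym (ι-recip (suc d)))
      (trans (sym (/-ι (suc k) d)) (trans (cong (_* ι (suc d)) (↥p/↧p≡p q)) (*-comm q (ι (suc d)))))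
      (1≤ι (suc k)))
  archimedean {mkℚ ℤ.-[1+ k ] d c} 0<q with () ← positive 0<q

  0≤^ : ∀ {x} k → 0ℚ ≤ x → 0ℚ ≤ x ^ℚ k
  0≤^ zero    0≤x = 0≤1
  0≤^ (suc k) 0≤x = 0≤* 0≤x (0≤^ k 0≤x)

  0<^ : ∀ {x} k → 0ℚ < x → 0ℚ < x ^ℚ k
  0<^ zero    0<x = positive⁻¹ 1ℚ
  0<^ (suc k) 0<x = 0<* 0<x (0<^ k 0<x)

  ^-≤1 : ∀ {x} k → 0ℚ ≤ x → x ≤ 1ℚ → x ^ℚ k ≤ 1ℚ
  ^-≤1 zero    0≤x x≤1 = ≤-refl
  ^-≤1 (suc k) 0≤x x≤1 = *-≤1 0≤x x≤1 (0≤^ k 0≤x) (^-≤1 k 0≤x x≤1)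

  ^-mono : ∀ {x y} k → 0ℚ ≤ x → x ≤ y → x ^ℚ k ≤ y ^ℚ k
  ^-mono zero    0≤x x≤y = ≤-refl
  ^-mono (suc k) 0≤x x≤y = *-mono 0≤x x≤y (0≤^ k 0≤x) (^-mono k 0≤x x≤y)

  ^-antitone : ∀ {x} {j k} → 0ℚ ≤ x → x ≤ 1ℚ → j ℕ.≤ k → x ^ℚ k ≤ x ^ℚ j
  ^-antitone {k = k} 0≤x x≤1 ℕ.z≤n = ^-≤1 k 0≤x x≤1
  ^-antitone 0≤x x≤1 (ℕ.s≤s j≤k) = *-monoˡ 0≤x (^-antitone 0≤x x≤1 j≤k)

  ^-+ : ∀ x j k → x ^ℚ (j ℕ.+ k) ≡ (x ^ℚ j) * (x ^ℚ k)
  ^-+ x zero    k = sym (*-identityˡ (x ^ℚ k))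
  ^-+ x (suc j) k = trans (cong (x *_) (^-+ x j k)) (sym (*-assoc x _ _))

  ^-* : ∀ x j k → x ^ℚ (j ℕ.* k) ≡ (x ^ℚ k) ^ℚ j
  ^-* x zero    k = refl
  ^-* x (suc j) k = trans (^-+ x k (j ℕ.* k)) (cong ((x ^ℚ k) *_) (^-* x j k))

  *-^ : ∀ x y k → (x * y) ^ℚ k ≡ (x ^ℚ k) * (y ^ℚ k)
  *-^ x y zero    = refl
  *-^ x y (suc k) = trans (cong (x * y *_) (*-^ x y k)) (eq x y (x ^ℚ k) (y ^ℚ k))
    where
    eq : ∀ x y a b → x * y * (a * b) ≡ x * a * (y * b)
    eq = solve-∀ ℚ-ring

  ι-^ : ∀ a k → ι (a ℕ.^ k) ≡ ι a ^ℚ k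
  ι-^ a zero    = ι-1
  ι-^ a (suc k) = trans (ι-* a (a ℕ.^ k)) (cong (ι a *_) (ι-^ a k))

  bernoulli : ∀ {x} → 0ℚ ≤ x → x ≤ 1ℚ → ∀ k → 1ℚ - ι k * x ≤ (1ℚ - x) ^ℚ k
  bernoulli {x} 0≤x x≤1 zero = ≤-reflexive (trans (cong (λ z → 1ℚ - z * x) ι-0) (eq x))
    where
    eq : ∀ x → 1ℚ - 0ℚ * x ≡ 1ℚ
    eq = solve-∀ ℚ-ring
  bernoulli {x} 0≤x x≤1 (suc k) = ≤-trans
    (≤-add (0≤* (0≤ι k) (0≤² x)) (trans (eq x (ι k)) (cong (λ z → 1ℚ - z * x + ι k * (x * x)) (sym (ι-suc k)))))
    (*-monoˡ (0≤- x≤1) (bernoulli 0≤x x≤1 k))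
    where
    eq : ∀ x k → (1ℚ - x) * (1ℚ - k * x) ≡ 1ℚ - (1ℚ + k) * x + k * (x * x)
    eq = solve-∀ ℚ-ring

  χ : Bool → ℚ
  χ true  = 1ℚ
  χ false = 0ℚ

  0≤χ : ∀ b → 0ℚ ≤ χ b
  0≤χ true  = 0≤1
  0≤χ false = ≤-refl

  χ≤1 : ∀ b → χ b ≤ 1ℚ
  χ≤1 true  = ≤-refl
  χ≤1 false = 0≤1

  χ-∧ : ∀ a b → χ (a ∧ b) ≡ χ a * χ b
  χ-∧ true  b = sym (*-identityˡ (χ b))
  χ-∧ false b = sym (*-zeroˡ (χ b))

-- Finite sums and products over lists.

module BigOperators where
  open import Algebra.Structures using (IsCommutativeMonoid)
  open import Data.Bool using (Bool; true; false; _∧_; if_then_else_)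
  open import Data.Fin using (Fin; zero; suc; toℕ; _↑ˡ_; _↑ʳ_; combine)
  open import Data.List using (List; []; _∷_; _++_; map; concatMap; allFin; length; lookup)
  open import Data.List.Properties using (map-tabulate)
  open import Data.Nat as ℕ using (ℕ; zero; suc; _<ᵇ_)
  import Data.Fin.Properties as FinP
  import Data.Nat.Properties as ℕP
  open import Data.Product using (_×_; _,_; proj₁; proj₂)
  open import Function using (_∘_; id)
  open import Relation.Binary.PropositionalEquality
  open import Relation.Binary.Definitions using (tri<; tri≈; tri>)
  open import Data.Unit using (tt)
  open import Data.Empty using (⊥-elim)
  open import Relation.Nullary using (¬_)

  <ᵇ-true : ∀ {a b} → a ℕ.< b → (a <ᵇ b) ≡ true
  <ᵇ-true {a} {b} a<b with a <ᵇ b | ℕP.<⇒<ᵇ a<b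
  ... | true | _ = refl

  <ᵇ-false : ∀ {a b} → ¬ (a ℕ.< b) → (a <ᵇ b) ≡ false
  <ᵇ-false {a} {b} a≮b with a <ᵇ b in eq
  ... | true  = ⊥-elim (a≮b (ℕP.<ᵇ⇒< a b (subst Data.Bool.T (sym eq) tt)))
  ... | false = refl

  allFin-suc : ∀ n → allFin (suc n) ≡ zero ∷ map suc (allFin n)
  allFin-suc n = cong (zero ∷_) (sym (map-tabulate id suc))

  -- Generic in the commutative monoid so that the rearrangements of edge sums, used for counting
  -- edges, also serve the edge products that occur in homomorphism counts.
  module Big {C : Set} (_∙_ : C → C → C) (ε : C) (isCM : IsCommutativeMonoid _≡_ _∙_ ε) where
    open IsCommutativeMonoid isCM using (assoc; comm; identityˡ; identityʳ)

    big : ∀ {A : Set} → List A → (A → C) → C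
    big []       f = ε
    big (x ∷ xs) f = f x ∙ big xs f

    interchange : ∀ a b c d → (a ∙ b) ∙ (c ∙ d) ≡ (a ∙ c) ∙ (b ∙ d)
    interchange a b c d = trans (assoc a b (c ∙ d)) (trans (cong (a ∙_)
      (trans (sym (assoc b c d)) (trans (cong (_∙ d) (comm b c)) (assoc c b d)))) (sym (assoc a c (b ∙ d))))

    big-cong : ∀ {A : Set} (xs : List A) {f g : A → C} → (∀ x → f x ≡ g x) → big xs f ≡ big xs g
    big-cong []       h = refl
    big-cong (x ∷ xs) h = cong₂ _∙_ (h x) (big-cong xs h)

    big-ε : ∀ {A : Set} (xs : List A) → big xs (λ _ → ε) ≡ ε
    big-ε []       = refl
    big-ε (x ∷ xs) = trans (identityˡ _) (big-ε xs)

    big-∙ : ∀ {A : Set} (xs : List A) (f g : A → C) → big xs (λ x → f x ∙ g x) ≡ big xs f ∙ big xs g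
    big-∙ []       f g = sym (identityˡ ε)
    big-∙ (x ∷ xs) f g = trans (cong (_ ∙_) (big-∙ xs f g)) (interchange _ _ _ _)

    big-swap : ∀ {A B : Set} (xs : List A) (ys : List B) (f : A → B → C) →
      big xs (λ x → big ys (f x)) ≡ big ys (λ y → big xs (λ x → f x y))
    big-swap []       ys f = sym (big-ε ys)
    big-swap (x ∷ xs) ys f = trans (cong (_ ∙_) (big-swap xs ys f))
      (sym (big-∙ ys (f x) (λ y → big xs (λ x → f x y))))

    big-++ : ∀ {A : Set} (xs ys : List A) (f : A → C) → big (xs ++ ys) f ≡ big xs f ∙ big ys f
    big-++ []       ys f = sym (identityˡ _)
    big-++ (x ∷ xs) ys f = trans (cong (_ ∙_) (big-++ xs ys f)) (sym (assoc _ _ _))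

    big-map : ∀ {A B : Set} (g : A → B) (xs : List A) (f : B → C) → big (map g xs) f ≡ big xs (f ∘ g)
    big-map g []       f = refl
    big-map g (x ∷ xs) f = cong (_ ∙_) (big-map g xs f)

    big-concatMap : ∀ {A B : Set} (g : A → List B) (xs : List A) (f : B → C) →
      big (concatMap g xs) f ≡ big xs (λ x → big (g x) f)
    big-concatMap g []       f = refl
    big-concatMap g (x ∷ xs) f = trans (big-++ (g x) (concatMap g xs) f) (cong (_ ∙_) (big-concatMap g xs f))

    big-allFin-suc : ∀ n (f : Fin (suc n) → C) → big (allFin (suc n)) f ≡ f zero ∙ big (allFin n) (f ∘ suc)
    big-allFin-suc n f = trans (cong (λ xs → big xs f) (allFin-suc n)) (cong (f zero ∙_) (big-map suc (allFin n) f))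

    big-allFin-+ : ∀ m n (f : Fin (m ℕ.+ n) → C) →
      big (allFin (m ℕ.+ n)) f ≡ big (allFin m) (λ i → f (i ↑ˡ n)) ∙ big (allFin n) (λ j → f (m ↑ʳ j))
    big-allFin-+ zero    n f = sym (identityˡ _)
    big-allFin-+ (suc m) n f = trans (big-allFin-suc (m ℕ.+ n) f)
      (trans (cong (f zero ∙_) (big-allFin-+ m n (f ∘ suc))) (trans (sym (assoc _ _ _))
        (cong (_∙ big (allFin n) (λ j → f (suc m ↑ʳ j))) (sym (big-allFin-suc m (λ i → f (i ↑ˡ n)))))))

    big-allFin-* : ∀ m n (f : Fin (m ℕ.* n) → C) →
      big (allFin (m ℕ.* n)) f ≡ big (allFin m) (λ i → big (allFin n) (λ j → f (combine i j)))
    big-allFin-* zero    n f = refl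
    big-allFin-* (suc m) n f = trans (big-allFin-+ n (m ℕ.* n) f)
      (trans (cong (big (allFin n) (λ j → f (j ↑ˡ (m ℕ.* n))) ∙_) (big-allFin-* m n (λ j → f (n ↑ʳ j))))
        (sym (big-allFin-suc m (λ i → big (allFin n) (λ j → f (combine i j))))))

    big-lookup : ∀ {A : Set} (xs : List A) (f : A → C) → big (allFin (length xs)) (f ∘ lookup xs) ≡ big xs f
    big-lookup []       f = refl
    big-lookup (x ∷ xs) f = trans (big-allFin-suc (length xs) (f ∘ lookup (x ∷ xs))) (cong (f x ∙_) (big-lookup xs f))

    big-edgeList : ∀ {n} (G : Graph n) (f : Fin n × Fin n → C) → big (edgeList G) f ≡
      big (allFin n) (λ i → big (allFin n) (λ j → if G i j ∧ (toℕ i <ᵇ toℕ j) then f (i , j) else ε))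
    big-edgeList {n} G f = trans (big-concatMap _ (allFin n) f) (big-cong (allFin n) λ i →
      trans (big-concatMap _ (allFin n) f) (big-cong (allFin n) λ j → single i j (G i j ∧ (toℕ i <ᵇ toℕ j))))
      where
      single : ∀ i j b → big (if b then (i , j) ∷ [] else []) f ≡ (if b then f (i , j) else ε)
      single i j true  = identityʳ _
      single i j false = refl

    -- The edge list holds each edge once, oriented upwards. Its two orientations fill the cells
    -- above and below the diagonal of the adjacency matrix, and the diagonal is empty because there
    -- are no loops.
    big-edges : ∀ {n} (G : Graph n) → IsSimple G → (h : Fin n → Fin n → C) →
      big (edgeList G) (λ e → h (proj₁ e) (proj₂ e) ∙ h (proj₂ e) (proj₁ e)) ≡
      big (allFin n) (λ i → big (allFin n) (λ j → if G i j then h i j else ε))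
    big-edges {n} G (G-sym , G-irr) h = begin
      big (edgeList G) (λ e → h (proj₁ e) (proj₂ e) ∙ h (proj₂ e) (proj₁ e))
        ≡⟨ big-∙ (edgeList G) _ _ ⟩
      big (edgeList G) (λ e → h (proj₁ e) (proj₂ e)) ∙ big (edgeList G) (λ e → h (proj₂ e) (proj₁ e))
        ≡⟨ cong₂ _∙_ (big-edgeList G _) (trans (big-edgeList G _) (big-swap (allFin n) (allFin n) _)) ⟩
      big (allFin n) (λ i → big (allFin n) (λ j → lt i j)) ∙ big (allFin n) (λ i → big (allFin n) (λ j → gt i j))
        ≡⟨ sym (big-∙ (allFin n) _ _) ⟩
      big (allFin n) (λ i → big (allFin n) (lt i) ∙ big (allFin n) (gt i))
        ≡⟨ big-cong (allFin n) (λ i → trans (sym (big-∙ (allFin n) _ _)) (big-cong (allFin n) (cell i))) ⟩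
      big (allFin n) (λ i → big (allFin n) (λ j → if G i j then h i j else ε)) ∎
      where
      open ≡-Reasoning
      lt gt : Fin n → Fin n → C
      lt i j = if G i j ∧ (toℕ i <ᵇ toℕ j) then h i j else ε
      gt i j = if G j i ∧ (toℕ j <ᵇ toℕ i) then h i j else ε
      cell : ∀ i j → lt i j ∙ gt i j ≡ (if G i j then h i j else ε)
      cell i j with ℕP.<-cmp (toℕ i) (toℕ j)
      cell i j | tri< i<j _ j≮i
        rewrite G-sym j i | <ᵇ-true i<j | <ᵇ-false j≮i with G i j
      ... | true  = identityʳ _
      ... | false = identityʳ _
      cell i j | tri> i≮j _ j<i
        rewrite G-sym j i | <ᵇ-true j<i | <ᵇ-false i≮j with G i j
      ... | true  = identityˡ _
      ... | false = identityʳ _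
      cell i j | tri≈ i≮j i≡j _ with FinP.toℕ-injective i≡j
      ... | refl rewrite G-irr i = identityʳ _

-- Expectations: uniform, product and power means.

module Means where
  open import Data.Bool using (Bool; true; false)
  open import Data.Fin using (Fin; zero; suc; combine)
  open import Data.List using (List; []; _∷_; map; allFin; length)
  open import Data.List.Properties using (length-tabulate)
  open import Data.Nat as ℕ using (ℕ; zero; suc; NonZero)
  import Data.Nat.Properties as ℕP
  open import Data.Product using (_×_; _,_)
  open import Data.Rational hiding (NonZero)
  open import Data.Rational.Properties
  open import Data.Vec using (Vec; []; _∷_; lookup; _[_]≔_)
  open import Function using (_∘_; id)
  open import Relation.Binary.PropositionalEquality
  open import Tactic.RingSolver using (solve-∀)
  open Rationals
  open BigOperators

  open Big _+_ 0ℚ +-0-isCommutativeMonoid public using () renaming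
    ( big to ∑; big-cong to ∑-cong; big-ε to ∑-0; big-∙ to ∑-+; big-swap to ∑-swap; big-concatMap to ∑-concatMap
    ; big-allFin-suc to ∑-allFin-suc; big-allFin-+ to ∑-allFin-+; big-allFin-* to ∑-allFin-*
    ; big-lookup to ∑-lookup; big-edges to ∑-edges; big-map to ∑-map )
  open Big _*_ 1ℚ *-1-isCommutativeMonoid public using () renaming
    ( big to ∏; big-cong to ∏-cong; big-∙ to ∏-*; big-edges to ∏-edges
    ; big-allFin-suc to ∏-allFin-suc; big-lookup to ∏-lookup )

  ∑-*ˡ : ∀ {A : Set} (xs : List A) c (f : A → ℚ) → ∑ xs (λ x → c * f x) ≡ c * ∑ xs f
  ∑-*ˡ []       c f = sym (*-zeroʳ c)
  ∑-*ˡ (x ∷ xs) c f = trans (cong (c * f x +_) (∑-*ˡ xs c f)) (sym (*-distribˡ-+ c (f x) (∑ xs f)))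

  ∑-mono : ∀ {A : Set} (xs : List A) {f g : A → ℚ} → (∀ x → f x ≤ g x) → ∑ xs f ≤ ∑ xs g
  ∑-mono []       h = ≤-refl
  ∑-mono (x ∷ xs) h = +-mono-≤ (h x) (∑-mono xs h)

  0≤∑ : ∀ {A : Set} (xs : List A) {f : A → ℚ} → (∀ x → 0ℚ ≤ f x) → 0ℚ ≤ ∑ xs f
  0≤∑ xs {f} h = subst (_≤ ∑ xs f) (∑-0 xs) (∑-mono xs h)

  ∑-1 : ∀ {A : Set} (xs : List A) → ∑ xs (λ _ → 1ℚ) ≡ ι (length xs)
  ∑-1 []       = sym ι-0
  ∑-1 (x ∷ xs) = trans (cong (1ℚ +_) (∑-1 xs)) (sym (ι-suc (length xs)))

  ∑-allFin-1 : ∀ n → ∑ (allFin n) (λ _ → 1ℚ) ≡ ι n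
  ∑-allFin-1 n = trans (∑-1 (allFin n)) (cong ι (length-tabulate id))

  ∑-const : ∀ n c → ∑ (allFin n) (λ _ → c) ≡ ι n * c
  ∑-const n c = trans (∑-cong (allFin n) (λ _ → sym (*-identityʳ c)))
    (trans (∑-*ˡ (allFin n) c (λ _ → 1ℚ)) (trans (cong (c *_) (∑-allFin-1 n)) (*-comm c (ι n))))

  ∑-eqFin : ∀ {n} (i : Fin n) (f : Fin n → ℚ) → ∑ (allFin n) (λ j → χ (eqFin i j) * f j) ≡ f i
  ∑-eqFin {suc n} zero f = trans (∑-allFin-suc n (λ j → χ (eqFin zero j) * f j)) (trans (cong₂ _+_ (*-identityˡ (f zero))
    (trans (∑-cong (allFin n) (λ j → *-zeroˡ (f (suc j)))) (∑-0 (allFin n)))) (+-identityʳ (f zero)))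
  ∑-eqFin {suc n} (suc i) f = trans (∑-allFin-suc n (λ j → χ (eqFin (suc i) j) * f j))
    (trans (cong₂ _+_ (*-zeroˡ (f zero)) (∑-eqFin i (f ∘ suc))) (+-identityˡ _))

  ∑-eqFin-1 : ∀ {n} (i : Fin n) → ∑ (allFin n) (λ j → χ (eqFin i j)) ≡ 1ℚ
  ∑-eqFin-1 {n} i = trans (∑-cong (allFin n) (λ j → sym (*-identityʳ _))) (∑-eqFin i (λ _ → 1ℚ))

  countTrue-∑ : ∀ {A : Set} (p : A → Bool) xs → ι (countTrue (map p xs)) ≡ ∑ xs (χ ∘ p)
  countTrue-∑ p []       = ι-0
  countTrue-∑ p (x ∷ xs) with p x
  ... | true  = trans (ι-suc _) (cong (1ℚ +_) (countTrue-∑ p xs))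
  ... | false = trans (countTrue-∑ p xs) (sym (+-identityˡ _))

  allB-∏ : ∀ {A : Set} (p : A → Bool) xs → χ (allB (map p xs)) ≡ ∏ xs (χ ∘ p)
  allB-∏ p []       = refl
  allB-∏ p (x ∷ xs) = trans (χ-∧ (p x) (allB (map p xs))) (cong (χ (p x) *_) (allB-∏ p xs))

  0≤∏ : ∀ {A : Set} (xs : List A) {f : A → ℚ} → (∀ x → 0ℚ ≤ f x) → 0ℚ ≤ ∏ xs f
  0≤∏ []       h = 0≤1
  0≤∏ (x ∷ xs) h = 0≤* (h x) (0≤∏ xs h)

  ∏≤1 : ∀ {A : Set} (xs : List A) {f : A → ℚ} → (∀ x → 0ℚ ≤ f x) → (∀ x → f x ≤ 1ℚ) → ∏ xs f ≤ 1ℚ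
  ∏≤1 []       h k = ≤-refl
  ∏≤1 (x ∷ xs) h k = *-≤1 (h x) (k x) (0≤∏ xs h) (∏≤1 xs h k)

  -- Kept apart from `Mean` because expectations are also exchanged with functionals that are not
  -- normalised, such as the value of `T^ k f` at a point.
  record Linear (A : Set) : Set where
    field
      E      : (A → ℚ) → ℚ
      E-cong : ∀ {f g} → (∀ a → f a ≡ g a) → E f ≡ E g
      E-+    : ∀ f g → E (λ a → f a + g a) ≡ E f + E g
      E-*ˡ   : ∀ c f → E (λ a → c * f a) ≡ c * E f

    E-*ʳ : ∀ f c → E (λ a → f a * c) ≡ E f * c
    E-*ʳ f c = trans (E-cong (λ a → *-comm (f a) c)) (trans (E-*ˡ c f) (*-comm c (E f)))

    E-0 : E (λ _ → 0ℚ) ≡ 0ℚ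
    E-0 = trans (E-cong (λ _ → sym (*-zeroˡ 0ℚ))) (trans (E-*ˡ 0ℚ (λ _ → 0ℚ)) (*-zeroˡ (E (λ _ → 0ℚ))))

    E-neg : ∀ f → E (λ a → - f a) ≡ - E f
    E-neg f = trans (E-cong (λ a → eq (f a))) (trans (E-*ˡ (- 1ℚ) f) (sym (eq (E f))))
      where
      eq : ∀ x → - x ≡ (- 1ℚ) * x
      eq = solve-∀ ℚ-ring

    E-- : ∀ f g → E (λ a → f a - g a) ≡ E f - E g
    E-- f g = trans (E-+ f (λ a → - g a)) (cong (E f +_) (E-neg g))

    E-∑ : ∀ {B : Set} (ys : List B) (f : A → B → ℚ) → E (λ a → ∑ ys (f a)) ≡ ∑ ys (λ y → E (λ a → f a y))
    E-∑ []       f = E-0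
    E-∑ (y ∷ ys) f = trans (E-+ (λ a → f a y) (λ a → ∑ ys (f a))) (cong (E (λ a → f a y) +_) (E-∑ ys f))

  -- Swapping with every linear functional is the Fubini property of finitely supported means.
  record Mean (A : Set) : Set₁ where
    field
      linear : Linear A
    open Linear linear public
    field
      E-mono : ∀ {f g} → (∀ a → f a ≤ g a) → E f ≤ E g
      E-1    : E (λ _ → 1ℚ) ≡ 1ℚ
      E-swap : ∀ {B : Set} (ν : Linear B) (f : A → B → ℚ) →
        E (λ a → Linear.E ν (f a)) ≡ Linear.E ν (λ b → E (λ a → f a b))

    E-const : ∀ c → E (λ _ → c) ≡ c
    E-const c = trans (E-cong (λ _ → sym (*-identityʳ c))) (trans (E-*ˡ c (λ _ → 1ℚ)) (trans (cong (c *_) E-1) (*-identityʳ c)))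

    0≤E : ∀ {f} → (∀ a → 0ℚ ≤ f a) → 0ℚ ≤ E f
    0≤E {f} h = subst (_≤ E f) (E-const 0ℚ) (E-mono h)

    E≤ : ∀ {f c} → (∀ a → f a ≤ c) → E f ≤ c
    E≤ {f} {c} h = subst (E f ≤_) (E-const c) (E-mono h)

    ≤E : ∀ {f c} → (∀ a → c ≤ f a) → c ≤ E f
    ≤E {f} {c} h = subst (_≤ E f) (E-const c) (E-mono h)

    E-affine : ∀ f g x y → E (λ a → x * f a + y * g a) ≡ x * E f + y * E g
    E-affine f g x y = trans (E-+ (λ a → x * f a) (λ a → y * g a)) (cong₂ _+_ (E-*ˡ x f) (E-*ˡ y g))

    -- The slack is the variance of `f`.
    jensen² : ∀ f → E f * E f ≤ E (λ a → f a * f a)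
    jensen² f = ≤-add (0≤E {λ a → (f a - E f) * (f a - E f)} (λ a → 0≤² (f a - E f))) (begin
      E (λ a → f a * f a)                                                     ≡⟨ eq (E (λ a → f a * f a)) (E f) ⟩
      E f * E f + (E (λ a → f a * f a) - (E f + E f) * E f + E f * E f)         ≡⟨ cong (E f * E f +_) (sym (begin
        E (λ a → (f a - E f) * (f a - E f))                                     ≡⟨ E-cong (λ a → eq′ (f a) (E f)) ⟩
        E (λ a → f a * f a - (E f + E f) * f a + E f * E f)                     ≡⟨ E-+ _ _ ⟩
        E (λ a → f a * f a - (E f + E f) * f a) + E (λ _ → E f * E f)           ≡⟨ cong₂ _+_ (E-- (λ a → f a * f a) (λ a → (E f + E f) * f a)) (E-const (E f * E f)) ⟩
        E (λ a → f a * f a) - E (λ a → (E f + E f) * f a) + E f * E f           ≡⟨ cong (λ z → E (λ a → f a * f a) - z + E f * E f) (E-*ˡ (E f + E f) f) ⟩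
        E (λ a → f a * f a) - (E f + E f) * E f + E f * E f                     ∎)) ⟩
      E f * E f + E (λ a → (f a - E f) * (f a - E f))                           ∎)
      where
      open ≡-Reasoning
      eq : ∀ s e → s ≡ e * e + (s - (e + e) * e + e * e)
      eq = solve-∀ ℚ-ring
      eq′ : ∀ x e → (x - e) * (x - e) ≡ x * x - (e + e) * x + e * e
      eq′ = solve-∀ ℚ-ring

  open Mean public

  unif : ∀ n .{{_ : NonZero n}} → Mean (Fin n)
  unif n = record
    { linear = record
      { E      = λ f → recip n * ∑ (allFin n) f
      ; E-cong = λ h → cong (recip n *_) (∑-cong (allFin n) h)
      ; E-+    = λ f g → trans (cong (recip n *_) (∑-+ (allFin n) f g)) (*-distribˡ-+ (recip n) _ _)
      ; E-*ˡ   = λ c f → trans (cong (recip n *_) (∑-*ˡ (allFin n) c f)) (exchange (recip n) c _)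
      }
    ; E-mono = λ h → *-monoˡ (0≤recip n) (∑-mono (allFin n) h)
    ; E-1    = trans (cong (recip n *_) (∑-allFin-1 n)) (recip-inverse n)
    ; E-swap = λ ν f → sym (trans (Linear.E-*ˡ ν (recip n) _)
        (cong (recip n *_) (Linear.E-∑ ν (allFin n) (λ b a → f a b))))
    }
    where
    exchange : ∀ r c s → r * (c * s) ≡ c * (r * s)
    exchange = solve-∀ ℚ-ring

  coin : ∀ p → 0ℚ ≤ p → p ≤ 1ℚ → Mean Bool
  coin p 0≤p p≤1 = record
    { linear = record
      { E      = λ f → p * f true + (1ℚ - p) * f false
      ; E-cong = λ h → cong₂ _+_ (cong (p *_) (h true)) (cong ((1ℚ - p) *_) (h false))
      ; E-+    = λ f g → eq-+ p (f true) (g true) (f false) (g false)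
      ; E-*ˡ   = λ c f → eq-* p c (f true) (f false)
      }
    ; E-mono = λ h → +-mono-≤ (*-monoˡ 0≤p (h true)) (*-monoˡ (0≤- p≤1) (h false))
    ; E-1    = eq-1 p
    ; E-swap = λ ν f → sym (trans (Linear.E-+ ν _ _) (cong₂ _+_ (Linear.E-*ˡ ν p (f true)) (Linear.E-*ˡ ν (1ℚ - p) (f false))))
    }
    where
    eq-+ : ∀ p a b c d → p * (a + b) + (1ℚ - p) * (c + d) ≡ p * a + (1ℚ - p) * c + (p * b + (1ℚ - p) * d)
    eq-+ = solve-∀ ℚ-ring
    eq-* : ∀ p c a b → p * (c * a) + (1ℚ - p) * (c * b) ≡ c * (p * a + (1ℚ - p) * b)
    eq-* = solve-∀ ℚ-ring
    eq-1 : ∀ p → p * 1ℚ + (1ℚ - p) * 1ℚ ≡ 1ℚ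
    eq-1 = solve-∀ ℚ-ring

  _⊗_ : ∀ {A B : Set} → Mean A → Mean B → Mean (A × B)
  μ ⊗ ν = record
    { linear = record
      { E      = λ f → E μ (λ a → E ν (λ b → f (a , b)))
      ; E-cong = λ h → E-cong μ (λ a → E-cong ν (λ b → h (a , b)))
      ; E-+    = λ f g → trans (E-cong μ (λ a → E-+ ν _ _)) (E-+ μ _ _)
      ; E-*ˡ   = λ c f → trans (E-cong μ (λ a → E-*ˡ ν c _)) (E-*ˡ μ c _)
      }
    ; E-mono = λ h → E-mono μ (λ a → E-mono ν (λ b → h (a , b)))
    ; E-1    = trans (E-cong μ (λ _ → E-1 ν)) (E-1 μ)
    ; E-swap = λ ξ f → trans (E-cong μ (λ a → E-swap ν ξ _)) (E-swap μ ξ _)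
    }

  trivial : ∀ {A : Set} → Mean (Vec A 0)
  trivial = record
    { linear = record
      { E      = λ f → f []
      ; E-cong = λ h → h []
      ; E-+    = λ f g → refl
      ; E-*ˡ   = λ c f → refl
      }
    ; E-mono = λ h → h []
    ; E-1    = refl
    ; E-swap = λ ν f → refl
    }

  -- The factors may differ: a random vertex set with prescribed inclusion probabilities is a
  -- product of distinct coins.
  prod : ∀ {A : Set} {n} → (Fin n → Mean A) → Mean (Vec A n)
  prod {n = zero}  μ = trivial
  prod {n = suc n} μ = record
    { linear = record
      { E      = λ f → E (μ zero) (λ a → E ν (λ v → f (a ∷ v)))
      ; E-cong = λ h → E-cong (μ zero) (λ a → E-cong ν (λ v → h (a ∷ v)))
      ; E-+    = λ f g → trans (E-cong (μ zero) (λ a → E-+ ν _ _)) (E-+ (μ zero) _ _)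
      ; E-*ˡ   = λ c f → trans (E-cong (μ zero) (λ a → E-*ˡ ν c _)) (E-*ˡ (μ zero) c _)
      }
    ; E-mono = λ h → E-mono (μ zero) (λ a → E-mono ν (λ v → h (a ∷ v)))
    ; E-1    = trans (E-cong (μ zero) (λ _ → E-1 ν)) (E-1 (μ zero))
    ; E-swap = λ ξ f → trans (E-cong (μ zero) (λ a → E-swap ν ξ _)) (E-swap (μ zero) ξ _)
    }
    where
    ν = prod (μ ∘ suc)

  pow : ∀ {A : Set} → Mean A → ∀ n → Mean (Vec A n)
  pow μ n = prod {n = n} (λ _ → μ)

  E-marginal : ∀ {A : Set} {n} (μ : Fin n → Mean A) i (f : A → ℚ) → E (prod μ) (λ v → f (lookup v i)) ≡ E (μ i) f
  E-marginal μ zero    f = E-cong (μ zero) (λ a → E-const (prod (μ ∘ suc)) (f a))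
  E-marginal μ (suc i) f = trans (E-const (μ zero) _) (E-marginal (μ ∘ suc) i f)

  -- This integrates out one coordinate while all others keep their places, so no splitting of the
  -- vector is needed later.
  E-resample : ∀ {A : Set} {n} (μ : Fin n → Mean A) i (F : Vec A n → ℚ) →
    E (prod μ) F ≡ E (prod μ) (λ v → E (μ i) (λ a → F (v [ i ]≔ a)))
  -- On the right the outermost mean averages over the entry that is about to be overwritten, hence
  -- over a constant.
  E-resample μ zero F = trans (E-swap (μ zero) (linear ν) _)
    (sym (trans (E-const (μ zero) _) refl))
    where ν = prod (μ ∘ suc)
  E-resample μ (suc i) F = E-cong (μ zero) (λ a → E-resample (μ ∘ suc) i (λ v → F (a ∷ v)))

  E-unif-* : ∀ a b .{{_ : NonZero a}} .{{_ : NonZero b}} .{{_ : NonZero (a ℕ.* b)}} (f : Fin (a ℕ.* b) → ℚ) →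
    E (unif (a ℕ.* b)) f ≡ E (unif a) (λ i → E (unif b) (λ j → f (combine i j)))
  E-unif-* a b f = begin
    recip (a ℕ.* b) * ∑ (allFin (a ℕ.* b)) f
      ≡⟨ cong₂ _*_ (recip-* a b) (∑-allFin-* a b f) ⟩
    recip a * recip b * ∑ (allFin a) (λ i → ∑ (allFin b) (λ j → f (combine i j)))
      ≡⟨ *-assoc (recip a) (recip b) _ ⟩
    recip a * (recip b * ∑ (allFin a) (λ i → ∑ (allFin b) (λ j → f (combine i j))))
      ≡⟨ cong (recip a *_) (sym (∑-*ˡ (allFin a) (recip b) _)) ⟩
    recip a * ∑ (allFin a) (λ i → recip b * ∑ (allFin b) (λ j → f (combine i j))) ∎
    where open ≡-Reasoning

  encodeVec : ∀ {n m} → Vec (Fin n) m → Fin (n ℕ.^ m)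
  encodeVec []      = zero
  encodeVec (x ∷ v) = combine x (encodeVec v)

  E-unif-^ : ∀ n m .{{_ : NonZero n}} .{{_ : NonZero (n ℕ.^ m)}} (f : Fin (n ℕ.^ m) → ℚ) →
    E (unif (n ℕ.^ m)) f ≡ E (pow (unif n) m) (f ∘ encodeVec)
  E-unif-^ n zero    f = trans (cong (_* (f zero + 0ℚ)) recip-1) (trans (*-identityˡ _) (+-identityʳ (f zero)))
  E-unif-^ n (suc m) f = trans (E-unif-* n (n ℕ.^ m) f) (E-cong (unif n) (λ i → E-unif-^ n m (λ j → f (combine i j))))
    where instance _ = ℕP.m^n≢0 n m

-- Local density for weight functions.

module WeightedDensity where
  open import Data.Bool using (Bool; true; false; _∧_; if_then_else_)
  open import Data.Empty using (⊥-elim)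
  open import Data.Fin using (Fin; zero; suc)
  import Data.Fin.Properties as FinP
  open import Data.Fin.Subset using (Subset; ∣_∣)
  open import Data.List using (allFin)
  open import Data.Nat as ℕ using (ℕ; zero; suc; NonZero)
  open import Data.Product using (_,_; proj₁; proj₂)
  open import Data.Rational hiding (NonZero; ∣_∣)
  open import Data.Rational.Properties
  open import Data.Sum using ([_,_]′)
  open import Data.Vec using ([]; _∷_; lookup)
  open import Function using (_∘_)
  open import Relation.Binary.PropositionalEquality
  open import Relation.Nullary using (yes; no)
  open import Tactic.RingSolver using (solve-∀)
  open Rationals
  open Means

  E-marginal₂ : ∀ {A : Set} {n} (μ : Fin n → Mean A) {i j} → i ≢ j → (g h : A → ℚ) →
    E (prod μ) (λ v → g (lookup v i) * h (lookup v j)) ≡ E (μ i) g * E (μ j) h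
  E-marginal₂ μ {zero} {zero} i≢j g h = ⊥-elim (i≢j refl)
  E-marginal₂ μ {zero} {suc j} i≢j g h = trans
    (E-cong (μ zero) (λ a → trans (E-*ˡ (prod (μ ∘ suc)) (g a) _) (cong (g a *_) (E-marginal (μ ∘ suc) j h))))
    (E-*ʳ (μ zero) g _)
  E-marginal₂ μ {suc i} {zero} i≢j g h = trans
    (E-cong (μ zero) (λ a → trans (E-*ʳ (prod (μ ∘ suc)) _ (h a)) (cong (_* h a) (E-marginal (μ ∘ suc) i g))))
    (E-*ˡ (μ zero) (E (μ (suc i)) g) h)
  E-marginal₂ μ {suc i} {suc j} i≢j g h = trans (E-const (μ zero) _)
    (E-marginal₂ (μ ∘ suc) (i≢j ∘ cong suc) g h)

  ι-∣∣ : ∀ {n} (X : Subset n) → ι ∣ X ∣ ≡ ∑ (allFin n) (χ ∘ lookup X)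
  ι-∣∣ []      = ι-0
  ι-∣∣ {suc n} (true ∷ X)  = trans (ι-suc ∣ X ∣) (trans (cong (1ℚ +_) (ι-∣∣ X)) (sym (∑-allFin-suc n (χ ∘ lookup (true ∷ X)))))
  ι-∣∣ {suc n} (false ∷ X) = trans (ι-∣∣ X) (trans (sym (+-identityˡ _)) (sym (∑-allFin-suc n (χ ∘ lookup (false ∷ X)))))

  private
    twice : ∀ x → ι 2 * x ≡ x + x
    twice x = trans (cong (_* x) (trans (ι-suc 1) (cong (1ℚ +_) ι-1))) (eq x)
      where
      eq : ∀ x → (1ℚ + 1ℚ) * x ≡ x + x
      eq = solve-∀ ℚ-ring

  ∑-edges-∑∑ : ∀ {n} (G : Graph n) → IsSimple G → (f : Fin n → Fin n → ℚ) → (∀ i j → f i j ≡ f j i) →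
    ι 2 * ∑ (edgeList G) (λ e → f (proj₁ e) (proj₂ e)) ≡ ∑ (allFin n) (λ i → ∑ (allFin n) (λ j → f i j * χ (G i j)))
  ∑-edges-∑∑ {n} G simple f f-sym = begin
    ι 2 * ∑ (edgeList G) (λ e → f (proj₁ e) (proj₂ e))
      ≡⟨ twice _ ⟩
    ∑ (edgeList G) (λ e → f (proj₁ e) (proj₂ e)) + ∑ (edgeList G) (λ e → f (proj₁ e) (proj₂ e))
      ≡⟨ cong (∑ (edgeList G) (λ e → f (proj₁ e) (proj₂ e)) +_) (∑-cong (edgeList G) (λ e → f-sym (proj₁ e) (proj₂ e))) ⟩
    ∑ (edgeList G) (λ e → f (proj₁ e) (proj₂ e)) + ∑ (edgeList G) (λ e → f (proj₂ e) (proj₁ e))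
      ≡⟨ sym (∑-+ (edgeList G) _ _) ⟩
    ∑ (edgeList G) (λ e → f (proj₁ e) (proj₂ e) + f (proj₂ e) (proj₁ e))
      ≡⟨ ∑-edges G simple f ⟩
    ∑ (allFin n) (λ i → ∑ (allFin n) (λ j → if G i j then f i j else 0ℚ))
      ≡⟨ ∑-cong (allFin n) (λ i → ∑-cong (allFin n) (λ j → if-χ (G i j) (f i j))) ⟩
    ∑ (allFin n) (λ i → ∑ (allFin n) (λ j → f i j * χ (G i j))) ∎
    where
    open ≡-Reasoning
    if-χ : ∀ b x → (if b then x else 0ℚ) ≡ x * χ b
    if-χ true  x = sym (*-identityʳ x)
    if-χ false x = sym (*-zeroʳ x)

  spannedEdges-∑∑ : ∀ {n} (G : Graph n) → IsSimple G → (X : Subset n) → ι 2 * ι (spannedEdges G X) ≡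
    ∑ (allFin n) (λ i → ∑ (allFin n) (λ j → χ (lookup X i) * χ (lookup X j) * χ (G i j)))
  spannedEdges-∑∑ {n} G simple X = trans (cong (ι 2 *_) (trans
      (countTrue-∑ (λ e → lookup X (proj₁ e) ∧ lookup X (proj₂ e)) (edgeList G))
      (∑-cong (edgeList G) (λ e → χ-∧ (lookup X (proj₁ e)) (lookup X (proj₂ e))))))
    (∑-edges-∑∑ G simple (λ i j → χ (lookup X i) * χ (lookup X j)) (λ i j → *-comm (χ (lookup X i)) (χ (lookup X j))))

  -- Opaque, because IsDense normalises, through fromℕ, to gcd computations.
  opaque
    Dense : ℚ → ℚ → ∀ {n} → Graph n → Set
    Dense = IsDense

    dense⁺ : ∀ {ρ d n} {G : Graph n} → IsDense ρ d G → Dense ρ d G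
    dense⁺ dense = dense

    dense⁻ : ∀ {ρ d n} {G : Graph n} → Dense ρ d G → IsDense ρ d G
    dense⁻ dense = dense

  dense-∑∑ : ∀ ρ d {n} {G : Graph n} → IsSimple G → Dense ρ d G → (X : Subset n) → ρ * ι n ≤ ι ∣ X ∣ →
    d * (ι ∣ X ∣ * ι ∣ X ∣) ≤ ∑ (allFin n) (λ i → ∑ (allFin n) (λ j → χ (lookup X i) * χ (lookup X j) * χ (G i j)))
  dense-∑∑ ρ d {n} {G} simple dense X large = subst₂ _≤_
    (trans (twice _) (trans (eq d (ι (∣ X ∣ ℕ.* ∣ X ∣))) (cong (d *_) (ι-* ∣ X ∣ ∣ X ∣))))
    (spannedEdges-∑∑ G simple X)
    (*-monoˡ (0≤ι 2) (subst₂ _≤_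
      (cong (½ * d *_) (sym (ι-fromℕ (∣ X ∣ ℕ.* ∣ X ∣)))) (sym (ι-fromℕ _))
      (dense⁻ {ρ} {d} {n} {G} dense X (subst₂ _≤_ (cong (ρ *_) (ι-fromℕ n)) (ι-fromℕ ∣ X ∣) large))))
    where
    eq : ∀ d x → ½ * d * x + ½ * d * x ≡ d * x
    eq = solve-∀ ℚ-ring

  -- The threshold on the size of a set is traded for the defect `d * (ρ * ρ)`. The condition can
  -- then be applied to any weight function with values in [0,1], with no lower bound on its mean.
  LocallyDense : ℚ → ℚ → ∀ {n} .{{_ : NonZero n}} → Graph n → Set
  LocallyDense ρ d {n} G = ∀ (f : Fin n → ℚ) → (∀ i → 0ℚ ≤ f i) → (∀ i → f i ≤ 1ℚ) →
    d * (E (unif n) f * E (unif n) f - ρ * ρ) ≤ E (unif n) (λ u → E (unif n) (λ v → f u * f v * χ (G u v)))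

  -- A random vertex set containing i with probability f i, independently, has expected
  -- squared size at least (∑ f)², while A has zero diagonal: averaging the density
  -- condition over sets, where small sets cost at most ρ²n², gives the weighted version.
  module _ {n} (G : Graph n) (simple : IsSimple G) where

    private
      ind : Subset n → Fin n → ℚ
      ind X i = χ (lookup X i)

      form : (Fin n → ℚ) → ℚ
      form f = ∑ (allFin n) (λ i → ∑ (allFin n) (λ j → f i * f j * χ (G i j)))

      total : (Fin n → ℚ) → ℚ
      total = ∑ (allFin n)

    set-form : ∀ {ρ d} → 0ℚ ≤ d → Dense ρ d G → ∀ X →
      d * (total (ind X) * total (ind X) - (ρ * ι n) * (ρ * ι n)) ≤ form (ind X)
    set-form {ρ} {d} 0≤d dense X = [ large , small ]′ (≤-total (ρ * ι n) (ι ∣ X ∣))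
      where
      defect : ℚ
      defect = (ρ * ι n) * (ρ * ι n)
      large : ρ * ι n ≤ ι ∣ X ∣ → d * (total (ind X) * total (ind X) - defect) ≤ form (ind X)
      large le = ≤-trans
          (≤-add (0≤* 0≤d (0≤² (ρ * ι n))) (eq d (total (ind X)) defect))
          (subst (λ z → d * (z * z) ≤ form (ind X)) (ι-∣∣ X) (dense-∑∑ ρ d simple dense X le))
        where
        eq : ∀ d s r → d * (s * s) ≡ d * (s * s - r) + d * r
        eq = solve-∀ ℚ-ring
      small : ι ∣ X ∣ ≤ ρ * ι n → d * (total (ind X) * total (ind X) - defect) ≤ form (ind X)
      small ge = ≤-trans
          (≤-add (0≤* 0≤d (0≤- (*-mono 0≤s s≤ 0≤s s≤))) (eq d (total (ind X) * total (ind X)) defect))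
          (0≤∑ (allFin n) (λ i → 0≤∑ (allFin n) (λ j → 0≤* (0≤* (0≤χ (lookup X i)) (0≤χ (lookup X j))) (0≤χ (G i j)))))
        where
        0≤s : 0ℚ ≤ total (ind X)
        0≤s = 0≤∑ (allFin n) (λ i → 0≤χ (lookup X i))
        s≤ : total (ind X) ≤ ρ * ι n
        s≤ = subst (_≤ ρ * ι n) (ι-∣∣ X) ge
        eq : ∀ d s r → 0ℚ ≡ d * (s - r) + d * (r - s)
        eq = solve-∀ ℚ-ring

    module _ (f : Fin n → ℚ) (0≤f : ∀ i → 0ℚ ≤ f i) (f≤1 : ∀ i → f i ≤ 1ℚ) where

      private
        coins : Fin n → Mean Bool
        coins i = coin (f i) (0≤f i) (f≤1 i)

        μ : Mean (Subset n)
        μ = prod coins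

        E-coin : ∀ i → E (coins i) χ ≡ f i
        E-coin i = eq (f i)
          where
          eq : ∀ p → p * 1ℚ + (1ℚ - p) * 0ℚ ≡ p
          eq = solve-∀ ℚ-ring

        E-total : E μ (total ∘ ind) ≡ total f
        E-total = trans (E-∑ μ (allFin n) ind) (∑-cong (allFin n) (λ i → trans (E-marginal coins i χ) (E-coin i)))

        cell : ∀ i j → E μ (λ X → ind X i * ind X j * χ (G i j)) ≡ f i * f j * χ (G i j)
        cell i j with i FinP.≟ j
        -- On the diagonal the expectation of the squared indicator is `f i` and not `f i * f i`,
        -- but both are multiplied by `χ (G i i)`, which is 0.
        ... | yes refl = trans (E-*ʳ μ _ (χ (G i i))) (trans (vanish (E μ (λ X → ind X i * ind X i))) (sym (vanish (f i * f i))))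
          where
          vanish : ∀ x → x * χ (G i i) ≡ 0ℚ
          vanish x = trans (cong (λ b → x * χ b) (proj₂ simple i)) (*-zeroʳ x)
        ... | no i≢j = trans (E-*ʳ μ _ (χ (G i j))) (cong (_* χ (G i j))
                (trans (E-marginal₂ coins i≢j χ χ) (cong₂ _*_ (E-coin i) (E-coin j))))

        E-form : E μ (form ∘ ind) ≡ form f
        E-form = trans (E-∑ μ (allFin n) _) (∑-cong (allFin n) (λ i → trans (E-∑ μ (allFin n) _) (∑-cong (allFin n) (cell i))))

      weighted-form : ∀ {d defect} → 0ℚ ≤ d → (∀ X → d * (total (ind X) * total (ind X) - defect) ≤ form (ind X)) →
        d * (total f * total f - defect) ≤ form f
      weighted-form {d} {defect} 0≤d sets = begin
        d * (total f * total f - defect)                                ≡⟨ cong (λ z → d * (z * z - defect)) (sym E-total) ⟩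
        d * (E μ (total ∘ ind) * E μ (total ∘ ind) - defect)             ≤⟨ *-monoˡ 0≤d (+-monoˡ-≤ (- defect) (jensen² μ (total ∘ ind))) ⟩
        d * (E μ (λ X → total (ind X) * total (ind X)) - defect)         ≡⟨ cong (λ z → d * (E μ (λ X → total (ind X) * total (ind X)) - z)) (sym (E-const μ defect)) ⟩
        d * (E μ (λ X → total (ind X) * total (ind X)) - E μ (λ _ → defect)) ≡⟨ cong (d *_) (sym (E-- μ _ _)) ⟩
        d * E μ (λ X → total (ind X) * total (ind X) - defect)           ≡⟨ sym (E-*ˡ μ d _) ⟩
        E μ (λ X → d * (total (ind X) * total (ind X) - defect))         ≤⟨ E-mono μ sets ⟩
        E μ (form ∘ ind)                                                ≡⟨ E-form ⟩
        form f                                                          ∎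
        where open ≤-Reasoning

    dense⇒locallyDense : ∀ {ρ d} .{{_ : NonZero n}} → 0ℚ ≤ d → Dense ρ d G → LocallyDense ρ d G
    dense⇒locallyDense {ρ} {d} 0≤d dense f 0≤f f≤1 = subst₂ _≤_
      (trans (eq (recip n) d (total f) ρ (ι n)) (trans (cong (λ z → d * (recip n * total f * (recip n * total f) - ρ * ρ * z))
        (trans (cong₂ _*_ (recip-inverse n) (recip-inverse n)) (*-identityˡ 1ℚ))) (eq′ d (recip n * total f) ρ)))
      (trans (*-assoc (recip n) (recip n) (form f)) (cong (recip n *_) (sym (∑-*ˡ (allFin n) (recip n) _))))
      (*-monoˡ (0≤* (0≤recip n) (0≤recip n)) (weighted-form f 0≤f f≤1 0≤d (set-form 0≤d dense)))
      where
      eq : ∀ r d s ρ n → (r * r) * (d * (s * s - (ρ * n) * (ρ * n))) ≡ d * ((r * s) * (r * s) - ρ * ρ * ((r * n) * (r * n)))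
      eq = solve-∀ ℚ-ring
      eq′ : ∀ d s ρ → d * (s * s - ρ * ρ * 1ℚ) ≡ d * (s * s - ρ * ρ)
      eq′ = solve-∀ ℚ-ring

-- The adjacency operator and the density of walks.

module Walks where
  open import Data.Fin using (Fin; zero; suc)
  open import Data.Nat as ℕ using (ℕ; zero; suc; NonZero)
  import Data.Nat.Properties as ℕP
  open import Data.Product using (_,_; proj₁; ∃-syntax)
  open import Data.Rational hiding (NonZero; ∣_∣)
  open import Data.Rational.Properties
  open import Data.Sum using (_⊎_; inj₁; inj₂)
  open import Relation.Binary.PropositionalEquality
  open import Tactic.RingSolver using (solve-∀)
  open Rationals
  open Means
  open WeightedDensity

  -- Since `x - c` and `x ^ r - c ^ r` have the same sign, their product is nonnegative. Averaging
  -- it bounds the mean of the next power below by an expression in the means of `f` and of `f ^ r`,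
  -- which are at least `c` and, by induction, `c ^ r`.
  ^-mean : ∀ {A : Set} (μ : Mean A) {f : A → ℚ} {c} → (∀ a → 0ℚ ≤ f a) → 0ℚ ≤ c → c ≤ E μ f →
    ∀ r → c ^ℚ r ≤ E μ (λ a → f a ^ℚ r)
  ^-mean μ {f} {c} 0≤f 0≤c c≤Ef zero = ≤-reflexive (sym (E-1 μ))
  ^-mean μ {f} {c} 0≤f 0≤c c≤Ef (suc r) = begin
    c * (c ^ℚ r)
      ≤⟨ ≤-add (0≤+ (0≤* (0≤^ r 0≤c) (0≤- c≤Ef)) (0≤* 0≤c (0≤- (^-mean μ 0≤f 0≤c c≤Ef r)))) (eq c (c ^ℚ r) (E μ f) (E μ (λ a → f a ^ℚ r))) ⟩
    c ^ℚ r * E μ f + c * E μ (λ a → f a ^ℚ r) - c * (c ^ℚ r)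
      ≡⟨ sym (trans (E-- μ _ _) (cong₂ _-_ (E-affine μ f (λ a → f a ^ℚ r) (c ^ℚ r) c) (E-const μ _))) ⟩
    E μ (λ a → (c ^ℚ r) * f a + c * (f a ^ℚ r) - c * (c ^ℚ r))
      ≤⟨ E-mono μ (λ a → ≤-add (chebyshev (f a) (0≤f a)) (eq′ (f a) (f a ^ℚ r) c (c ^ℚ r))) ⟩
    E μ (λ a → f a * (f a ^ℚ r)) ∎
    where
    open ≤-Reasoning
    eq : ∀ c cr e er → cr * e + c * er - c * cr ≡ c * cr + (cr * (e - c) + c * (er - cr))
    eq = solve-∀ ℚ-ring
    eq′ : ∀ x xr c cr → x * xr ≡ cr * x + c * xr - c * cr + (x - c) * (xr - cr)
    eq′ = solve-∀ ℚ-ring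
    swap-both : ∀ x y z w → (x - y) * (z - w) ≡ (y - x) * (w - z)
    swap-both = solve-∀ ℚ-ring
    chebyshev : ∀ x → 0ℚ ≤ x → 0ℚ ≤ (x - c) * (x ^ℚ r - c ^ℚ r)
    chebyshev x 0≤x with ≤-total c x
    ... | inj₁ c≤x = 0≤* (0≤- c≤x) (0≤- (^-mono r 0≤c c≤x))
    ... | inj₂ x≤c = subst (0ℚ ≤_) (swap-both c x (c ^ℚ r) (x ^ℚ r)) (0≤* (0≤- x≤c) (0≤- (^-mono r 0≤x x≤c)))

  half : ∀ j → ∃[ i ] (j ≡ i ℕ.+ i ⊎ j ≡ suc (i ℕ.+ i))
  half zero = 0 , inj₁ refl
  half (suc j) with half j
  ... | i , inj₁ refl = i , inj₂ refl
  ... | i , inj₂ refl = suc i , inj₁ (cong suc (sym (ℕP.+-suc i i)))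

  module WalkOperator {n} .{{_ : NonZero n}} (G : Graph n) (simple : IsSimple G) where

    U : Mean (Fin n)
    U = unif n

    A : Fin n → Fin n → ℚ
    A u v = χ (G u v)

    A-sym : ∀ u v → A u v ≡ A v u
    A-sym u v = cong χ (proj₁ simple u v)

    T : (Fin n → ℚ) → Fin n → ℚ
    T f x = E U (λ y → A x y * f y)

    T^ : ℕ → (Fin n → ℚ) → Fin n → ℚ
    T^ zero    f = f
    T^ (suc k) f = T (T^ k f)

    T-linear : ∀ x → Linear (Fin n)
    T-linear x = record
      { E      = λ f → T f x
      ; E-cong = λ h → E-cong U (λ y → cong (A x y *_) (h y))
      ; E-+    = λ f g → trans (E-cong U (λ y → *-distribˡ-+ (A x y) (f y) (g y))) (E-+ U _ _)
      ; E-*ˡ   = λ c f → trans (E-cong U (λ y → eq (A x y) c (f y))) (E-*ˡ U c _)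
      }
      where
      eq : ∀ a c f → a * (c * f) ≡ c * (a * f)
      eq = solve-∀ ℚ-ring

    T^-linear : ∀ k x → Linear (Fin n)
    T^-linear k x = record
      { E      = λ f → T^ k f x
      ; E-cong = λ h → T^-cong k h x
      ; E-+    = λ f g → T^-+ k f g x
      ; E-*ˡ   = λ c f → T^-*ˡ k c f x
      }
      where
      T^-cong : ∀ k {f g} → (∀ x → f x ≡ g x) → ∀ x → T^ k f x ≡ T^ k g x
      T^-cong zero    h x = h x
      T^-cong (suc k) h x = Linear.E-cong (T-linear x) (T^-cong k h)
      T^-+ : ∀ k f g x → T^ k (λ a → f a + g a) x ≡ T^ k f x + T^ k g x
      T^-+ zero    f g x = refl
      T^-+ (suc k) f g x = trans (Linear.E-cong (T-linear x) (T^-+ k f g)) (Linear.E-+ (T-linear x) (T^ k f) (T^ k g))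
      T^-*ˡ : ∀ k c f x → T^ k (λ a → c * f a) x ≡ c * T^ k f x
      T^-*ˡ zero    c f x = refl
      T^-*ˡ (suc k) c f x = trans (Linear.E-cong (T-linear x) (T^-*ˡ k c f)) (Linear.E-*ˡ (T-linear x) c (T^ k f))

    T^-comm : ∀ k f x → T^ k (T f) x ≡ T (T^ k f) x
    T^-comm zero    f x = refl
    T^-comm (suc k) f x = Linear.E-cong (T-linear x) (T^-comm k f)

    T^-+ : ∀ j k f x → T^ (j ℕ.+ k) f x ≡ T^ j (T^ k f) x
    T^-+ zero    k f x = refl
    T^-+ (suc j) k f x = Linear.E-cong (T-linear x) (T^-+ j k f)

    T-adjoint : ∀ f g → E U (λ x → f x * T g x) ≡ E U (λ x → T f x * g x)
    T-adjoint f g = begin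
      E U (λ x → f x * T g x)                        ≡⟨ E-cong U (λ x → sym (E-*ˡ U (f x) _)) ⟩
      E U (λ x → E U (λ y → f x * (A x y * g y)))     ≡⟨ E-swap U (linear U) _ ⟩
      E U (λ y → E U (λ x → f x * (A x y * g y)))     ≡⟨ E-cong U (λ y → E-cong U (λ x → trans (cong (λ a → f x * (a * g y)) (A-sym x y)) (eq (f x) (A y x) (g y)))) ⟩
      E U (λ y → E U (λ x → A y x * f x * g y))       ≡⟨ E-cong U (λ y → E-*ʳ U _ (g y)) ⟩
      E U (λ y → T f y * g y)                        ∎
      where
      open ≡-Reasoning
      eq : ∀ f a g → f * (a * g) ≡ a * f * g
      eq = solve-∀ ℚ-ring

    T^-adjoint : ∀ k f g → E U (λ x → f x * T^ k g x) ≡ E U (λ x → T^ k f x * g x)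
    T^-adjoint zero    f g = refl
    T^-adjoint (suc k) f g = trans (T-adjoint f (T^ k g)) (trans (T^-adjoint k (T f) g)
      (E-cong U (λ x → cong (_* g x) (T^-comm k f x))))

    δ : ℕ → Fin n → ℚ
    δ k = T^ k (λ _ → 1ℚ)

    0≤T^ : ∀ k {f} → (∀ x → 0ℚ ≤ f x) → ∀ x → 0ℚ ≤ T^ k f x
    0≤T^ zero    h x = h x
    0≤T^ (suc k) h x = 0≤E U (λ y → 0≤* (0≤χ (G x y)) (0≤T^ k h y))

    0≤δ : ∀ k x → 0ℚ ≤ δ k x
    0≤δ k = 0≤T^ k (λ _ → 0≤1)

    δ≤1 : ∀ k x → δ k x ≤ 1ℚ
    δ≤1 zero    x = ≤-refl
    δ≤1 (suc k) x = E≤ U (λ y → *-≤1 (0≤χ (G x y)) (χ≤1 (G x y)) (0≤δ k y) (δ≤1 k y))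

    E-T^ : ∀ k φ → E U (T^ k φ) ≡ E U (λ x → δ k x * φ x)
    E-T^ k φ = trans (E-cong U (λ x → sym (*-identityˡ (T^ k φ x)))) (T^-adjoint k (λ _ → 1ℚ) φ)

    E-T^-≤ : ∀ k {φ} → (∀ x → 0ℚ ≤ φ x) → E U (T^ k φ) ≤ E U φ
    E-T^-≤ k {φ} 0≤φ = subst (_≤ E U φ) (sym (E-T^ k φ)) (E-mono U (λ x → *-≤ʳ (0≤φ x) (δ≤1 k x)))

    -- The index counts internal vertices: this is the density of walks with `k` internal vertices,
    -- so with `k + 1` steps, from `w` to `z`. A path carrying `s` subdivision vertices therefore
    -- corresponds to `A^ s`.
    A^ : ℕ → Fin n → Fin n → ℚ
    A^ k z w = T^ k (λ v → A v z) w

    -- Reversal of walks. The first step of a walk out of `z` is moved as a constant factor inside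
    -- the walk read from `w`, where it becomes the last step.
    A^-sym : ∀ k w z → A^ k z w ≡ A^ k w z
    A^-sym zero    w z = A-sym w z
    A^-sym (suc k) w z = sym (begin
      T (T^ k (λ v → A v w)) z                            ≡⟨ E-cong U (λ y → trans (*-comm (A z y) _) (cong (_* A z y) (A^-sym k y w))) ⟩
      E U (λ y → A^ k y w * A z y)                        ≡⟨ E-cong U (λ y → cong (A^ k y w *_) (A-sym z y)) ⟩
      E U (λ y → A^ k y w * A y z)                        ≡⟨ E-cong U (λ y → sym (Linear.E-*ʳ (T^-linear k w) (λ v → A v y) (A y z))) ⟩
      E U (λ y → T^ k (λ v → A v y * A y z) w)            ≡⟨ E-swap U (T^-linear k w) _ ⟩
      T^ k (T (λ v → A v z)) w                            ≡⟨ T^-comm k _ w ⟩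
      T (T^ k (λ v → A v z)) w                            ∎)
      where open ≡-Reasoning

    -- A walk of length 2j+1 is an edge whose two ends are extended by walks of length j,
    -- so local density bounds its count; a walk of length 2j is handled by Cauchy–Schwarz.
    walk-density : ∀ {ρ d θ k} → LocallyDense ρ d G → 0ℚ ≤ d → 0ℚ ≤ d * (1ℚ - θ) →
      (∀ j → j ℕ.≤ k → ρ * ρ ≤ θ * (((d * (1ℚ - θ)) ^ℚ j) * ((d * (1ℚ - θ)) ^ℚ j))) →
      ∀ b j → j ℕ.≤ b → j ℕ.≤ k → (d * (1ℚ - θ)) ^ℚ j ≤ E U (δ j)
    walk-density {ρ} {d} {θ} {k} dense 0≤d 0≤d₁ small = go
      where
      open ≤-Reasoning
      d₁ : ℚ
      d₁ = d * (1ℚ - θ)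
      sq : ∀ {x y} → 0ℚ ≤ x → x ≤ y → x * x ≤ y * y
      sq 0≤x x≤y = *-mono 0≤x x≤y 0≤x x≤y
      eq : ∀ d θ p → d * (1ℚ - θ) * p ≡ d * (p - θ * p)
      eq = solve-∀ ℚ-ring
      eq′ : ∀ a x y → x * (a * y) ≡ x * y * a
      eq′ = solve-∀ ℚ-ring
      -- `b` is fuel: the recursive calls are at half of `j`, which is not a structural subterm.
      go : ∀ b j → j ℕ.≤ b → j ℕ.≤ k → d₁ ^ℚ j ≤ E U (δ j)
      go b zero j≤b j≤k = ≤-reflexive (sym (E-1 U))
      go (suc b) (suc j) (ℕ.s≤s j≤b) j<k with half (suc j)
      ... | suc i , inj₁ refl = begin
        d₁ ^ℚ (suc i ℕ.+ suc i)                          ≡⟨ ^-+ d₁ (suc i) (suc i) ⟩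
        (d₁ ^ℚ suc i) * (d₁ ^ℚ suc i)                    ≤⟨ sq (0≤^ (suc i) 0≤d₁) (go b (suc i) si≤b (ℕP.≤-trans (ℕP.m≤m+n (suc i) (suc i)) j<k)) ⟩
        E U (δ (suc i)) * E U (δ (suc i))                ≤⟨ jensen² U (δ (suc i)) ⟩
        E U (λ x → δ (suc i) x * δ (suc i) x)            ≡⟨ sym (E-T^ (suc i) (δ (suc i))) ⟩
        E U (T^ (suc i) (δ (suc i)))                     ≡⟨ E-cong U (λ x → sym (T^-+ (suc i) (suc i) _ x)) ⟩
        E U (δ (suc i ℕ.+ suc i))                        ∎
        where
        si≤b : suc i ℕ.≤ b
        si≤b = ℕP.≤-trans (ℕP.m≤n+m (suc i) i) j≤b
      ... | i , inj₂ refl = begin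
        d₁ * (d₁ ^ℚ (i ℕ.+ i))                           ≡⟨ cong (d₁ *_) (^-+ d₁ i i) ⟩
        -- The factor `1 - θ` in one copy of `d₁` pays for the defect: it frees the amount
        -- `θ * (d₁ ^ i) ^ 2`, which `small` makes at least `ρ * ρ`.
        d₁ * ((d₁ ^ℚ i) * (d₁ ^ℚ i))                     ≡⟨ eq d θ ((d₁ ^ℚ i) * (d₁ ^ℚ i)) ⟩
        d * ((d₁ ^ℚ i) * (d₁ ^ℚ i) - θ * ((d₁ ^ℚ i) * (d₁ ^ℚ i)))
          ≤⟨ *-monoˡ 0≤d (+-mono-≤ (sq (0≤^ i 0≤d₁) (go b i i≤b i≤k)) (neg-antimono-≤ (small i i≤k))) ⟩
        d * (E U (δ i) * E U (δ i) - ρ * ρ)              ≤⟨ dense (δ i) (0≤δ i) (δ≤1 i) ⟩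
        E U (λ u → E U (λ v → δ i u * δ i v * A u v))    ≡⟨ E-cong U (λ u → trans (E-cong U (λ v → sym (eq′ (A u v) (δ i u) (δ i v)))) (E-*ˡ U (δ i u) _)) ⟩
        E U (λ u → δ i u * T (δ i) u)                    ≡⟨ sym (E-T^ i (T (δ i))) ⟩
        E U (T^ i (T (δ i)))                             ≡⟨ E-cong U (λ x → trans (T^-comm i (δ i) x) (Linear.E-cong (T-linear x) (λ y → sym (T^-+ i i _ y)))) ⟩
        E U (δ (suc (i ℕ.+ i)))                          ∎
        where
        i≤b : i ℕ.≤ b
        i≤b = ℕP.≤-trans (ℕP.m≤m+n i i) j≤b
        i≤k : i ℕ.≤ k
        i≤k = ℕP.≤-trans (ℕP.m≤m+n i i) (ℕP.≤-trans (ℕP.n≤1+n (i ℕ.+ i)) j<k)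

-- Edges as pairwise distinct unordered pairs.

module EdgeLists where
  open import Data.Bool using (Bool; true; false; _∧_; if_then_else_)
  open import Data.Fin using (Fin; toℕ)
  open import Data.List using (List; []; _∷_; concatMap; allFin)
  open import Data.List.Membership.Propositional.Properties using (∈-allFin)
  open import Data.List.Relation.Unary.All as All using (All; []; _∷_)
  import Data.List.Relation.Unary.All.Properties as AllP
  open import Data.List.Relation.Unary.AllPairs using (AllPairs; []; _∷_)
  import Data.List.Relation.Unary.AllPairs.Properties as AllPairsP
  open import Data.Nat as ℕ using (ℕ; _<ᵇ_)
  import Data.Nat.Properties as ℕP
  open import Data.Product using (_×_; _,_; proj₁; proj₂)
  open import Data.Unit using (tt)
  open import Relation.Binary.PropositionalEquality
  open import Relation.Nullary using (¬_)
  open BigOperators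

  module _ {n} (G : Graph n) where

    private
      cell : Fin n → Fin n → List (Fin n × Fin n)
      cell i j = if G i j ∧ (toℕ i <ᵇ toℕ j) then (i , j) ∷ [] else []

      row : Fin n → List (Fin n × Fin n)
      row i = concatMap (cell i) (allFin n)

      All-cell : ∀ {P : Fin n × Fin n → Set} i j → (G i j ≡ true → toℕ i ℕ.< toℕ j → P (i , j)) → All P (cell i j)
      All-cell i j h with G i j | toℕ i <ᵇ toℕ j in lt
      ... | true  | true  = h refl (ℕP.<ᵇ⇒< (toℕ i) (toℕ j) (subst Data.Bool.T (sym lt) tt)) ∷ []
      ... | true  | false = []
      ... | false | _     = []

      All-row : ∀ {P : Fin n × Fin n → Set} i → (∀ j → G i j ≡ true → toℕ i ℕ.< toℕ j → P (i , j)) → All P (row i)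
      All-row i h = AllP.concat⁺ (AllP.map⁺ (AllP.tabulate⁺ (λ j → All-cell i j (h j))))

    All-edgeList⁺ : ∀ {P : Fin n × Fin n → Set} → (∀ i j → G i j ≡ true → toℕ i ℕ.< toℕ j → P (i , j)) → All P (edgeList G)
    All-edgeList⁺ h = AllP.concat⁺ (AllP.map⁺ (AllP.tabulate⁺ (λ i → All-row i (h i))))

    All-edgeList⁻ : ∀ {P : Fin n × Fin n → Set} → All P (edgeList G) → ∀ i j → G i j ≡ true → toℕ i ℕ.< toℕ j → P (i , j)
    All-edgeList⁻ {P} ps i j Gij i<j = All.head (subst (λ b → All P (if b then (i , j) ∷ [] else [])) eq
        (All.lookup (AllP.map⁻ (AllP.concat⁻ (All.lookup (AllP.map⁻ (AllP.concat⁻ ps)) (∈-allFin i)))) (∈-allFin j)))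
      where
      eq : (G i j ∧ (toℕ i <ᵇ toℕ j)) ≡ true
      eq rewrite Gij | <ᵇ-true i<j = refl

    edgeList-unique : AllPairs _≢_ (edgeList G)
    edgeList-unique = AllPairsP.concat⁺
      (AllP.map⁺ (AllP.tabulate⁺ (λ i → AllPairsP.concat⁺
        (AllP.map⁺ (AllP.tabulate⁺ (λ j → single (G i j ∧ (toℕ i <ᵇ toℕ j)))))
        (AllPairsP.map⁺ (AllPairsP.tabulate⁺ (λ {j} {j′} j≢j′ →
          All-cell i j (λ _ _ → All-cell i j′ (λ _ _ eq → j≢j′ (cong proj₂ eq)))))))))
      (AllPairsP.map⁺ (AllPairsP.tabulate⁺ (λ {i} {i′} i≢i′ →
        All-row i (λ j _ _ → All-row i′ (λ j′ _ _ eq → i≢i′ (cong proj₁ eq))))))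
      where
      single : ∀ {e : Fin n × Fin n} b → AllPairs _≢_ (if b then e ∷ [] else [])
      single true  = [] ∷ []
      single false = []

  -- Distinctness as unordered pairs. An edge of `H` will read one sample at each of its ends, and
  -- its reversal would read the same two samples.
  Apart : ∀ {n} → Fin n × Fin n → Fin n × Fin n → Set
  Apart (i , j) (i′ , j′) = ¬ (i ≡ i′ × j ≡ j′) × ¬ (i ≡ j′ × j ≡ i′)

  edgeList-irreflexive : ∀ {n} (G : Graph n) → All (λ e → proj₁ e ≢ proj₂ e) (edgeList G)
  edgeList-irreflexive G = All-edgeList⁺ G (λ i j _ i<j i≡j → ℕP.<-irrefl (cong toℕ i≡j) i<j)

  -- Uniqueness of the entries excludes a repetition, and their common upward orientation excludes a
  -- reversed copy.
  edgeList-apart : ∀ {n} (G : Graph n) → AllPairs Apart (edgeList G)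
  edgeList-apart G = go (All-edgeList⁺ G (λ i j _ i<j → i<j)) (edgeList-unique G)
    where
    go : ∀ {es} → All (λ e → toℕ (proj₁ e) ℕ.< toℕ (proj₂ e)) es → AllPairs _≢_ es → AllPairs Apart es
    go []       []       = []
    go (lt ∷ lts) (ne ∷ nes) = All.zipWith (λ {e′} (lt′ , ne′) →
        (λ (p , q) → ne′ (cong₂ _,_ p q)) ,
        (λ { (refl , refl) → ℕP.<-asym lt lt′ })) (lts , ne) ∷ go lts nes

-- Independent samples: variance, resampling, label collisions.

module Independence where
  open import Data.Bool using (true)
  open import Data.Empty using (⊥-elim)
  open import Data.Fin using (Fin; zero; suc)
  import Data.Fin.Properties as FinP
  open import Data.List using (allFin)
  open import Data.Nat as ℕ using (ℕ; zero; suc; NonZero)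
  import Data.Nat.Properties as ℕP
  open import Data.Product using (_×_; _,_)
  open import Data.Rational hiding (NonZero; ∣_∣)
  open import Data.Rational.Properties
  open import Data.Sum using (_⊎_; inj₁; inj₂)
  open import Data.Vec as Vec using (Vec; []; _∷_; lookup; _[_]≔_; zip)
  import Data.Vec.Properties as VecP
  open import Function using (_∘_)
  open import Relation.Binary.PropositionalEquality
  open import Relation.Nullary using (yes; no)
  open import Tactic.RingSolver using (solve-∀)
  open Rationals
  open Means

  -- Cross terms factor by independence and vanish by centring, which leaves `s` diagonal terms of
  -- at most 1. The function may change with the coordinate, because the coordinate is the label of
  -- the vertex that is being compared.
  variance : ∀ {A : Set} (μ : Mean A) s (k : Fin s → A → ℚ) → (∀ b → E μ (k b) ≡ 0ℚ) → (∀ b a → k b a * k b a ≤ 1ℚ) →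
    E (pow μ s) (λ u → ∑ (allFin s) (λ b → k b (lookup u b)) * ∑ (allFin s) (λ b → k b (lookup u b))) ≤ ι s
  variance μ zero k centred bounded = ≤-reflexive (trans (*-zeroʳ 0ℚ) (sym ι-0))
  variance {A} μ (suc s) k centred bounded = begin
    E μ (λ a → E ν (λ u → sum (a ∷ u) * sum (a ∷ u)))
      ≡⟨ E-cong μ (λ a → E-cong ν (λ u → trans (cong (λ z → z * z) (∑-allFin-suc s (λ b → k b (lookup (a ∷ u) b)))) (eq (k zero a) (rest u)))) ⟩
    E μ (λ a → E ν (λ u → k zero a * (rest u + rest u) + (k zero a * k zero a + rest u * rest u)))
      ≡⟨ E-cong μ (λ a → trans (E-+ ν _ _) (cong₂ _+_ (E-*ˡ ν (k zero a) _) (trans (E-+ ν _ _) (cong (_+ E ν (λ u → rest u * rest u)) (E-const ν (k zero a * k zero a)))))) ⟩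
    E μ (λ a → k zero a * E ν (λ u → rest u + rest u) + (k zero a * k zero a + E ν (λ u → rest u * rest u)))
      ≡⟨ trans (E-+ μ _ _) (cong₂ _+_ (E-*ʳ μ (k zero) _) (trans (E-+ μ _ _) (cong (E μ (λ a → k zero a * k zero a) +_) (E-const μ _)))) ⟩
    E μ (k zero) * E ν (λ u → rest u + rest u) + (E μ (λ a → k zero a * k zero a) + E ν (λ u → rest u * rest u))
      ≡⟨ cong (_+ (E μ (λ a → k zero a * k zero a) + E ν (λ u → rest u * rest u))) (trans (cong (_* E ν (λ u → rest u + rest u)) (centred zero)) (*-zeroˡ (E ν (λ u → rest u + rest u)))) ⟩
    0ℚ + (E μ (λ a → k zero a * k zero a) + E ν (λ u → rest u * rest u))
      ≡⟨ +-identityˡ _ ⟩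
    E μ (λ a → k zero a * k zero a) + E ν (λ u → rest u * rest u)
      ≤⟨ +-mono-≤ (E≤ μ (bounded zero)) (variance μ s (k ∘ suc) (centred ∘ suc) (bounded ∘ suc)) ⟩
    1ℚ + ι s
      ≡⟨ sym (ι-suc s) ⟩
    ι (suc s) ∎
    where
    open ≤-Reasoning
    ν = pow μ s
    sum : Vec A (suc s) → ℚ
    sum u = ∑ (allFin (suc s)) (λ b → k b (lookup u b))
    rest : Vec A s → ℚ
    rest u = ∑ (allFin s) (λ b → k (suc b) (lookup u b))
    eq : ∀ x r → (x + r) * (x + r) ≡ x * (r + r) + (x * x + r * r)
    eq = solve-∀ ℚ-ring

  -- A function with values in [0,1] is almost uncorrelated with the average of s centred
  -- independent coordinates, since that average has variance at most 1/s.
  correlation : ∀ {A : Set} (μ : Mean A) s .{{_ : NonZero s}} {η} → 0ℚ < η → recip s ≤ η * η →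
    (k : Fin s → A → ℚ) → (∀ b → E μ (k b) ≡ 0ℚ) → (∀ b a → k b a * k b a ≤ 1ℚ) →
    (g : Vec A s → ℚ) → (∀ u → 0ℚ ≤ g u) → (∀ u → g u ≤ 1ℚ) →
    - η ≤ E (pow μ s) (λ u → g u * E (unif s) (λ b → k b (lookup u b)))
  correlation {A} μ s {η} 0<η s-large k centred bounded g 0≤g g≤1 =
    -- Cauchy-Schwarz without roots: expand the square of `η * g + h`. As `g * g` has mean at most 1
    -- and `h * h` has mean at most `η * η`, what remains is that `2 * η` times the sum of `η` and
    -- the mean of `g * h` is nonnegative.
    0≤-⁻¹ (*-cancelˡ-≤ (0<* 0<η (positive⁻¹ (1ℚ + 1ℚ))) (subst (_≤ η * (1ℚ + 1ℚ) * (E ν gh - - η)) (sym (*-zeroʳ (η * (1ℚ + 1ℚ)))) (begin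
      0ℚ ≤⟨ 0≤E ν (λ u → 0≤² (η * g u + h u)) ⟩
      E ν (λ u → (η * g u + h u) * (η * g u + h u)) ≡⟨ E-cong ν (λ u → eq η (g u) (h u)) ⟩
      E ν (λ u → η * η * (g u * g u) + (η * (1ℚ + 1ℚ) * gh u + h u * h u)) ≡⟨ trans (E-+ ν _ _) (cong₂ _+_ (E-*ˡ ν (η * η) _) (trans (E-+ ν _ _) (cong (_+ E ν (λ u → h u * h u)) (E-*ˡ ν (η * (1ℚ + 1ℚ)) gh)))) ⟩
      η * η * E ν (λ u → g u * g u) + (η * (1ℚ + 1ℚ) * E ν gh + E ν (λ u → h u * h u))
        ≤⟨ +-mono-≤ (*-≤ˡ (0≤² η) (E≤ ν (λ u → *-≤1 (0≤g u) (g≤1 u) (0≤g u) (g≤1 u)))) (+-monoʳ-≤ (η * (1ℚ + 1ℚ) * E ν gh) h²≤) ⟩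
      η * η + (η * (1ℚ + 1ℚ) * E ν gh + η * η) ≡⟨ eq′ η (E ν gh) ⟩
      η * (1ℚ + 1ℚ) * (E ν gh - - η) ∎)))
    where
    open ≤-Reasoning
    ν = pow μ s
    h gh S : Vec A s → ℚ
    S u = ∑ (allFin s) (λ b → k b (lookup u b))
    h u = recip s * S u
    gh u = g u * h u
    eq : ∀ η g h → (η * g + h) * (η * g + h) ≡ η * η * (g * g) + (η * (1ℚ + 1ℚ) * (g * h) + h * h)
    eq = solve-∀ ℚ-ring
    eq′ : ∀ η e → η * η + (η * (1ℚ + 1ℚ) * e + η * η) ≡ η * (1ℚ + 1ℚ) * (e - - η)
    eq′ = solve-∀ ℚ-ring
    eq″ : ∀ r x → (r * x) * (r * x) ≡ r * r * (x * x)
    eq″ = solve-∀ ℚ-ring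
    h²≤ : E ν (λ u → h u * h u) ≤ η * η
    h²≤ = begin
      E ν (λ u → h u * h u)                       ≡⟨ trans (E-cong ν (λ u → eq″ (recip s) (S u))) (E-*ˡ ν (recip s * recip s) _) ⟩
      recip s * recip s * E ν (λ u → S u * S u)   ≤⟨ *-monoˡ (0≤* (0≤recip s) (0≤recip s)) (variance μ s k centred bounded) ⟩
      recip s * recip s * ι s                     ≡⟨ trans (*-assoc (recip s) (recip s) (ι s)) (trans (cong (recip s *_) (recip-inverse s)) (*-identityʳ _)) ⟩
      recip s                                     ≤⟨ s-large ⟩
      η * η                                       ∎

  E-pow-⊗ : ∀ {A B : Set} (μ : Mean A) (ν : Mean B) m (F : Vec (A × B) m → ℚ) →
    E (pow (μ ⊗ ν) m) F ≡ E (pow μ m) (λ x → E (pow ν m) (λ y → F (zip x y)))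
  E-pow-⊗ μ ν zero    F = refl
  E-pow-⊗ μ ν (suc m) F = E-cong μ (λ a → trans (E-cong ν (λ b → E-pow-⊗ μ ν m (λ v → F ((a , b) ∷ v))))
    (E-swap ν (linear (pow μ m)) _))

  E-pow-map : ∀ {A B : Set} (μ : Mean A) (ν : Mean B) (g : B → A) → (∀ f → E μ f ≡ E ν (f ∘ g)) →
    ∀ m F → E (pow μ m) F ≡ E (pow ν m) (F ∘ Vec.map g)
  E-pow-map μ ν g h zero    F = refl
  E-pow-map μ ν g h (suc m) F = trans (h _) (E-cong ν (λ b → E-pow-map μ ν g h m (λ v → F (g b ∷ v))))

  -- A cell names a vertex and one of its samples in a single index, so that independence of two
  -- readings becomes plain inequality of cells.
  read : ∀ {A : Set} {m s} → Vec (Vec A s) m → Fin m × Fin s → A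
  read us (i , b) = lookup (lookup us i) b

  write : ∀ {A : Set} {m s} → Vec (Vec A s) m → Fin m × Fin s → A → Vec (Vec A s) m
  write us (i , b) a = us [ i ]≔ (lookup us i [ b ]≔ a)

  read-write : ∀ {A : Set} {m s} (us : Vec (Vec A s) m) c a → read (write us c a) c ≡ a
  read-write us (i , b) a = trans (cong (λ u → lookup u b) (VecP.lookup∘update i us _)) (VecP.lookup∘update b (lookup us i) a)

  read-write′ : ∀ {A : Set} {m s} (us : Vec (Vec A s) m) c c′ a → c ≢ c′ → read (write us c a) c′ ≡ read us c′
  read-write′ us (i , b) (i′ , b′) a c≢c′ with i FinP.≟ i′
  ... | yes refl = trans (cong (λ u → lookup u b′) (VecP.lookup∘update i us _))
                     (VecP.lookup∘update′ (λ b′≡b → c≢c′ (cong (i ,_) (sym b′≡b))) (lookup us i) a)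
  ... | no i≢i′ = cong (λ u → lookup u b′) (VecP.lookup∘update′ (λ i′≡i → i≢i′ (sym i′≡i)) us _)

  -- A fresh row is drawn, then one entry of it is drawn again; a second use of row resampling,
  -- backwards, restores the remaining entries of the original row.
  E-resample₂ : ∀ {A : Set} (μ : Mean A) m s (c : Fin m × Fin s) (F : Vec (Vec A s) m → ℚ) →
    E (pow (pow μ s) m) F ≡ E (pow (pow μ s) m) (λ us → E μ (λ a → F (write us c a)))
  E-resample₂ μ m s (i , b) F = begin
    E ν F
      ≡⟨ E-resample (λ _ → pow μ s) i F ⟩
    E ν (λ us → E (pow μ s) (λ u → F (us [ i ]≔ u)))
      ≡⟨ E-cong ν (λ us → E-resample (λ _ → μ) b (λ u → F (us [ i ]≔ u))) ⟩
    E ν (λ us → E (pow μ s) (λ u → E μ (λ a → F (us [ i ]≔ (u [ b ]≔ a)))))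
      ≡⟨ E-cong ν (λ us → E-cong (pow μ s) (λ u → E-cong μ (λ a → cong F (rewrite-row us u a)))) ⟩
    E ν (λ us → E (pow μ s) (λ u → E μ (λ a → F (write (us [ i ]≔ u) (i , b) a))))
      ≡⟨ sym (E-resample (λ _ → pow μ s) i (λ us → E μ (λ a → F (write us (i , b) a)))) ⟩
    E ν (λ us → E μ (λ a → F (write us (i , b) a))) ∎
    where
    open ≡-Reasoning
    ν = pow (pow μ s) m
    rewrite-row : ∀ us u a → us [ i ]≔ (u [ b ]≔ a) ≡ write (us [ i ]≔ u) (i , b) a
    rewrite-row us u a = sym (trans (VecP.[]≔-idempotent us i)
      (cong (λ w → us [ i ]≔ (w [ b ]≔ a)) (VecP.lookup∘update i us u)))

  -- Pairs are counted, rather than recording whether one exists: the count dominates the indicator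
  -- of a repetition and its mean follows from linearity.
  collisions : ∀ {m s} → Vec (Fin s) m → ℚ
  collisions []              = 0ℚ
  collisions (_∷_ {m} a as) = ∑ (allFin m) (λ i → χ (eqFin (lookup as i) a)) + collisions as

  0≤collisions : ∀ {m s} (as : Vec (Fin s) m) → 0ℚ ≤ collisions as
  0≤collisions [] = ≤-refl
  0≤collisions (_∷_ {m} a as) = 0≤+ (0≤∑ (allFin m) (λ i → 0≤χ (eqFin (lookup as i) a))) (0≤collisions as)

  eqFin-refl : ∀ {n} (i : Fin n) → eqFin i i ≡ true
  eqFin-refl zero    = refl
  eqFin-refl (suc i) = eqFin-refl i

  distinct⊎collide : ∀ {m s} (as : Vec (Fin s) m) → (∀ {i j} → lookup as i ≡ lookup as j → i ≡ j) ⊎ 1ℚ ≤ collisions as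
  distinct⊎collide [] = inj₁ (λ { {()} })
  distinct⊎collide (_∷_ {m} a as) with distinct⊎collide as | FinP.any? (λ i → lookup as i FinP.≟ a)
  ... | inj₂ le | _ = inj₂ (≤-trans le (≤-add (0≤∑ (allFin m) (λ i → 0≤χ (eqFin (lookup as i) a))) (+-comm (∑ (allFin m) (λ i → χ (eqFin (lookup as i) a))) (collisions as))))
  ... | inj₁ _ | yes (i , eq) = inj₂ (≤-trans 1≤∑ (≤-add (0≤collisions as) refl))
    where
    1≤∑ : 1ℚ ≤ ∑ (allFin m) (λ i → χ (eqFin (lookup as i) a))
    1≤∑ = subst (_≤ ∑ (allFin m) (λ i → χ (eqFin (lookup as i) a)))
      (trans (∑-eqFin i (λ j → χ (eqFin (lookup as j) a))) (cong χ (trans (cong (λ z → eqFin z a) eq) (eqFin-refl a))))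
      (∑-mono (allFin m) (λ j → *-≤ʳ (0≤χ (eqFin (lookup as j) a)) (χ≤1 (eqFin i j))))
  ... | inj₁ inj | no none = inj₁ go
    where
    go : ∀ {i j} → lookup (a ∷ as) i ≡ lookup (a ∷ as) j → i ≡ j
    go {zero}  {zero}  eq = refl
    go {zero}  {suc j} eq = ⊥-elim (none (j , sym eq))
    go {suc i} {zero}  eq = ⊥-elim (none (i , eq))
    go {suc i} {suc j} eq = cong suc (inj eq)

  -- A new label meets each of the other `m` with chance `1 / s`. The square is a convenient
  -- overestimate of the number of pairs, and it survives the induction because `m + m * m` is at
  -- most the square of `m + 1`.
  E-collisions : ∀ s .{{_ : NonZero s}} m → E (pow (unif s) m) collisions ≤ ι (m ℕ.* m) * recip s
  E-collisions s zero = ≤-reflexive (sym (trans (cong (_* recip s) ι-0) (*-zeroˡ (recip s))))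
  E-collisions s (suc m) = begin
    E (unif s) (λ a → E ν (λ as → ∑ (allFin m) (λ i → χ (eqFin (lookup as i) a)) + collisions as))
      ≡⟨ E-swap (unif s) (linear ν) _ ⟩
    E ν (λ as → E (unif s) (λ a → ∑ (allFin m) (λ i → χ (eqFin (lookup as i) a)) + collisions as))
      ≡⟨ E-cong ν (λ as → trans (E-+ (unif s) _ _) (cong₂ _+_ (hit as) (E-const (unif s) (collisions as)))) ⟩
    E ν (λ as → ι m * recip s + collisions as)
      ≡⟨ trans (E-+ ν _ _) (cong (_+ E ν collisions) (E-const ν (ι m * recip s))) ⟩
    ι m * recip s + E ν collisions
      ≤⟨ +-monoʳ-≤ (ι m * recip s) (E-collisions s m) ⟩
    ι m * recip s + ι (m ℕ.* m) * recip s
      ≡⟨ sym (*-distribʳ-+ (recip s) (ι m) (ι (m ℕ.* m))) ⟩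
    (ι m + ι (m ℕ.* m)) * recip s
      ≡⟨ cong (_* recip s) (sym (ι-+ m (m ℕ.* m))) ⟩
    ι (m ℕ.+ m ℕ.* m) * recip s
      ≤⟨ *-monoʳ (0≤recip s) (ι-mono (ℕP.≤-trans (ℕP.≤-reflexive (sym (ℕP.*-suc m m))) (ℕP.m≤n+m (m ℕ.* suc m) (suc m)))) ⟩
    ι (suc m ℕ.* suc m) * recip s ∎
    where
    open ≤-Reasoning
    ν = pow (unif s) m
    hit : ∀ as → E (unif s) (λ a → ∑ (allFin m) (λ i → χ (eqFin (lookup as i) a))) ≡ ι m * recip s
    hit as = trans (E-∑ (unif s) (allFin m) _) (trans (∑-cong (allFin m) (λ i →
      trans (cong (recip s *_) (∑-eqFin-1 (lookup as i))) (*-identityʳ (recip s)))) (∑-const m (recip s)))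

-- Homomorphism densities and edge densities as expectations.

module HomDensities where
  open import Data.Fin using (Fin; zero; suc)
  open import Data.Fin.Subset using (Subset; ∣_∣)
  open import Data.List using (_∷_; allFin)
  open import Data.Nat as ℕ using (ℕ; zero; suc; NonZero)
  open import Data.Product using (proj₁; proj₂)
  open import Data.Rational hiding (NonZero; ∣_∣)
  open import Data.Rational.Properties
  open import Data.Vec using (_∷_; lookup)
  open import Function using (_∘_)
  open import Relation.Binary.PropositionalEquality
  open import Tactic.RingSolver using (solve-∀)
  open Rationals
  open Means
  open WeightedDensity

  -- `ext` takes the place of function extensionality: a map built by `consF` and the `lookup` of
  -- the corresponding vector agree only pointwise.
  E-allMaps : ∀ n m .{{_ : NonZero n}} (F : (Fin m → Fin n) → ℚ) → (∀ {f g} → (∀ i → f i ≡ g i) → F f ≡ F g) →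
    recip (n ℕ.^ m) * ∑ (allMaps m n) F ≡ E (pow (unif n) m) (F ∘ lookup)
  E-allMaps n zero F ext = trans (cong (_* (F (λ ()) + 0ℚ)) recip-1) (trans (*-identityˡ (F (λ ()) + 0ℚ))
    (trans (+-identityʳ (F (λ ()))) (ext (λ ()))))
  E-allMaps n (suc m) F ext = begin
    recip (n ℕ.* n ℕ.^ m) * ∑ (allMaps (suc m) n) F
      ≡⟨ cong₂ _*_ (recip-* n (n ℕ.^ m)) (trans (∑-concatMap _ (allFin n) F) (∑-cong (allFin n) (λ x → ∑-map (consF x) (allMaps m n) F))) ⟩
    recip n * recip (n ℕ.^ m) * ∑ (allFin n) (λ x → ∑ (allMaps m n) (F ∘ consF x))
      ≡⟨ *-assoc (recip n) (recip (n ℕ.^ m)) _ ⟩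
    recip n * (recip (n ℕ.^ m) * ∑ (allFin n) (λ x → ∑ (allMaps m n) (F ∘ consF x)))
      ≡⟨ cong (recip n *_) (sym (∑-*ˡ (allFin n) (recip (n ℕ.^ m)) _)) ⟩
    recip n * ∑ (allFin n) (λ x → recip (n ℕ.^ m) * ∑ (allMaps m n) (F ∘ consF x))
      ≡⟨ E-cong (unif n) (λ x → trans (E-allMaps n m (F ∘ consF x) (λ h → ext (λ { zero → refl ; (suc i) → h i })))
           (E-cong (pow (unif n) m) (λ v → ext (λ { zero → refl ; (suc i) → refl })))) ⟩
    E (unif n) (λ x → E (pow (unif n) m) (λ v → F (lookup (x ∷ v)))) ∎
    where open ≡-Reasoning

  χ-isHom : ∀ {m n} (H : Graph m) (G : Graph n) f →
    χ (isHom H G f) ≡ ∏ (edgeList H) (λ e → χ (G (f (proj₁ e)) (f (proj₂ e))))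
  χ-isHom H G f = allB-∏ _ (edgeList H)

  opaque
    density : ∀ {m n} → Graph m → Graph n → ℚ
    density = t

    density-t : ∀ {m n} (H : Graph m) (G : Graph n) → density H G ≡ t H G
    density-t H G = refl

  density-E : ∀ {m n} .{{_ : NonZero n}} (H : Graph m) (G : Graph n) →
    density H G ≡ E (pow (unif n) m) (λ v → χ (isHom H G (lookup v)))
  density-E {m} {n} H G = trans (density-t H G) (trans (ratio-recip (homCount H G) (n ℕ.^ m)) (trans (*-comm (ι (homCount H G)) (recip (n ℕ.^ m)))
    (trans (cong (recip (n ℕ.^ m) *_) (countTrue-∑ (isHom H G) (allMaps m n)))
      (E-allMaps n m (χ ∘ isHom H G) (λ {f} {g} h → trans (χ-isHom H G f) (trans
        (∏-cong (edgeList H) (λ e → cong₂ (λ x y → χ (G x y)) (h (proj₁ e)) (h (proj₂ e)))) (sym (χ-isHom H G g))))))))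

  -- The double mean runs over ordered pairs, so it counts every spanned edge twice; this cancels
  -- the factor `½` in `IsDense`.
  dense-fromMeans : ∀ {n} .{{_ : NonZero n}} {K : Graph n} → IsSimple K → ∀ {ρ d} →
    (∀ (X : Subset n) → ρ ≤ E (unif n) (χ ∘ lookup X) → d * (E (unif n) (χ ∘ lookup X) * E (unif n) (χ ∘ lookup X)) ≤
      E (unif n) (λ i → E (unif n) (λ j → χ (lookup X i) * χ (lookup X j) * χ (K i j)))) →
    Dense ρ d K
  dense-fromMeans {n} {K} simple {ρ} {d} h = dense⁺ (λ X large → subst₂ _≤_ (lhs X) (rhs X)
      (*-monoˡ 0≤½ (*-monoˡ (0≤* (0≤ι n) (0≤ι n)) (h X (subst₂ _≤_ scaled-ρ (scaled-X X) (*-monoˡ (0≤recip n) large))))))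
    where
    open ≡-Reasoning
    nr : ι n * recip n ≡ 1ℚ
    nr = ι-recip n
    two : ι 2 ≡ 1ℚ + 1ℚ
    two = trans (ι-suc 1) (cong (1ℚ +_) ι-1)
    size : ∀ X → E (unif n) (χ ∘ lookup X) ≡ recip n * ι ∣ X ∣
    size X = cong (recip n *_) (sym (ι-∣∣ X))
    form : ∀ X → E (unif n) (λ i → E (unif n) (λ j → χ (lookup X i) * χ (lookup X j) * χ (K i j))) ≡ recip n * (recip n * (ι 2 * ι (spannedEdges K X)))
    form X = cong (recip n *_) (trans (∑-*ˡ (allFin n) (recip n) _) (cong (recip n *_) (sym (spannedEdges-∑∑ K simple X))))
    scaled-ρ : recip n * (ρ * fromℕ n) ≡ ρ
    scaled-ρ = begin
      recip n * (ρ * fromℕ n) ≡⟨ cong (λ z → recip n * (ρ * z)) (sym (ι-fromℕ n)) ⟩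
      recip n * (ρ * ι n)     ≡⟨ eq (recip n) ρ (ι n) ⟩
      ρ * (ι n * recip n)     ≡⟨ trans (cong (ρ *_) nr) (*-identityʳ ρ) ⟩
      ρ                       ∎
      where
      eq : ∀ r ρ n → r * (ρ * n) ≡ ρ * (n * r)
      eq = solve-∀ ℚ-ring
    scaled-X : ∀ X → recip n * fromℕ ∣ X ∣ ≡ E (unif n) (χ ∘ lookup X)
    scaled-X X = trans (cong (recip n *_) (sym (ι-fromℕ ∣ X ∣))) (sym (size X))
    lhs : ∀ X → ½ * (ι n * ι n * (d * (E (unif n) (χ ∘ lookup X) * E (unif n) (χ ∘ lookup X)))) ≡ ½ * d * fromℕ (∣ X ∣ ℕ.* ∣ X ∣)
    lhs X = begin
      ½ * (ι n * ι n * (d * (E (unif n) (χ ∘ lookup X) * E (unif n) (χ ∘ lookup X))))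
        ≡⟨ cong (λ z → ½ * (ι n * ι n * (d * (z * z)))) (size X) ⟩
      ½ * (ι n * ι n * (d * ((recip n * ι ∣ X ∣) * (recip n * ι ∣ X ∣))))
        ≡⟨ eq d (ι n) (recip n) (ι ∣ X ∣) ⟩
      (ι n * recip n) * (ι n * recip n) * (½ * d * (ι ∣ X ∣ * ι ∣ X ∣))
        ≡⟨ cong₂ _*_ (cong₂ _*_ nr nr) (cong (½ * d *_) (trans (sym (ι-* ∣ X ∣ ∣ X ∣)) (ι-fromℕ (∣ X ∣ ℕ.* ∣ X ∣)))) ⟩
      1ℚ * 1ℚ * (½ * d * fromℕ (∣ X ∣ ℕ.* ∣ X ∣))
        ≡⟨ *-identityˡ _ ⟩
      ½ * d * fromℕ (∣ X ∣ ℕ.* ∣ X ∣) ∎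
      where
      eq : ∀ d n r x → ½ * (n * n * (d * ((r * x) * (r * x)))) ≡ (n * r) * (n * r) * (½ * d * (x * x))
      eq = solve-∀ ℚ-ring
    rhs : ∀ X → ½ * (ι n * ι n * E (unif n) (λ i → E (unif n) (λ j → χ (lookup X i) * χ (lookup X j) * χ (K i j)))) ≡ fromℕ (spannedEdges K X)
    rhs X = begin
      ½ * (ι n * ι n * E (unif n) (λ i → E (unif n) (λ j → χ (lookup X i) * χ (lookup X j) * χ (K i j))))
        ≡⟨ cong (λ z → ½ * (ι n * ι n * z)) (form X) ⟩
      ½ * (ι n * ι n * (recip n * (recip n * (ι 2 * ι (spannedEdges K X)))))
        ≡⟨ eq (ι n) (recip n) (ι 2) (ι (spannedEdges K X)) ⟩
      (ι n * recip n) * (ι n * recip n) * (½ * ι 2 * ι (spannedEdges K X))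
        ≡⟨ cong₂ _*_ (cong₂ _*_ nr nr) (cong (λ z → ½ * z * ι (spannedEdges K X)) two) ⟩
      1ℚ * 1ℚ * (½ * (1ℚ + 1ℚ) * ι (spannedEdges K X))
        ≡⟨ eq′ (ι (spannedEdges K X)) ⟩
      ι (spannedEdges K X)
        ≡⟨ ι-fromℕ (spannedEdges K X) ⟩
      fromℕ (spannedEdges K X) ∎
      where
      eq : ∀ n r t x → ½ * (n * n * (r * (r * (t * x)))) ≡ (n * r) * (n * r) * (½ * t * x)
      eq = solve-∀ ℚ-ring
      eq′ : ∀ x → 1ℚ * 1ℚ * (½ * (1ℚ + 1ℚ) * x) ≡ x
      eq′ = solve-∀ ℚ-ring

-- Realising a weighted kernel by a graph.

module SampledGraph where
  open import Data.Bool using (Bool)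
  open import Data.Fin using (Fin; zero; suc; combine; remQuot)
  import Data.Fin.Properties as FinP
  open import Data.Fin.Subset using (Subset)
  open import Data.List using ([]; _∷_)
  open import Data.List.Relation.Unary.All using (All; []; _∷_)
  open import Data.List.Relation.Unary.AllPairs using (AllPairs; []; _∷_)
  open import Data.Nat as ℕ using (ℕ; zero; suc; NonZero)
  import Data.Nat.Properties as ℕP
  open import Data.Product using (_×_; _,_; proj₁; proj₂)
  open import Data.Rational hiding (NonZero; ∣_∣)
  open import Data.Rational.Properties
  open import Data.Sum using (inj₁; inj₂)
  open import Data.Vec using (Vec; []; _∷_; lookup; zip)
  import Data.Vec.Properties as VecP
  open import Function using (_∘_)
  open import Relation.Binary.PropositionalEquality
  open import Tactic.RingSolver using (solve-∀)
  open Rationals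
  open Means
  open WeightedDensity
  open EdgeLists
  open Independence
  open HomDensities

  decodeVec : ∀ {n} m → Fin (n ℕ.^ m) → Vec (Fin n) m
  decodeVec         zero    _ = []
  decodeVec {n} (suc m) i = proj₁ (remQuot {n} (n ℕ.^ m) i) ∷ decodeVec m (proj₂ (remQuot {n} (n ℕ.^ m) i))

  decode-encodeVec : ∀ {n m} (v : Vec (Fin n) m) → decodeVec m (encodeVec v) ≡ v
  decode-encodeVec []      = refl
  decode-encodeVec {n} {suc m} (x ∷ v) = trans
    (cong (λ r → proj₁ r ∷ decodeVec m (proj₂ r)) (FinP.remQuot-combine {n} {n ℕ.^ m} x (encodeVec v)))
    (cong (x ∷_) (decode-encodeVec v))

  -- The sampled graph replaces the weights q by a genuine graph: a vertex carries a point σ,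
  -- a label a < s and independent samples u_0, …, u_{s-1} from the distribution S σ, and the
  -- vertices (σ, a, u) and (τ, b, v) are compared through the samples u_b and v_a.
  -- Once the vertices of H receive distinct labels, all samples used are different.
  module _ {n} (G : Graph n) (simple : IsSimple G)
    {p L s} .{{_ : NonZero p}} .{{_ : NonZero L}} .{{_ : NonZero s}} (S : Fin p → Fin L → Fin n) where

    private
      instance
        L^s≢0 : NonZero (L ℕ.^ s)
        L^s≢0 = ℕP.m^n≢0 L s
        sL^s≢0 : NonZero (s ℕ.* L ℕ.^ s)
        sL^s≢0 = ℕP.m*n≢0 s (L ℕ.^ s)

    Vertex : Set
    Vertex = Fin p × (Fin s × Vec (Fin L) s)

    order : ℕ
    order = p ℕ.* (s ℕ.* L ℕ.^ s)

    instance
      order≢0 : NonZero order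
      order≢0 = ℕP.m*n≢0 p (s ℕ.* L ℕ.^ s)

    P : Mean (Fin p)
    P = unif p

    Λ : Mean (Fin L)
    Λ = unif L

    Labels : Mean (Fin s)
    Labels = unif s

    Rows : Mean (Vec (Fin L) s)
    Rows = pow Λ s

    V : Mean Vertex
    V = P ⊗ (Labels ⊗ Rows)

    encodeVertex : Vertex → Fin order
    encodeVertex (σ , a , u) = combine σ (combine a (encodeVec u))

    decodeVertex : Fin order → Vertex
    decodeVertex i = let σ , r = remQuot {p} (s ℕ.* L ℕ.^ s) i ; a , x = remQuot {s} (L ℕ.^ s) r in σ , a , decodeVec s x

    decode-encode : ∀ ω → decodeVertex (encodeVertex ω) ≡ ω
    decode-encode (σ , a , u) = trans
      (cong (λ r → proj₁ r , decodeLabel (remQuot {s} (L ℕ.^ s) (proj₂ r))) (FinP.remQuot-combine {p} {s ℕ.* L ℕ.^ s} σ (combine a (encodeVec u))))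
      (cong (σ ,_) (trans (cong decodeLabel (FinP.remQuot-combine {s} {L ℕ.^ s} a (encodeVec u))) (cong (a ,_) (decode-encodeVec u))))
      where
      decodeLabel : Fin s × Fin (L ℕ.^ s) → Fin s × Vec (Fin L) s
      decodeLabel (a , x) = a , decodeVec s x

    E-vertices : ∀ f → E (unif order) f ≡ E V (f ∘ encodeVertex)
    E-vertices f = trans (E-unif-* p (s ℕ.* L ℕ.^ s) f) (E-cong P (λ σ →
      trans (E-unif-* s (L ℕ.^ s) _) (E-cong Labels (λ a → E-unif-^ L s _))))

    adjacent : Vertex → Vertex → Bool
    adjacent (σ , a , u) (τ , b , v) = G (S σ (lookup u b)) (S τ (lookup v a))

    sampled : Graph order
    sampled i j = adjacent (decodeVertex i) (decodeVertex j)

    -- Compared with itself, a vertex reads its own sample `u_a` on both sides, hence a single point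
    -- of `G`, which carries no loop.
    sampled-simple : IsSimple sampled
    sampled-simple = (λ i j → proj₁ simple _ _) , (λ i → proj₂ simple _)

    sampled-encode : ∀ ω ω′ → sampled (encodeVertex ω) (encodeVertex ω′) ≡ adjacent ω ω′
    sampled-encode ω ω′ = cong₂ adjacent (decode-encode ω) (decode-encode ω′)

    A : Fin n → Fin n → ℚ
    A x y = χ (G x y)

    0≤A : ∀ x y → 0ℚ ≤ A x y
    0≤A x y = 0≤χ (G x y)

    A≤1 : ∀ x y → A x y ≤ 1ℚ
    A≤1 x y = χ≤1 (G x y)

    -- The intermediate kernel, with the sample on one side averaged and the point on the other side
    -- still fixed. Adjacency is compared with `q` through it, one sample at a time.
    half-q : Fin p → Fin n → ℚ
    half-q σ y = E Λ (λ l → A (S σ l) y)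

    q : Fin p → Fin p → ℚ
    q σ τ = E Λ (λ l′ → half-q σ (S τ l′))

    0≤half-q : ∀ σ y → 0ℚ ≤ half-q σ y
    0≤half-q σ y = 0≤E Λ (λ l → 0≤χ (G (S σ l) y))

    half-q≤1 : ∀ σ y → half-q σ y ≤ 1ℚ
    half-q≤1 σ y = E≤ Λ (λ l → χ≤1 (G (S σ l) y))

    0≤q : ∀ σ τ → 0ℚ ≤ q σ τ
    0≤q σ τ = 0≤E Λ (λ l → 0≤half-q σ (S τ l))

    q≤1 : ∀ σ τ → q σ τ ≤ 1ℚ
    q≤1 σ τ = E≤ Λ (λ l → half-q≤1 σ (S τ l))

    module _ {η} (0<η : 0ℚ < η) (s-large : recip s ≤ η * η)
      (g : Vertex → ℚ) (0≤g : ∀ ω → 0ℚ ≤ g ω) (g≤1 : ∀ ω → g ω ≤ 1ℚ) where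

      mass : Fin p → ℚ
      mass σ = E Labels (λ a → E Rows (λ u → g (σ , a , u)))

      private
        diff-bound : ∀ {x y z} → 0ℚ ≤ x → x ≤ 1ℚ → 0ℚ ≤ y → y ≤ 1ℚ → 0ℚ ≤ z → z ≤ 1ℚ →
          (- 1ℚ ≤ z * (x - y)) × (z * (x - y) ≤ 1ℚ)
        diff-bound {x} {y} {z} 0≤x x≤1 0≤y y≤1 0≤z z≤1 =
          ≤-add (0≤+ (0≤+ (0≤* 0≤z 0≤x) (0≤* 0≤z (0≤- y≤1))) (0≤- z≤1)) (eq x y z) ,
          ≤-add (0≤+ (0≤+ (0≤* 0≤z 0≤y) (0≤* 0≤z (0≤- x≤1))) (0≤- z≤1)) (eq′ x y z)
          where
          eq : ∀ x y z → z * (x - y) ≡ - 1ℚ + (z * x + z * (1ℚ - y) + (1ℚ - z))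
          eq = solve-∀ ℚ-ring
          eq′ : ∀ x y z → 1ℚ ≡ z * (x - y) + (z * y + z * (1ℚ - x) + (1ℚ - z))
          eq′ = solve-∀ ℚ-ring

        E-sq-bound : ∀ {B : Set} (μ : Mean B) {f : B → ℚ} → (∀ b → (- 1ℚ ≤ f b) × (f b ≤ 1ℚ)) → E μ f * E μ f ≤ 1ℚ
        E-sq-bound μ h = ²-≤1 (≤E μ (proj₁ ∘ h)) (E≤ μ (proj₂ ∘ h))

        -- With `σ` and `a` fixed, this is the error of replacing the sample `u_b` by its average,
        -- after averaging over the point and the row of the other vertex. It depends on `u` only
        -- through that one sample and is centred in it; `k₂` is the mirror image for the second
        -- sample.
        k₁ : Fin p → Fin s → Fin s → Fin L → ℚ
        k₁ σ a b l = E (P ⊗ Rows) (λ (τ , v) → g (τ , b , v) * (A (S σ l) (S τ (lookup v a)) - half-q σ (S τ (lookup v a))))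

        k₂ : Fin p → Fin s → Fin s → Fin L → ℚ
        k₂ τ b a l = E (P ⊗ Rows) (λ (σ , u) → g (σ , a , u) * (half-q σ (S τ l) - q σ τ))

        E-centred : ∀ {B : Set} (μ : Mean B) (f : B → ℚ) → E μ (λ b → f b - E μ f) ≡ 0ℚ
        E-centred μ f = trans (E-- μ f _) (trans (cong (λ z → E μ f - z) (E-const μ (E μ f))) (+-inverseʳ (E μ f)))

        E-k₁ : ∀ σ a b → E Λ (k₁ σ a b) ≡ 0ℚ
        E-k₁ σ a b = trans (E-swap Λ (linear (P ⊗ Rows)) _) (trans (E-cong (P ⊗ Rows) (λ (τ , v) →
          trans (E-*ˡ Λ (g (τ , b , v)) _) (trans (cong (g (τ , b , v) *_) (E-centred Λ (λ l → A (S σ l) (S τ (lookup v a))))) (*-zeroʳ (g (τ , b , v))))))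
          (E-0 (P ⊗ Rows)))

        E-k₂ : ∀ τ b a → E Λ (k₂ τ b a) ≡ 0ℚ
        E-k₂ τ b a = trans (E-swap Λ (linear (P ⊗ Rows)) _) (trans (E-cong (P ⊗ Rows) (λ (σ , u) →
          trans (E-*ˡ Λ (g (σ , a , u)) _) (trans (cong (g (σ , a , u) *_) (E-centred Λ (λ l → half-q σ (S τ l)))) (*-zeroʳ (g (σ , a , u))))))
          (E-0 (P ⊗ Rows)))

        swap-label : ∀ (f : Vertex → ℚ) → E Labels (λ b → E (P ⊗ Rows) (λ (τ , v) → f (τ , b , v))) ≡ E V f
        swap-label f = E-swap Labels (linear P) _

        -- Averaging over the label `b` of the second vertex is the same as averaging over the
        -- coordinates of the row `u`, so `correlation` applies with the weight `g` as a function of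
        -- `u`.
        step₁ : - η ≤ E V (λ ω → E V (λ ω′ → g ω * g ω′ *
          (χ (adjacent ω ω′) - half-q (proj₁ ω) (S (proj₁ ω′) (lookup (proj₂ (proj₂ ω′)) (proj₁ (proj₂ ω)))))))
        step₁ = ≤E P (λ σ → ≤E Labels (λ a → subst (- η ≤_)
          (E-cong Rows (λ u → trans (cong (g (σ , a , u) *_) (swap-label _)) (trans (sym (E-*ˡ V (g (σ , a , u)) _))
            (E-cong V (λ ω′ → sym (*-assoc (g (σ , a , u)) (g ω′) _))))))
          (correlation Λ s 0<η s-large (k₁ σ a) (E-k₁ σ a)
            (λ b l → E-sq-bound (P ⊗ Rows) (λ (τ , v) → diff-bound (0≤A (S σ l) (S τ (lookup v a))) (A≤1 (S σ l) (S τ (lookup v a))) (0≤half-q σ (S τ (lookup v a))) (half-q≤1 σ (S τ (lookup v a))) (0≤g (τ , b , v)) (g≤1 (τ , b , v))))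
            (λ u → g (σ , a , u)) (λ u → 0≤g (σ , a , u)) (λ u → g≤1 (σ , a , u)))))

        step₂ : - η ≤ E V (λ ω → E V (λ ω′ → g ω * g ω′ *
          (half-q (proj₁ ω) (S (proj₁ ω′) (lookup (proj₂ (proj₂ ω′)) (proj₁ (proj₂ ω)))) - q (proj₁ ω) (proj₁ ω′))))
        step₂ = subst (- η ≤_) (E-swap V (linear V) _) (≤E P (λ τ → ≤E Labels (λ b → subst (- η ≤_)
          (E-cong Rows (λ v → trans (cong (g (τ , b , v) *_) (swap-label _)) (trans (sym (E-*ˡ V (g (τ , b , v)) _))
            (E-cong V (λ ω → eq (g (τ , b , v)) (g ω) _)))))
          (correlation Λ s 0<η s-large (k₂ τ b) (E-k₂ τ b)
            (λ a l → E-sq-bound (P ⊗ Rows) (λ (σ , u) → diff-bound (0≤half-q σ (S τ l)) (half-q≤1 σ (S τ l)) (0≤q σ τ) (q≤1 σ τ) (0≤g (σ , a , u)) (g≤1 (σ , a , u))))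
            (λ v → g (τ , b , v)) (λ v → 0≤g (τ , b , v)) (λ v → g≤1 (τ , b , v))))))
          where
          eq : ∀ x y z → x * (y * z) ≡ y * x * z
          eq = solve-∀ ℚ-ring

        mass-form : E V (λ ω → E V (λ ω′ → g ω * g ω′ * q (proj₁ ω) (proj₁ ω′))) ≡
          E P (λ σ → E P (λ τ → mass σ * mass τ * q σ τ))
        mass-form = E-cong P (λ σ → begin
          E Labels (λ a → E Rows (λ u → E P (λ τ → E Labels (λ b → E Rows (λ v → g (σ , a , u) * g (τ , b , v) * q σ τ)))))
            ≡⟨ E-cong Labels (λ a → E-cong Rows (λ u → E-cong P (λ τ →
                 trans (E-cong Labels (λ b → E-*ʳ Rows _ (q σ τ))) (trans (E-*ʳ Labels _ (q σ τ)) (cong (_* q σ τ)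
                 (trans (E-cong Labels (λ b → E-*ˡ Rows (g (σ , a , u)) _)) (E-*ˡ Labels (g (σ , a , u)) _))))))) ⟩
          E Labels (λ a → E Rows (λ u → E P (λ τ → g (σ , a , u) * mass τ * q σ τ)))
            ≡⟨ trans (E-cong Labels (λ a → E-swap Rows (linear P) _)) (E-swap Labels (linear P) _) ⟩
          E P (λ τ → E Labels (λ a → E Rows (λ u → g (σ , a , u) * mass τ * q σ τ)))
            ≡⟨ E-cong P (λ τ → trans (E-cong Labels (λ a → trans (E-*ʳ Rows _ (q σ τ)) (cong (_* q σ τ) (E-*ʳ Rows _ (mass τ)))))
                 (trans (E-*ʳ Labels _ (q σ τ)) (cong (_* q σ τ) (E-*ʳ Labels _ (mass τ))))) ⟩
          E P (λ τ → mass σ * mass τ * q σ τ) ∎)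
          where open ≡-Reasoning

      -- Telescoping through `half-q`: each of the two replacements costs at most `η`.
      sampled-form : E P (λ σ → E P (λ τ → mass σ * mass τ * q σ τ)) - (η + η) ≤
        E V (λ ω → E V (λ ω′ → g ω * g ω′ * χ (adjacent ω ω′)))
      sampled-form = subst₂ _≤_
        (trans (eq η _) (cong (λ z → z - (η + η)) mass-form))
        (trans (sym (E-+ V _ _)) (trans (E-cong V (λ ω → trans (cong₂ _+_ (sym (E-+ V _ _)) refl) (sym (E-+ V _ _)))) (E-cong V (λ ω → E-cong V (λ ω′ → eq′ (g ω * g ω′) _ _ _)))))
        (+-monoˡ-≤ (E V (λ ω → E V (λ ω′ → g ω * g ω′ * q (proj₁ ω) (proj₁ ω′)))) (≤-trans (+-mono-≤ step₁ step₂) (≤-reflexive (sym (E-+ V _ _)))))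
        where
        eq : ∀ η x → - η + - η + x ≡ x - (η + η)
        eq = solve-∀ ℚ-ring
        eq′ : ∀ c x y z → c * (x - y) + c * (y - z) + c * z ≡ c * x
        eq′ = solve-∀ ℚ-ring

    -- A vertex set acts on the base points through the weight `mass`, whose mean is the relative
    -- size of the set, so the size threshold carries over unchanged. The extra `η + η` in the
    -- hypothesis pays for the sampling error.
    sampled-dense : ∀ {ρ d η} → 0ℚ < η → recip s ≤ η * η →
      (∀ g → (∀ σ → 0ℚ ≤ g σ) → (∀ σ → g σ ≤ 1ℚ) → ρ ≤ E P g →
        d * (E P g * E P g) + (η + η) ≤ E P (λ σ → E P (λ τ → g σ * g τ * q σ τ))) →
      Dense ρ d sampled
    sampled-dense {ρ} {d} {η} 0<η s-large h = dense-fromMeans sampled-simple {ρ} {d} dense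
      where
      dense : ∀ (X : Subset order) → ρ ≤ E (unif order) (χ ∘ lookup X) →
        d * (E (unif order) (χ ∘ lookup X) * E (unif order) (χ ∘ lookup X)) ≤
        E (unif order) (λ i → E (unif order) (λ j → χ (lookup X i) * χ (lookup X j) * χ (sampled i j)))
      dense X large = subst₂ _≤_ (cong (λ z → d * (z * z)) (sym (E-vertices _)))
          (sym (trans (E-vertices _) (E-cong V (λ ω → trans (E-vertices _) (E-cong V (λ ω′ → cong (λ b → g ω * g ω′ * χ b) (sampled-encode ω ω′)))))))
          (≤-trans (≤-trans (≤-reflexive (eq (d * (E V g * E V g)) η)) (+-monoˡ-≤ (- (η + η)) (h (mass 0<η s-large g 0≤g g≤1)
            (λ σ → 0≤E Labels (λ a → 0≤E Rows (λ u → 0≤g (σ , a , u)))) (λ σ → E≤ Labels (λ a → E≤ Rows (λ u → g≤1 (σ , a , u))))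
            (subst (ρ ≤_) (E-vertices _) large))))
            (sampled-form 0<η s-large g 0≤g g≤1))
        where
        g : Vertex → ℚ
        g ω = χ (lookup X (encodeVertex ω))
        0≤g : ∀ ω → 0ℚ ≤ g ω
        0≤g ω = 0≤χ (lookup X (encodeVertex ω))
        g≤1 : ∀ ω → g ω ≤ 1ℚ
        g≤1 ω = χ≤1 (lookup X (encodeVertex ω))
        eq : ∀ x η → x ≡ x + (η + η) - (η + η)
        eq = solve-∀ ℚ-ring

    -- All the samples read by the edges are distinct, so they can be resampled one by one.
    E-∏-apart : ∀ {m} (σs : Vec (Fin p) m) (as : Vec (Fin s) m) → (∀ {i j} → lookup as i ≡ lookup as j → i ≡ j) →
      ∀ es → All (λ e → proj₁ e ≢ proj₂ e) es → AllPairs Apart es →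
      E (pow Rows m) (λ us → ∏ es (λ e →
        A (S (lookup σs (proj₁ e)) (read us (proj₁ e , lookup as (proj₂ e)))) (S (lookup σs (proj₂ e)) (read us (proj₂ e , lookup as (proj₁ e))))))
      ≡ ∏ es (λ e → q (lookup σs (proj₁ e)) (lookup σs (proj₂ e)))
    E-∏-apart {m} σs as inj [] [] [] = E-1 (pow Rows m)
    E-∏-apart {m} σs as inj ((i , j) ∷ es) (i≢j ∷ ne) (ap ∷ aps) = begin
      E ν (λ us → A (S σ (read us c)) (S τ (read us c′)) * rest us)
        ≡⟨ E-resample₂ Λ m s c _ ⟩
      E ν (λ us → E Λ (λ l → A (S σ (read (write us c l) c)) (S τ (read (write us c l) c′)) * rest (write us c l)))
        ≡⟨ E-cong ν (λ us → trans (E-cong Λ (λ l → cong₂ _*_ (cong₂ (λ x y → A (S σ x) (S τ y)) (read-write us c l)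
             (read-write′ us c c′ l c≢c′)) (rest-write us c l (λ e ap → proj₁ (untouched ap))))) (E-*ʳ Λ _ (rest us))) ⟩
      E ν (λ us → half-q σ (S τ (read us c′)) * rest us)
        ≡⟨ E-resample₂ Λ m s c′ _ ⟩
      E ν (λ us → E Λ (λ l → half-q σ (S τ (read (write us c′ l) c′)) * rest (write us c′ l)))
        ≡⟨ E-cong ν (λ us → trans (E-cong Λ (λ l → cong₂ _*_ (cong (λ x → half-q σ (S τ x)) (read-write us c′ l))
             (rest-write us c′ l (λ e ap → proj₂ (untouched ap))))) (E-*ʳ Λ _ (rest us))) ⟩
      E ν (λ us → q σ τ * rest us)
        ≡⟨ E-*ˡ ν (q σ τ) rest ⟩
      q σ τ * E ν rest
        ≡⟨ cong (q σ τ *_) (E-∏-apart σs as inj es ne aps) ⟩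
      q σ τ * ∏ es (λ e → q (lookup σs (proj₁ e)) (lookup σs (proj₂ e))) ∎
      where
      open ≡-Reasoning
      ν = pow Rows m
      σ = lookup σs i
      τ = lookup σs j
      c c′ : Fin m × Fin s
      c  = i , lookup as j
      c′ = j , lookup as i
      factor : Vec (Vec (Fin L) s) m → Fin m × Fin m → ℚ
      factor us e = A (S (lookup σs (proj₁ e)) (read us (proj₁ e , lookup as (proj₂ e)))) (S (lookup σs (proj₂ e)) (read us (proj₂ e , lookup as (proj₁ e))))
      rest : Vec (Vec (Fin L) s) m → ℚ
      rest us = ∏ es (factor us)
      c≢c′ : c ≢ c′
      c≢c′ eq = i≢j (cong proj₁ eq)
      Avoids : Fin m × Fin s → Fin m × Fin m → Set
      Avoids x e = x ≢ (proj₁ e , lookup as (proj₂ e)) × x ≢ (proj₂ e , lookup as (proj₁ e))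
      -- Equal cells have the same vertex and the same label; as labels are distinct, they also have
      -- the same partner, so the two edges would coincide up to orientation.
      untouched : ∀ {e} → Apart (i , j) e → Avoids c e × Avoids c′ e
      untouched (h , h′) =
        ((λ eq → h (cong proj₁ eq , inj (cong proj₂ eq))) , (λ eq → h′ (cong proj₁ eq , inj (cong proj₂ eq)))) ,
        ((λ eq → h′ (inj (cong proj₂ eq) , cong proj₁ eq)) , (λ eq → h (inj (cong proj₂ eq) , cong proj₁ eq)))
      rest-write : ∀ us x l → (∀ e → Apart (i , j) e → Avoids x e) → rest (write us x l) ≡ rest us
      rest-write us x l h = go ap
        where
        go : ∀ {es} → All (Apart (i , j)) es → ∏ es (factor (write us x l)) ≡ ∏ es (factor us)
        go []       = refl
        go {e ∷ _} (a ∷ as′) = cong₂ _*_ (cong₂ (λ y z → A (S (lookup σs (proj₁ e)) y) (S (lookup σs (proj₂ e)) z))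
          (read-write′ us x _ l (proj₁ (h e a))) (read-write′ us x _ l (proj₂ (h e a)))) (go as′)

    -- With distinct labels the edge product has expectation exactly the product of the weights;
    -- otherwise it is at most 1, hence at most the number of collisions. An upper bound is what is
    -- wanted, since the lower bound that KNRS gives for the sampled graph has to pass to the
    -- weights.
    sampled-count : ∀ {m} (H : Graph m) → density H sampled ≤
      E (pow P m) (λ σs → ∏ (edgeList H) (λ e → q (lookup σs (proj₁ e)) (lookup σs (proj₂ e)))) + ι (m ℕ.* m) * recip s
    sampled-count {m} H = begin
      density H sampled
        ≡⟨ trans (density-E H sampled) (E-cong (pow (unif order) m) (λ v → χ-isHom H sampled (lookup v))) ⟩
      E (pow (unif order) m) (λ v → ∏ es (λ e → χ (sampled (lookup v (proj₁ e)) (lookup v (proj₂ e)))))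
        ≡⟨ trans (E-pow-map (unif order) V encodeVertex E-vertices m _) (E-cong (pow V m) (λ ωs → ∏-cong es (λ e → cong χ
             (trans (cong₂ sampled (VecP.lookup-map (proj₁ e) encodeVertex ωs) (VecP.lookup-map (proj₂ e) encodeVertex ωs)) (sampled-encode (lookup ωs (proj₁ e)) (lookup ωs (proj₂ e))))))) ⟩
      E (pow V m) (λ ωs → ∏ es (λ e → χ (adjacent (lookup ωs (proj₁ e)) (lookup ωs (proj₂ e)))))
        ≡⟨ trans (E-pow-⊗ P (Labels ⊗ Rows) m _) (E-cong (pow P m) (λ σs → trans (E-pow-⊗ Labels Rows m _)
             (E-cong (pow Labels m) (λ as → E-cong (pow Rows m) (λ us → ∏-cong es (λ e → cong₂ (λ ω ω′ → χ (adjacent ω ω′))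
               (unzip σs as us (proj₁ e)) (unzip σs as us (proj₂ e)))))))) ⟩
      E (pow P m) (λ σs → E (pow Labels m) (λ as → E (pow Rows m) (λ us → ∏ es (factor σs as us))))
        ≤⟨ E-mono (pow P m) (λ σs → E-mono (pow Labels m) (λ as → bound σs as)) ⟩
      E (pow P m) (λ σs → E (pow Labels m) (λ as → Q σs + collisions as))
        ≡⟨ E-cong (pow P m) (λ σs → trans (E-+ (pow Labels m) _ _) (cong (_+ E (pow Labels m) collisions) (E-const (pow Labels m) (Q σs)))) ⟩
      E (pow P m) (λ σs → Q σs + E (pow Labels m) collisions)
        ≡⟨ trans (E-+ (pow P m) _ _) (cong (E (pow P m) Q +_) (E-const (pow P m) _)) ⟩
      E (pow P m) Q + E (pow Labels m) collisions
        ≤⟨ +-monoʳ-≤ (E (pow P m) Q) (E-collisions s m) ⟩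
      E (pow P m) Q + ι (m ℕ.* m) * recip s ∎
      where
      open ≤-Reasoning
      es = edgeList H
      Q : Vec (Fin p) m → ℚ
      Q σs = ∏ es (λ e → q (lookup σs (proj₁ e)) (lookup σs (proj₂ e)))
      factor : Vec (Fin p) m → Vec (Fin s) m → Vec (Vec (Fin L) s) m → Fin m × Fin m → ℚ
      factor σs as us e = A (S (lookup σs (proj₁ e)) (read us (proj₁ e , lookup as (proj₂ e)))) (S (lookup σs (proj₂ e)) (read us (proj₂ e , lookup as (proj₁ e))))
      unzip : ∀ (σs : Vec (Fin p) m) (as : Vec (Fin s) m) (us : Vec (Vec (Fin L) s) m) i →
        lookup (zip σs (zip as us)) i ≡ (lookup σs i , lookup as i , lookup us i)
      unzip σs as us i = trans (VecP.lookup-zip i σs (zip as us)) (cong (lookup σs i ,_) (VecP.lookup-zip i as us))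
      bound : ∀ σs as → E (pow Rows m) (λ us → ∏ es (factor σs as us)) ≤ Q σs + collisions as
      bound σs as with distinct⊎collide as
      ... | inj₁ inj = ≤-trans (≤-reflexive (E-∏-apart σs as inj es (edgeList-irreflexive H) (edgeList-apart H)))
              (≤-add (0≤collisions as) refl)
      ... | inj₂ 1≤c = ≤-trans (≤-trans (E≤ (pow Rows m) (λ us → ∏≤1 es (λ e → 0≤A _ _) (λ e → A≤1 _ _))) 1≤c)
              (≤-add (0≤∏ es (λ e → 0≤q _ _)) (+-comm (Q σs) (collisions as)))

-- Homomorphisms from a subdivision as tuples of walks.

module Subdivisions where
  open import Data.Bool using (Bool; true; false; _∧_; _∨_)
  import Data.Bool.Properties as BoolP
  open import Data.Fin as Fin using (Fin; zero; suc; toℕ; combine; splitAt; _↑ˡ_; _↑ʳ_)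
  import Data.Fin.Properties as FinP
  open import Data.List as List using (List; []; _∷_; allFin; map)
  open import Data.List.Membership.Propositional.Properties using (∈-allFin)
  open import Data.List.Relation.Unary.All as All using (All; []; _∷_)
  open import Data.Nat as ℕ using (ℕ; zero; suc; NonZero; _≡ᵇ_)
  import Data.Nat.Properties as ℕP
  open import Data.Product using (_×_; _,_; proj₁; proj₂)
  open import Data.Rational hiding (NonZero; ∣_∣)
  open import Data.Rational.Properties
  open import Data.Sum using (_⊎_; inj₁; inj₂)
  open import Data.Unit using (tt)
  open import Data.Vec using (Vec; []; _∷_; lookup; _++_; concat)
  import Data.Vec.Properties as VecP
  open import Function using (_∘_)
  open import Relation.Binary.Definitions using (tri<; tri≈; tri>)
  open import Relation.Binary.PropositionalEquality
  open Rationals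
  open Means
  open Walks
  open EdgeLists
  open Independence
  open HomDensities

  ≡ᵇ-true⁻ : ∀ {a b} → (a ≡ᵇ b) ≡ true → a ≡ b
  ≡ᵇ-true⁻ {a} {b} eq = ℕP.≡ᵇ⇒≡ a b (subst Data.Bool.T (sym eq) tt)

  ≡ᵇ-true : ∀ {a b} → a ≡ b → (a ≡ᵇ b) ≡ true
  ≡ᵇ-true {zero}  refl = refl
  ≡ᵇ-true {suc a} refl = ≡ᵇ-true {a} refl

  suc-≡ᵇ : ∀ a → (suc a ≡ᵇ a) ≡ false
  suc-≡ᵇ zero    = refl
  suc-≡ᵇ (suc a) = suc-≡ᵇ a

  ≡ᵇ-sym : ∀ a b → (a ≡ᵇ b) ≡ (b ≡ᵇ a)
  ≡ᵇ-sym zero    zero    = refl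
  ≡ᵇ-sym zero    (suc b) = refl
  ≡ᵇ-sym (suc a) zero    = refl
  ≡ᵇ-sym (suc a) (suc b) = ≡ᵇ-sym a b

  eqFin-sym : ∀ {n} (i j : Fin n) → eqFin i j ≡ eqFin j i
  eqFin-sym i j = ≡ᵇ-sym (toℕ i) (toℕ j)

  eqFin-true : ∀ {n} {i j : Fin n} → eqFin i j ≡ true → i ≡ j
  eqFin-true eq = FinP.toℕ-injective (≡ᵇ-true⁻ eq)

  ∧-true⁻ : ∀ {a b} → (a ∧ b) ≡ true → a ≡ true × b ≡ true
  ∧-true⁻ {true} {true} eq = refl , refl

  ∧-true : ∀ {a b} → a ≡ true → b ≡ true → (a ∧ b) ≡ true
  ∧-true refl refl = refl

  ∨-true⁻ : ∀ {a b} → (a ∨ b) ≡ true → a ≡ true ⊎ b ≡ true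
  ∨-true⁻ {true}  eq = inj₁ refl
  ∨-true⁻ {false} eq = inj₂ eq

  ∨-trueʳ : ∀ {a b} → b ≡ true → (a ∨ b) ≡ true
  ∨-trueʳ {true}  eq = refl
  ∨-trueʳ {false} eq = eq

  ∨-trueˡ : ∀ {a b} → a ≡ true → (a ∨ b) ≡ true
  ∨-trueˡ refl = refl

  true-ext : ∀ {a b} → (a ≡ true → b ≡ true) → (b ≡ true → a ≡ true) → a ≡ b
  true-ext {true}          f g = sym (f refl)
  true-ext {false} {true}  f g = g refl
  true-ext {false} {false} f g = refl

  allB⁻ : ∀ {A : Set} {p : A → Bool} xs → allB (map p xs) ≡ true → All (λ x → p x ≡ true) xs
  allB⁻ []       eq = []
  allB⁻ (x ∷ xs) eq = proj₁ (∧-true⁻ eq) ∷ allB⁻ xs (proj₂ (∧-true⁻ eq))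

  allB⁺ : ∀ {A : Set} {p : A → Bool} {xs} → All (λ x → p x ≡ true) xs → allB (map p xs) ≡ true
  allB⁺ []       = refl
  allB⁺ (p ∷ ps) = ∧-true p (allB⁺ ps)

  isHom⁻ : ∀ {m n} {K : Graph m} {G : Graph n} → IsSimple K → IsSimple G → (f : Fin m → Fin n) →
    isHom K G f ≡ true → ∀ v w → K v w ≡ true → G (f v) (f w) ≡ true
  isHom⁻ {K = K} {G} (K-sym , K-irr) (G-sym , _) f hom v w Kvw with ℕP.<-cmp (toℕ v) (toℕ w)
  ... | tri< v<w _ _ = All-edgeList⁻ K (allB⁻ (edgeList K) hom) v w Kvw v<w
  ... | tri> _ _ w<v = trans (G-sym (f v) (f w)) (All-edgeList⁻ K (allB⁻ (edgeList K) hom) w v (trans (K-sym w v) Kvw) w<v)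
  ... | tri≈ _ v≡w _ with FinP.toℕ-injective v≡w
  ...   | refl with () ← trans (sym (K-irr v)) Kvw

  isHom⁺ : ∀ {m n} {K : Graph m} {G : Graph n} (f : Fin m → Fin n) →
    (∀ v w → K v w ≡ true → G (f v) (f w) ≡ true) → isHom K G f ≡ true
  isHom⁺ {K = K} f h = allB⁺ (All-edgeList⁺ K (λ v w Kvw _ → h v w Kvw))

  chain : ∀ {n s} → Graph n → Fin n → Vec (Fin n) s → Fin n → Bool
  chain G x []       z = G x z
  chain G x (y ∷ ys) z = G x y ∧ chain G y ys z

  -- Here `y ∷ ys` are all the internal vertices of a path, indexed as in `subdivAdj`. The parameter
  -- `s` is thus one less than their number, and `toℕ p ≡ s` says that `p` is the last.
  chain⁺ : ∀ {n s} (G : Graph n) y (ys : Vec (Fin n) s) z →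
    (∀ p p′ → suc (toℕ p) ≡ toℕ p′ → G (lookup (y ∷ ys) p) (lookup (y ∷ ys) p′) ≡ true) →
    (∀ p → toℕ p ≡ s → G (lookup (y ∷ ys) p) z ≡ true) → chain G y ys z ≡ true
  chain⁺ G y []        z steps end = end zero refl
  chain⁺ G y (y′ ∷ ys) z steps end = ∧-true (steps zero (suc zero) refl)
    (chain⁺ G y′ ys z (λ p p′ eq → steps (suc p) (suc p′) (cong suc eq)) (λ p eq → end (suc p) (cong suc eq)))

  chain-end : ∀ {n s} (G : Graph n) y (ys : Vec (Fin n) s) z → chain G y ys z ≡ true →
    ∀ p → toℕ p ≡ s → G (lookup (y ∷ ys) p) z ≡ true
  chain-end G y []        z c zero    eq = c
  chain-end G y (y′ ∷ ys) z c (suc p) eq = chain-end G y′ ys z (proj₂ (∧-true⁻ c)) p (ℕP.suc-injective eq)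

  chain-step : ∀ {n s} (G : Graph n) y (ys : Vec (Fin n) s) z → chain G y ys z ≡ true →
    ∀ p p′ → suc (toℕ p) ≡ toℕ p′ → G (lookup (y ∷ ys) p) (lookup (y ∷ ys) p′) ≡ true
  chain-step G y (y′ ∷ ys) z c zero    (suc zero) eq = proj₁ (∧-true⁻ c)
  chain-step G y (y′ ∷ ys) z c (suc p) (suc p′)   eq = chain-step G y′ ys z (proj₂ (∧-true⁻ c)) p p′ (ℕP.suc-injective eq)

  E-pow-+ : ∀ {A : Set} (μ : Mean A) a b (F : Vec A (a ℕ.+ b) → ℚ) →
    E (pow μ (a ℕ.+ b)) F ≡ E (pow μ a) (λ x → E (pow μ b) (λ y → F (x ++ y)))
  E-pow-+ μ zero    b F = refl
  E-pow-+ μ (suc a) b F = E-cong μ (λ x → E-pow-+ μ a b (λ v → F (x ∷ v)))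

  E-pow-* : ∀ {A : Set} (μ : Mean A) a b (F : Vec A (a ℕ.* b) → ℚ) →
    E (pow μ (a ℕ.* b)) F ≡ E (pow (pow μ b) a) (λ Y → F (concat Y))
  E-pow-* μ zero    b F = refl
  E-pow-* μ (suc a) b F = trans (E-pow-+ μ b (a ℕ.* b) F) (E-cong (pow μ b) (λ x → E-pow-* μ a b (λ v → F (x ++ v))))

  E-pow-∏ : ∀ {A : Set} (μ : Mean A) n (h : Fin n → A → ℚ) →
    E (pow μ n) (λ Y → ∏ (allFin n) (λ k → h k (lookup Y k))) ≡ ∏ (allFin n) (λ k → E μ (h k))
  E-pow-∏ μ zero    h = refl
  E-pow-∏ μ (suc n) h = begin
    E μ (λ a → E (pow μ n) (λ Y → ∏ (allFin (suc n)) (λ k → h k (lookup (a ∷ Y) k))))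
      ≡⟨ E-cong μ (λ a → trans (E-cong (pow μ n) (λ Y → ∏-allFin-suc n (λ k → h k (lookup (a ∷ Y) k)))) (E-*ˡ (pow μ n) (h zero a) _)) ⟩
    E μ (λ a → h zero a * E (pow μ n) (λ Y → ∏ (allFin n) (λ k → h (suc k) (lookup Y k))))
      ≡⟨ E-*ʳ μ (h zero) _ ⟩
    E μ (h zero) * E (pow μ n) (λ Y → ∏ (allFin n) (λ k → h (suc k) (lookup Y k)))
      ≡⟨ cong (E μ (h zero) *_) (E-pow-∏ μ n (h ∘ suc)) ⟩
    E μ (h zero) * ∏ (allFin n) (λ k → E μ (h (suc k)))
      ≡⟨ sym (∏-allFin-suc n (λ k → E μ (h k))) ⟩
    ∏ (allFin (suc n)) (λ k → E μ (h k)) ∎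
    where open ≡-Reasoning

  module Subdivide {m} (H : Graph m) (s : ℕ) where

    e : ℕ
    e = numEdges H

    encode : SubdivVertex m e s → Fin (m ℕ.+ e ℕ.* s)
    encode (inj₁ i)       = i ↑ˡ (e ℕ.* s)
    encode (inj₂ (k , p)) = m ↑ʳ combine k p

    decode-encode : ∀ α → decode e s (encode α) ≡ α
    decode-encode (inj₁ i) rewrite FinP.splitAt-↑ˡ m i (e ℕ.* s) = refl
    decode-encode (inj₂ (k , p)) rewrite FinP.splitAt-↑ʳ m (e ℕ.* s) (combine k p) = cong inj₂ (FinP.remQuot-combine k p)

    encode-decode : ∀ v → encode (decode e s v) ≡ v
    encode-decode v with splitAt m v in eq
    ... | inj₁ i = trans (cong (Fin.join m (e ℕ.* s)) (sym eq)) (FinP.join-splitAt m (e ℕ.* s) v)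
    ... | inj₂ w = trans (cong (m ↑ʳ_) (FinP.combine-remQuot {e} s w))
                     (trans (cong (Fin.join m (e ℕ.* s)) (sym eq)) (FinP.join-splitAt m (e ℕ.* s) v))

    subdivAdj-sym : ∀ α β → subdivAdj H s α β ≡ subdivAdj H s β α
    subdivAdj-sym (inj₁ i) (inj₁ j) = refl
    subdivAdj-sym (inj₁ i) (inj₂ _) = refl
    subdivAdj-sym (inj₂ _) (inj₁ j) = refl
    subdivAdj-sym (inj₂ (k , p)) (inj₂ (k′ , p′)) = cong₂ _∧_ (eqFin-sym k k′)
      (BoolP.∨-comm (suc (toℕ p) ≡ᵇ toℕ p′) (suc (toℕ p′) ≡ᵇ toℕ p))

    subdivAdj-irr : ∀ α → subdivAdj H s α α ≡ false
    subdivAdj-irr (inj₁ i) = refl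
    subdivAdj-irr (inj₂ (k , p)) rewrite suc-≡ᵇ (toℕ p) = BoolP.∧-zeroʳ (eqFin k k)

    subdivision-simple : IsSimple (subdivision s H)
    subdivision-simple = (λ v w → subdivAdj-sym (decode e s v) (decode e s w)) , (λ v → subdivAdj-irr (decode e s v))

    source target : Fin e → Fin m
    source k = proj₁ (List.lookup (edgeList H) k)
    target k = proj₂ (List.lookup (edgeList H) k)

  -- There is at least one internal vertex on each path: `subdivAdj` never joins two original
  -- vertices, so `s = 0` would give an edgeless graph instead of `H`.
  module SubdivisionHoms {m} (H : Graph m) (s′ : ℕ) {n} .{{_ : NonZero n}} (G : Graph n) (G-simple : IsSimple G) where

    s : ℕ
    s = suc s′

    open Subdivide H s
    open WalkOperator G G-simple

    value : Vec (Fin n) m → Vec (Vec (Fin n) s) e → SubdivVertex m e s → Fin n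
    value x Y (inj₁ i)       = lookup x i
    value x Y (inj₂ (k , p)) = lookup (lookup Y k) p

    lookup-encode : ∀ x Y α → lookup (x ++ concat Y) (encode α) ≡ value x Y α
    lookup-encode x Y (inj₁ i)       = VecP.lookup-++ˡ x (concat Y) i
    lookup-encode x Y (inj₂ (k , p)) = trans (VecP.lookup-++ʳ x (concat Y) (combine k p)) (VecP.lookup-concat Y k p)

    lookup-decode : ∀ x Y v → lookup (x ++ concat Y) v ≡ value x Y (decode e s v)
    lookup-decode x Y v = trans (cong (lookup (x ++ concat Y)) (sym (encode-decode v))) (lookup-encode x Y (decode e s v))

    link : Vec (Fin n) m → Vec (Vec (Fin n) s) e → Fin e → Bool
    link x Y k = chain G (lookup x (source k)) (lookup Y k) (lookup x (target k))

    link⁺ : ∀ x Y → (∀ α β → subdivAdj H s α β ≡ true → G (value x Y α) (value x Y β) ≡ true) → ∀ k → link x Y k ≡ true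
    link⁺ x Y h k with lookup Y k in eq
    ... | y ∷ ys = ∧-true
        (subst (λ z → G (lookup x (source k)) (lookup z zero) ≡ true) eq
          (h (inj₁ (source k)) (inj₂ (k , zero)) (∨-trueˡ (eqFin-refl (source k)))))
        (chain⁺ G y ys (lookup x (target k))
          (λ p p′ next → subst (λ z → G (lookup z p) (lookup z p′) ≡ true) eq
            (h (inj₂ (k , p)) (inj₂ (k , p′)) (∧-true (eqFin-refl k) (∨-trueˡ (≡ᵇ-true next)))))
          (λ p last → subst (λ z → G (lookup z p) (lookup x (target k)) ≡ true) eq
            (h (inj₂ (k , p)) (inj₁ (target k)) (∨-trueʳ {(toℕ p ≡ᵇ 0) ∧ eqFin (target k) (source k)}
              (∧-true (≡ᵇ-true last) (eqFin-refl (target k)))))))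

    link⁻ : ∀ x Y → (∀ k → link x Y k ≡ true) → ∀ α β → subdivAdj H s α β ≡ true → G (value x Y α) (value x Y β) ≡ true
    link⁻ x Y c = go
      where
      side : ∀ i k p → subdivAdj H s (inj₁ i) (inj₂ (k , p)) ≡ true → G (lookup x i) (lookup (lookup Y k) p) ≡ true
      side i k p adj with lookup Y k | c k | ∨-true⁻ {(toℕ p ≡ᵇ 0) ∧ eqFin i (source k)} adj
      ... | y ∷ ys | ck | inj₁ start with p | eqFin-true {i = i} (proj₂ (∧-true⁻ {toℕ p ≡ᵇ 0} start)) | proj₁ (∧-true⁻ {toℕ p ≡ᵇ 0} start)
      ...   | zero | refl | _ = proj₁ (∧-true⁻ ck)
      side i k p adj | y ∷ ys | ck | inj₂ end with eqFin-true {i = i} (proj₂ (∧-true⁻ {suc (toℕ p) ≡ᵇ s} end))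
      ...   | refl = trans (proj₁ G-simple _ _) (chain-end G y ys (lookup x (target k)) (proj₂ (∧-true⁻ {G (lookup x (source k)) y} ck)) p
                (≡ᵇ-true⁻ (proj₁ (∧-true⁻ {suc (toℕ p) ≡ᵇ s} end))))
      step : ∀ k p p′ → suc (toℕ p) ≡ toℕ p′ → G (lookup (lookup Y k) p) (lookup (lookup Y k) p′) ≡ true
      step k p p′ next with lookup Y k | c k
      ... | y ∷ ys | ck = chain-step G y ys (lookup x (target k)) (proj₂ (∧-true⁻ {G (lookup x (source k)) y} ck)) p p′ next
      go : ∀ α β → subdivAdj H s α β ≡ true → G (value x Y α) (value x Y β) ≡ true
      go (inj₁ i) (inj₂ (k , p)) adj = side i k p adj
      go (inj₂ (k , p)) (inj₁ j) adj = trans (proj₁ G-simple _ _) (side j k p adj)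
      go (inj₂ (k , p)) (inj₂ (k′ , p′)) adj with eqFin-true {i = k} (proj₁ (∧-true⁻ {eqFin k k′} adj)) | ∨-true⁻ {suc (toℕ p) ≡ᵇ toℕ p′} (proj₂ (∧-true⁻ {eqFin k k′} adj))
      ... | refl | inj₁ next = step k p p′ (≡ᵇ-true⁻ next)
      ... | refl | inj₂ next = trans (proj₁ G-simple _ _) (step k p′ p (≡ᵇ-true⁻ next))

    -- Once the original vertices are placed, the condition splits into one condition per path, and
    -- different paths use disjoint blocks of `Y`. Independence of the blocks then turns the
    -- expectation over `Y` into a product over the edges.
    isHom-link : ∀ x Y → isHom (subdivision s H) G (lookup (x ++ concat Y)) ≡ allB (map (link x Y) (allFin e))
    isHom-link x Y = true-ext
      (λ hom → allB⁺ (All.universal (link⁺ x Y (λ α β adj → subst₂ (λ a b → G a b ≡ true) (lookup-encode x Y α) (lookup-encode x Y β)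
        (isHom⁻ subdivision-simple G-simple _ hom (encode α) (encode β)
          (trans (cong₂ (subdivAdj H s) (decode-encode α) (decode-encode β)) adj)))) (allFin e)))
      (λ links → isHom⁺ {K = subdivision s H} {G} _ (λ v w adj → subst₂ (λ a b → G a b ≡ true) (sym (lookup-decode x Y v)) (sym (lookup-decode x Y w))
        (link⁻ x Y (λ k → All.lookup (allB⁻ (allFin e) links) (∈-allFin k)) (decode e s v) (decode e s w) adj)))

    E-chain : ∀ r x z → E (pow U r) (λ ys → χ (chain G x ys z)) ≡ A^ r z x
    E-chain zero    x z = refl
    E-chain (suc r) x z = E-cong U (λ y → trans (E-cong (pow U r) (λ ys → χ-∧ (G x y) (chain G y ys z)))
      (trans (E-*ˡ (pow U r) (A x y) _) (cong (A x y *_) (E-chain r y z))))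

    density-subdivision : density (subdivision s H) G ≡
      E (pow U m) (λ x → ∏ (edgeList H) (λ ε → A^ s (lookup x (proj₂ ε)) (lookup x (proj₁ ε))))
    density-subdivision = begin
      density (subdivision s H) G
        ≡⟨ density-E (subdivision s H) G ⟩
      E (pow U (m ℕ.+ e ℕ.* s)) (λ v → χ (isHom (subdivision s H) G (lookup v)))
        ≡⟨ trans (E-pow-+ U m (e ℕ.* s) _) (E-cong (pow U m) (λ x → E-pow-* U e s _)) ⟩
      E (pow U m) (λ x → E (pow (pow U s) e) (λ Y → χ (isHom (subdivision s H) G (lookup (x ++ concat Y)))))
        ≡⟨ E-cong (pow U m) (λ x → E-cong (pow (pow U s) e) (λ Y → trans (cong χ (isHom-link x Y)) (allB-∏ (link x Y) (allFin e)))) ⟩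
      E (pow U m) (λ x → E (pow (pow U s) e) (λ Y → ∏ (allFin e) (λ k → χ (chain G (lookup x (source k)) (lookup Y k) (lookup x (target k))))))
        ≡⟨ E-cong (pow U m) (λ x → trans (E-pow-∏ (pow U s) e (λ k ys → χ (chain G (lookup x (source k)) ys (lookup x (target k)))))
             (∏-cong (allFin e) (λ k → E-chain s (lookup x (source k)) (lookup x (target k))))) ⟩
      E (pow U m) (λ x → ∏ (allFin e) (λ k → A^ s (lookup x (target k)) (lookup x (source k))))
        ≡⟨ E-cong (pow U m) (λ x → ∏-lookup (edgeList H) (λ ε → A^ s (lookup x (proj₂ ε)) (lookup x (proj₁ ε)))) ⟩
      E (pow U m) (λ x → ∏ (edgeList H) (λ ε → A^ s (lookup x (proj₂ ε)) (lookup x (proj₁ ε)))) ∎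
      where open ≡-Reasoning

-- Counting edges of subdivisions and of regular graphs.

module EdgeCounts where
  open import Data.Bool using (Bool; true; false; _∧_; _∨_; if_then_else_)
  open import Data.Empty using (⊥-elim)
  open import Data.Fin using (Fin; zero; suc; toℕ)
  import Data.Fin.Properties as FinP
  open import Data.List as List using (List; []; _∷_; allFin)
  open import Data.Nat as ℕ using (ℕ; zero; suc; _≡ᵇ_)
  import Data.Nat.Properties as ℕP
  open import Data.Product using (_×_; _,_; proj₁; proj₂)
  open import Data.Rational hiding (NonZero; ∣_∣)
  open import Data.Rational.Properties
  open import Data.Sum using (inj₁; inj₂)
  open import Relation.Binary.PropositionalEquality
  open import Relation.Nullary using (¬_)
  open import Tactic.RingSolver using (solve-∀)
  open Rationals
  open Means
  open WeightedDensity
  open Subdivisions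

  handshake : ∀ {n} (G : Graph n) → IsSimple G → ι 2 * ι (numEdges G) ≡ ∑ (allFin n) (λ i → ∑ (allFin n) (λ j → χ (G i j)))
  handshake {n} G simple = trans (cong (ι 2 *_) (sym (∑-1 (edgeList G)))) (trans (∑-edges-∑∑ G simple (λ _ _ → 1ℚ) (λ _ _ → refl))
    (∑-cong (allFin n) (λ i → ∑-cong (allFin n) (λ j → *-identityˡ (χ (G i j))))))

  χ-∨ : ∀ {a b} → ¬ (a ≡ true × b ≡ true) → χ (a ∨ b) ≡ χ a + χ b
  χ-∨ {true}  {true}  h = ⊥-elim (h (refl , refl))
  χ-∨ {true}  {false} h = refl
  χ-∨ {false} {b}     h = sym (+-identityˡ (χ b))

  ∑-toℕ : ∀ n j → j ℕ.< n → ∑ (allFin n) (λ p → χ (toℕ p ≡ᵇ j)) ≡ 1ℚ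
  ∑-toℕ (suc n) zero    _ = trans (∑-allFin-suc n (λ p → χ (toℕ p ≡ᵇ 0))) (trans (cong (1ℚ +_) (∑-0 (allFin n))) (+-identityʳ 1ℚ))
  ∑-toℕ (suc n) (suc j) (ℕ.s≤s j<n) = trans (∑-allFin-suc n (λ p → χ (toℕ p ≡ᵇ suc j))) (trans (+-identityˡ _) (∑-toℕ n j j<n))

  ∑-successors : ∀ r → ∑ (allFin (suc r)) (λ p → ∑ (allFin (suc r)) (λ p′ → χ (suc (toℕ p) ≡ᵇ toℕ p′))) ≡ ι r
  ∑-successors r = trans (∑-swap (allFin (suc r)) (allFin (suc r)) (λ p p′ → χ (suc (toℕ p) ≡ᵇ toℕ p′))) (trans (∑-allFin-suc r (λ p′ → ∑ (allFin (suc r)) (λ p → χ (suc (toℕ p) ≡ᵇ toℕ p′))))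
    (trans (cong₂ _+_ (∑-0 (allFin (suc r))) (trans (∑-cong (allFin r) (λ j → ∑-toℕ (suc r) (toℕ j) (ℕP.m<n⇒m<1+n (FinP.toℕ<n j)))) (∑-allFin-1 r)))
      (+-identityˡ (ι r))))

  -- Doubly counting ordered pairs of adjacent vertices: every internal vertex of a path has
  -- one neighbour on each side.
  module _ {m} (H : Graph m) (s″ : ℕ) where

    private
      s : ℕ
      s = suc (suc s″)

    open Subdivide H s

    private
      N : ℕ
      N = m ℕ.+ e ℕ.* s

      ∑-vertices : ∀ (F : Fin N → ℚ) → ∑ (allFin N) F ≡
        ∑ (allFin m) (λ i → F (encode (inj₁ i))) + ∑ (allFin e) (λ k → ∑ (allFin s) (λ p → F (encode (inj₂ (k , p)))))
      ∑-vertices F = trans (∑-allFin-+ m (e ℕ.* s) F) (cong (∑ (allFin m) (λ i → F (encode (inj₁ i))) +_) (∑-allFin-* e s _))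

      adj : SubdivVertex m e s → SubdivVertex m e s → ℚ
      adj α β = χ (subdivAdj H s α β)

      ends : Fin s → ℚ
      ends p = χ (toℕ p ≡ᵇ 0) + χ (suc (toℕ p) ≡ᵇ s)

      ∑-ends : ∑ (allFin s) ends ≡ 1ℚ + 1ℚ
      ∑-ends = trans (∑-+ (allFin s) (λ p → χ (toℕ p ≡ᵇ 0)) (λ p → χ (suc (toℕ p) ≡ᵇ s))) (cong₂ _+_ (∑-toℕ s 0 (ℕ.s≤s ℕ.z≤n)) (∑-toℕ s (suc s″) ℕP.≤-refl))

      -- As `s` is at least 2, no internal vertex is both first and last on its path, so the
      -- disjunction in `subdivAdj` becomes a sum.
      ∑-original : ∀ k p → ∑ (allFin m) (λ i → adj (inj₁ i) (inj₂ (k , p))) ≡ ends p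
      ∑-original k p = trans (∑-cong (allFin m) (λ i → trans (χ-∨ (exclusive i)) (cong₂ _+_ (split (toℕ p ≡ᵇ 0) i (source k)) (split (suc (toℕ p) ≡ᵇ s) i (target k)))))
        (trans (∑-+ (allFin m) (λ i → χ (toℕ p ≡ᵇ 0) * χ (eqFin (source k) i)) (λ i → χ (suc (toℕ p) ≡ᵇ s) * χ (eqFin (target k) i))) (cong₂ _+_ (single (toℕ p ≡ᵇ 0) (source k)) (single (suc (toℕ p) ≡ᵇ s) (target k))))
        where
        exclusive : ∀ i → ¬ (((toℕ p ≡ᵇ 0) ∧ eqFin i (source k)) ≡ true × ((suc (toℕ p) ≡ᵇ s) ∧ eqFin i (target k)) ≡ true)
        exclusive i (start , end) with toℕ p
        exclusive i (start , ()) | zero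
        exclusive i (() , end)   | suc _
        split : ∀ b (i j : Fin m) → χ (b ∧ eqFin i j) ≡ χ b * χ (eqFin j i)
        split b i j = trans (χ-∧ b (eqFin i j)) (cong (λ z → χ b * χ z) (eqFin-sym i j))
        single : ∀ b (j : Fin m) → ∑ (allFin m) (λ i → χ b * χ (eqFin j i)) ≡ χ b
        single b j = trans (∑-*ˡ (allFin m) (χ b) (λ i → χ (eqFin j i))) (trans (cong (χ b *_) (∑-eqFin-1 j)) (*-identityʳ (χ b)))

      ∑-∑-original : ∑ (allFin e) (λ k → ∑ (allFin s) (λ p → ∑ (allFin m) (λ i → adj (inj₁ i) (inj₂ (k , p))))) ≡ ι e * (1ℚ + 1ℚ)
      ∑-∑-original = trans (∑-cong (allFin e) (λ k → trans (∑-cong (allFin s) (∑-original k)) ∑-ends)) (∑-const e (1ℚ + 1ℚ))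

      consecutive : Fin s → Fin s → Bool
      consecutive p p′ = (suc (toℕ p) ≡ᵇ toℕ p′) ∨ (suc (toℕ p′) ≡ᵇ toℕ p)

      ∑-consecutive : ∑ (allFin s) (λ p → ∑ (allFin s) (λ p′ → χ (consecutive p p′))) ≡ ι (suc s″) + ι (suc s″)
      ∑-consecutive = trans (∑-cong (allFin s) (λ p → trans (∑-cong (allFin s) (λ p′ → χ-∨ (exclusive p p′))) (∑-+ (allFin s) (λ p′ → forward p p′) (λ p′ → forward p′ p))))
        (trans (∑-+ (allFin s) (λ p → ∑ (allFin s) (λ p′ → forward p p′)) (λ p → ∑ (allFin s) (λ p′ → forward p′ p)))
          (cong₂ _+_ (∑-successors (suc s″)) (trans (∑-swap (allFin s) (allFin s) (λ p p′ → forward p′ p)) (∑-successors (suc s″)))))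
        where
        forward : Fin s → Fin s → ℚ
        forward p p′ = χ (suc (toℕ p) ≡ᵇ toℕ p′)
        exclusive : ∀ p p′ → ¬ ((suc (toℕ p) ≡ᵇ toℕ p′) ≡ true × (suc (toℕ p′) ≡ᵇ toℕ p) ≡ true)
        exclusive p p′ (next , prev) = ℕP.<-asym (ℕP.≤-reflexive (≡ᵇ-true⁻ {suc (toℕ p)} next)) (ℕP.≤-reflexive (≡ᵇ-true⁻ {suc (toℕ p′)} prev))

      ∑-internal : ∑ (allFin e) (λ k → ∑ (allFin s) (λ p → ∑ (allFin e) (λ k′ → ∑ (allFin s) (λ p′ → adj (inj₂ (k , p)) (inj₂ (k′ , p′)))))) ≡
        ι e * (ι (suc s″) + ι (suc s″))
      ∑-internal = trans (∑-cong (allFin e) (λ k → trans (∑-cong (allFin s) (λ p →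
          trans (∑-cong (allFin e) (λ k′ → trans (∑-cong (allFin s) (λ p′ → χ-∧ (eqFin k k′) (consecutive p p′))) (∑-*ˡ (allFin s) (χ (eqFin k k′)) (λ p′ → χ (consecutive p p′)))))
            (∑-eqFin k (λ _ → ∑ (allFin s) (λ p′ → χ (consecutive p p′)))))) ∑-consecutive))
        (∑-const e (ι (suc s″) + ι (suc s″)))

    numEdges-subdivision : numEdges (subdivision s H) ≡ suc s ℕ.* e
    numEdges-subdivision = ι-injective (cancel (begin
      ι 2 * ι (numEdges (subdivision s H))
        ≡⟨ handshake (subdivision s H) subdivision-simple ⟩
      ∑ (allFin N) (λ v → ∑ (allFin N) (λ w → adj (decode e s v) (decode e s w)))
        ≡⟨ trans (∑-vertices _) (cong₂ _+_ (∑-cong (allFin m) (λ i → row (inj₁ i))) (∑-cong (allFin e) (λ k → ∑-cong (allFin s) (λ p → row (inj₂ (k , p)))))) ⟩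
      ∑ (allFin m) (λ i → ∑ (allFin m) (λ j → 0ℚ) + ∑ (allFin e) (λ k → ∑ (allFin s) (λ p → adj (inj₁ i) (inj₂ (k , p)))))
        + ∑ (allFin e) (λ k → ∑ (allFin s) (λ p → ∑ (allFin m) (λ j → adj (inj₂ (k , p)) (inj₁ j)) + ∑ (allFin e) (λ k′ → ∑ (allFin s) (λ p′ → adj (inj₂ (k , p)) (inj₂ (k′ , p′))))))
        ≡⟨ cong₂ _+_
             (trans (∑-cong (allFin m) (λ i → trans (cong (_+ outer i) (∑-0 (allFin m))) (+-identityˡ (outer i))))
               (trans (∑-swap (allFin m) (allFin e) (λ i k → ∑ (allFin s) (λ p → adj (inj₁ i) (inj₂ (k , p))))) (trans (∑-cong (allFin e) (λ k → ∑-swap (allFin m) (allFin s) (λ i p → adj (inj₁ i) (inj₂ (k , p))))) ∑-∑-original)))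
             (trans (∑-cong (allFin e) (λ k → ∑-+ (allFin s) (back k) (inner k))) (trans (∑-+ (allFin e) (λ k → ∑ (allFin s) (back k)) (λ k → ∑ (allFin s) (inner k))) (cong₂ _+_ ∑-∑-original ∑-internal))) ⟩
      -- Each path contributes two ordered pairs from original to internal vertices, two in the
      -- opposite direction, and `2 * (s - 1)` ordered pairs of consecutive internal vertices.
      ι e * (1ℚ + 1ℚ) + (ι e * (1ℚ + 1ℚ) + ι e * (ι (suc s″) + ι (suc s″)))
        ≡⟨ eq (ι e) (ι (suc s″)) ⟩
      (1ℚ + 1ℚ) * ((1ℚ + (1ℚ + ι (suc s″))) * ι e)
        ≡⟨ cong₂ (λ a b → a * (b * ι e)) (sym (trans (ι-suc 1) (cong (1ℚ +_) ι-1))) (sym (trans (ι-suc s) (cong (1ℚ +_) (ι-suc (suc s″))))) ⟩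
      ι 2 * (ι (suc s) * ι e)
        ≡⟨ cong (ι 2 *_) (sym (ι-* (suc s) e)) ⟩
      ι 2 * ι (suc s ℕ.* e) ∎))
      where
      open ≡-Reasoning
      outer : Fin m → ℚ
      outer i = ∑ (allFin e) (λ k → ∑ (allFin s) (λ p → adj (inj₁ i) (inj₂ (k , p))))
      back inner : Fin e → Fin s → ℚ
      back k p = ∑ (allFin m) (λ j → adj (inj₂ (k , p)) (inj₁ j))
      inner k p = ∑ (allFin e) (λ k′ → ∑ (allFin s) (λ p′ → adj (inj₂ (k , p)) (inj₂ (k′ , p′))))
      row : ∀ α → ∑ (allFin N) (λ w → adj (decode e s (encode α)) (decode e s w)) ≡
        ∑ (allFin m) (λ j → adj α (inj₁ j)) + ∑ (allFin e) (λ k → ∑ (allFin s) (λ p → adj α (inj₂ (k , p))))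
      row α = trans (∑-vertices _) (cong₂ _+_
        (∑-cong (allFin m) (λ j → cong₂ adj (decode-encode α) (decode-encode (inj₁ j))))
        (∑-cong (allFin e) (λ k → ∑-cong (allFin s) (λ p → cong₂ adj (decode-encode α) (decode-encode (inj₂ (k , p)))))))
      eq : ∀ e r → e * (1ℚ + 1ℚ) + (e * (1ℚ + 1ℚ) + e * (r + r)) ≡ (1ℚ + 1ℚ) * ((1ℚ + (1ℚ + r)) * e)
      eq = solve-∀ ℚ-ring
      cancel : ∀ {x y} → ι 2 * x ≡ ι 2 * y → x ≡ y
      cancel h = ≤-antisym (*-cancelˡ-≤ (0<ι 2) (≤-reflexive h)) (*-cancelˡ-≤ (0<ι 2) (≤-reflexive (sym h)))

  -- Each vertex i occurs as an endpoint of exactly r entries of the edge list.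
  ∏-regular : ∀ {m} (H : Graph m) → IsSimple H → ∀ r → (∀ v → degree H v ≡ r) → (f : Fin m → ℚ) →
    ∏ (edgeList H) (λ ε → f (proj₁ ε) * f (proj₂ ε)) ≡ ∏ (allFin m) (λ i → f i ^ℚ r)
  ∏-regular {m} H simple r regular f = trans (∏-edges H simple (λ i j → f i)) (∏-cong (allFin m) (λ i →
    trans (power (H i) (f i) (allFin m)) (cong (f i ^ℚ_) (regular i))))
    where
    power : ∀ {A : Set} (p : A → Bool) x xs → ∏ xs (λ j → if p j then x else 1ℚ) ≡ x ^ℚ countTrue (List.map p xs)
    power p x []       = refl
    power p x (y ∷ xs) with p y
    ... | true  = cong (x *_) (power p x xs)
    ... | false = trans (*-identityˡ _) (power p x xs)

  numEdges-regular : ∀ {m} (H : Graph m) → IsSimple H → ∀ r → (∀ v → degree H v ≡ r) → 2 ℕ.* numEdges H ≡ m ℕ.* r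
  numEdges-regular {m} H simple r regular = ι-injective (trans (ι-* 2 (numEdges H)) (trans (handshake H simple)
    (trans (∑-cong (allFin m) (λ i → trans (sym (countTrue-∑ (H i) (allFin m))) (cong ι (regular i)))) (trans (∑-const m (ι r)) (sym (ι-* m r))))))

-- Uniform sampling of walks and the reweighted vertex measure.

module WalkSamples where
  open import Data.Bool using (true; false; if_then_else_)
  open import Data.Fin using (Fin; zero; suc; remQuot)
  import Data.Fin.Properties as FinP
  open import Data.List as List using (List; []; _∷_; allFin; concatMap; length; replicate)
  open import Data.List.Membership.Propositional.Properties using (∈-allFin; ∈-map⁺)
  import Data.List.Relation.Unary.All as All
  import Data.List.Relation.Unary.All.Properties as AllP
  open import Data.Nat as ℕ using (ℕ; zero; suc; NonZero)
  open import Data.Nat.Divisibility using (_∣_; divides)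
  open import Data.Nat.ListAction using (product)
  open import Data.Nat.ListAction.Properties using (∈⇒∣product; product≢0)
  open import Data.Product using (_,_; proj₁; proj₂; ∃-syntax)
  open import Data.Rational hiding (NonZero; ∣_∣)
  open import Data.Rational.Properties
  open import Data.Vec as Vec using (Vec; []; _∷_; lookup)
  import Data.Vec.Properties as VecP
  open import Function using (_∘_)
  open import Relation.Binary.PropositionalEquality
  open import Tactic.RingSolver using (solve-∀)
  open Rationals
  open Means
  open WeightedDensity
  open Walks
  open HomDensities
  open Subdivisions
  open EdgeCounts

  -- The list is repeated a whole number of times, so a uniform index hits each of its entries
  -- equally often; this is the purpose of the divisibility.
  uniformSamples : ∀ {A : Set} (ws : List A) L .{{_ : NonZero L}} → length ws ∣ L →
    ∃[ S ] (∀ (φ : A → ℚ) → ι (length ws) * E (unif L) (φ ∘ S) ≡ ∑ ws φ)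
  uniformSamples {A} ws L (divides c refl) = S , λ φ → begin
      ι d * (recip (c ℕ.* d) * ∑ (allFin (c ℕ.* d)) (φ ∘ S))
        ≡⟨ cong (λ z → ι d * (recip (c ℕ.* d) * z)) (sum φ) ⟩
      ι d * (recip (c ℕ.* d) * (ι c * ∑ ws φ))
        ≡⟨ eq (ι d) (recip (c ℕ.* d)) (ι c) (∑ ws φ) ⟩
      recip (c ℕ.* d) * (ι c * ι d) * ∑ ws φ
        ≡⟨ cong (_* ∑ ws φ) (trans (cong (recip (c ℕ.* d) *_) (sym (ι-* c d))) (recip-inverse (c ℕ.* d))) ⟩
      1ℚ * ∑ ws φ
        ≡⟨ *-identityˡ _ ⟩
      ∑ ws φ ∎
    where
    open ≡-Reasoning
    d : ℕ
    d = length ws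
    S : Fin (c ℕ.* d) → A
    S i = List.lookup ws (proj₂ (remQuot {c} d i))
    sum : ∀ φ → ∑ (allFin (c ℕ.* d)) (φ ∘ S) ≡ ι c * ∑ ws φ
    sum φ = trans (∑-allFin-* c d (φ ∘ S)) (trans (∑-cong (allFin c) (λ i → trans
      (∑-cong (allFin d) (λ j → cong (λ z → φ (List.lookup ws (proj₂ z))) (FinP.remQuot-combine {c} {d} i j))) (∑-lookup ws φ))) (∑-const c (∑ ws φ)))
    eq : ∀ d r c x → d * (r * (c * x)) ≡ r * (c * d) * x
    eq = solve-∀ ℚ-ring

  ∑-replicate : ∀ {A : Set} k (x : A) (f : A → ℚ) → ∑ (replicate k x) f ≡ ι k * f x
  ∑-replicate zero    x f = sym (trans (cong (_* f x) ι-0) (*-zeroˡ (f x)))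
  ∑-replicate (suc k) x f = trans (cong (f x +_) (∑-replicate k x f)) (trans (eq (ι k) (f x)) (cong (_* f x) (sym (ι-suc k))))
    where
    eq : ∀ k x → x + k * x ≡ (1ℚ + k) * x
    eq = solve-∀ ℚ-ring

  -- Change of measure, one coordinate at a time. The normalising constant stays on the left as a
  -- factor, which avoids division.
  E-pow-reweight : ∀ {A B : Set} (μ : Mean A) (ν : Mean B) (base : B → A) (w : A → ℚ) Z →
    (∀ F → E ν (F ∘ base) * Z ≡ E μ (λ x → w x * F x)) →
    ∀ m F → E (pow ν m) (F ∘ Vec.map base) * (Z ^ℚ m) ≡ E (pow μ m) (λ x → ∏ (allFin m) (λ i → w (lookup x i)) * F x)
  E-pow-reweight μ ν base w Z h zero F = trans (*-identityʳ (F [])) (sym (*-identityˡ (F [])))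
  E-pow-reweight μ ν base w Z h (suc m) F = begin
    E ν (λ b → E (pow ν m) (λ v → F (base b ∷ Vec.map base v))) * (Z * (Z ^ℚ m))
      ≡⟨ eq (E ν (λ b → E (pow ν m) (λ v → F (base b ∷ Vec.map base v)))) Z (Z ^ℚ m) ⟩
    E ν (λ b → E (pow ν m) (λ v → F (base b ∷ Vec.map base v))) * (Z ^ℚ m) * Z
      ≡⟨ cong (_* Z) (trans (sym (E-*ʳ ν _ (Z ^ℚ m))) (E-cong ν (λ b → E-pow-reweight μ ν base w Z h m (λ v → F (base b ∷ v))))) ⟩
    E ν (λ b → E (pow μ m) (λ x → ∏ (allFin m) (λ i → w (lookup x i)) * F (base b ∷ x))) * Z
      ≡⟨ h (λ a → E (pow μ m) (λ x → ∏ (allFin m) (λ i → w (lookup x i)) * F (a ∷ x))) ⟩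
    E μ (λ a → w a * E (pow μ m) (λ x → ∏ (allFin m) (λ i → w (lookup x i)) * F (a ∷ x)))
      ≡⟨ E-cong μ (λ a → trans (sym (E-*ˡ (pow μ m) (w a) _)) (E-cong (pow μ m) (λ x → trans (sym (*-assoc (w a) _ _))
           (cong (_* F (a ∷ x)) (sym (∏-allFin-suc m (λ i → w (lookup (a ∷ x) i)))))))) ⟩
    E μ (λ a → E (pow μ m) (λ x → ∏ (allFin (suc m)) (λ i → w (lookup (a ∷ x) i)) * F (a ∷ x))) ∎
    where
    open ≡-Reasoning
    eq : ∀ x z y → x * (z * y) ≡ x * y * z
    eq = solve-∀ ℚ-ring

  -- δ k x · E_l φ(sample x l) = T^ k φ x says that sample x is the endpoint of a uniformly
  -- random walk of length k from x; base is distributed proportionally to δ k ^ r.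
  module WalkMeasure {n} .{{_ : NonZero n}} (G : Graph n) (simple : IsSimple G) (k : ℕ) where

    open WalkOperator G simple

    walks : ℕ → Fin n → List (Fin n)
    walks zero    x = x ∷ []
    walks (suc j) x = concatMap (λ y → if G x y then walks j y else []) (allFin n)

    T^-walks : ∀ j φ x → T^ j φ x ≡ (recip n ^ℚ j) * ∑ (walks j x) φ
    T^-walks zero    φ x = sym (trans (*-identityˡ _) (+-identityʳ (φ x)))
    T^-walks (suc j) φ x = begin
      recip n * ∑ (allFin n) (λ y → A x y * T^ j φ y)
        ≡⟨ cong (recip n *_) (∑-cong (allFin n) (λ y → trans (cong (A x y *_) (T^-walks j φ y)) (eq (A x y) (recip n ^ℚ j) (∑ (walks j y) φ)))) ⟩
      recip n * ∑ (allFin n) (λ y → (recip n ^ℚ j) * (A x y * ∑ (walks j y) φ))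
        ≡⟨ trans (cong (recip n *_) (∑-*ˡ (allFin n) (recip n ^ℚ j) _)) (sym (*-assoc (recip n) (recip n ^ℚ j) _)) ⟩
      recip n * (recip n ^ℚ j) * ∑ (allFin n) (λ y → A x y * ∑ (walks j y) φ)
        ≡⟨ cong (recip n * (recip n ^ℚ j) *_) (trans (∑-cong (allFin n) (λ y → if-χ (G x y) (walks j y))) (sym (∑-concatMap _ (allFin n) φ))) ⟩
      recip n * (recip n ^ℚ j) * ∑ (walks (suc j) x) φ ∎
      where
      open ≡-Reasoning
      eq : ∀ a r s → a * (r * s) ≡ r * (a * s)
      eq = solve-∀ ℚ-ring
      if-χ : ∀ b ws → χ b * ∑ ws φ ≡ ∑ (if b then ws else []) φ
      if-χ true  ws = *-identityˡ _
      if-χ false ws = *-zeroˡ (∑ ws φ)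

    count : Fin n → ℕ
    count x = length (walks k x)

    δ-count : ∀ x → δ k x ≡ (recip n ^ℚ k) * ι (count x)
    δ-count x = trans (T^-walks k (λ _ → 1ℚ) x) (cong ((recip n ^ℚ k) *_) (∑-1 (walks k x)))

    -- A vertex from which no walk starts contributes 1 instead of 0, which keeps the product
    -- `samples` nonzero.
    positivePart : ℕ → ℕ
    positivePart zero    = 1
    positivePart (suc c) = suc c

    -- A common multiple of all nonzero walk counts, so that walks from every starting point can be
    -- drawn from one and the same index set.
    samples : ℕ
    samples = product (List.map (positivePart ∘ count) (allFin n))

    instance
      samples≢0 : NonZero samples
      samples≢0 = product≢0 (AllP.map⁺ (All.universal (λ x → nz (count x)) (allFin n)))
        where
        nz : ∀ c → NonZero (positivePart c)
        nz zero    = _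
        nz (suc c) = _

    Λ : Mean (Fin samples)
    Λ = unif samples

    sampling : ∀ x → ∃[ S ] (∀ φ → δ k x * E Λ (φ ∘ S) ≡ T^ k φ x)
    sampling x = go (walks k x) refl
      where
      go : ∀ ws → walks k x ≡ ws → ∃[ S ] (∀ φ → δ k x * E Λ (φ ∘ S) ≡ T^ k φ x)
      -- Without walks from `x` the sample is an arbitrary default: `δ k x` and `T^ k φ x` both
      -- vanish.
      go [] eq = (λ _ → x) , λ φ → trans
        (cong (_* E Λ (λ _ → φ x)) (trans (δ-count x) (trans (cong (λ ws → (recip n ^ℚ k) * ι (length ws)) eq) (trans (cong ((recip n ^ℚ k) *_) ι-0) (*-zeroʳ (recip n ^ℚ k))))))
        (trans (*-zeroˡ (E Λ (λ _ → φ x))) (sym (trans (T^-walks k φ x) (trans (cong (λ ws → (recip n ^ℚ k) * ∑ ws φ) eq) (*-zeroʳ (recip n ^ℚ k))))))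
      go ws@(w ∷ ws′) eq = proj₁ S , λ φ → begin
          δ k x * E Λ (φ ∘ proj₁ S)
            ≡⟨ cong (_* E Λ (φ ∘ proj₁ S)) (trans (δ-count x) (cong (λ ws → (recip n ^ℚ k) * ι (length ws)) eq)) ⟩
          (recip n ^ℚ k) * ι (length ws) * E Λ (φ ∘ proj₁ S)
            ≡⟨ *-assoc (recip n ^ℚ k) (ι (length ws)) _ ⟩
          (recip n ^ℚ k) * (ι (length ws) * E Λ (φ ∘ proj₁ S))
            ≡⟨ cong ((recip n ^ℚ k) *_) (proj₂ S φ) ⟩
          (recip n ^ℚ k) * ∑ ws φ
            ≡⟨ sym (trans (T^-walks k φ x) (cong (λ ws → (recip n ^ℚ k) * ∑ ws φ) eq)) ⟩
          T^ k φ x ∎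
        where
        open ≡-Reasoning
        dvd : length ws ∣ samples
        dvd = subst (_∣ samples) (cong (positivePart ∘ length) eq) (∈⇒∣product (∈-map⁺ (positivePart ∘ count) (∈-allFin x)))
        S = uniformSamples ws samples dvd

    sample : Fin n → Fin samples → Fin n
    sample x = proj₁ (sampling x)

    E-sample : ∀ x φ → δ k x * E Λ (φ ∘ sample x) ≡ T^ k φ x
    E-sample x = proj₂ (sampling x)

    -- The two means are nested in the order used by `q` of the sampled graph, so that at base
    -- points the two agree by definition.
    pairDensity : Fin n → Fin n → ℚ
    pairDensity x y = E Λ (λ l′ → E Λ (λ l → A (sample x l) (sample y l′)))

    -- The walk is cut at its middle edge. By `A^-sym` its second half is read starting from `y`, so
    -- that each half is sampled from its own end of the path.
    A^-pairDensity : ∀ x y → A^ (k ℕ.+ k) y x ≡ (δ k x * δ k y) * pairDensity x y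
    A^-pairDensity x y = begin
      T^ (k ℕ.+ k) (λ v → A v y) x
        ≡⟨ T^-+ k k _ x ⟩
      T^ k (λ w → A^ k y w) x
        ≡⟨ Linear.E-cong (T^-linear k x) (λ w → A^-sym k w y) ⟩
      T^ k (λ w → A^ k w y) x
        ≡⟨ sym (E-sample x (λ w → A^ k w y)) ⟩
      δ k x * E Λ (λ l → T^ k (λ v → A v (sample x l)) y)
        ≡⟨ cong (δ k x *_) (E-cong Λ (λ l → sym (E-sample y (λ v → A v (sample x l))))) ⟩
      δ k x * E Λ (λ l → δ k y * E Λ (λ l′ → A (sample y l′) (sample x l)))
        ≡⟨ cong (δ k x *_) (E-*ˡ Λ (δ k y) _) ⟩
      δ k x * (δ k y * E Λ (λ l → E Λ (λ l′ → A (sample y l′) (sample x l))))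
        ≡⟨ sym (*-assoc (δ k x) (δ k y) _) ⟩
      δ k x * δ k y * E Λ (λ l → E Λ (λ l′ → A (sample y l′) (sample x l)))
        ≡⟨ cong (δ k x * δ k y *_) (trans (E-swap Λ (linear Λ) _) (E-cong Λ (λ l′ → E-cong Λ (λ l → A-sym (sample y l′) (sample x l))))) ⟩
      δ k x * δ k y * pairDensity x y ∎
      where open ≡-Reasoning

    module Weighted (r′ : ℕ) (Z>0 : 0ℚ < E U (λ x → δ k x ^ℚ suc r′)) where

      r : ℕ
      r = suc r′

      Z : ℚ
      Z = E U (λ x → δ k x ^ℚ r)

      -- Integer multiplicities suffice because `δ k x` is the walk count times a factor that is the
      -- same for all vertices.
      points : List (Fin n)
      points = concatMap (λ x → replicate (count x ℕ.^ r) x) (allFin n)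

      p : ℕ
      p = length points

      base : Fin p → Fin n
      base = List.lookup points

      private
        scale : ℚ
        scale = (recip n ^ℚ k) ^ℚ r

        ∑-points : ∀ F → ∑ points F ≡ ∑ (allFin n) (λ x → ι (count x ℕ.^ r) * F x)
        ∑-points F = trans (∑-concatMap _ (allFin n) F) (∑-cong (allFin n) (λ x → ∑-replicate (count x ℕ.^ r) x F))

        δ^r : ∀ x → δ k x ^ℚ r ≡ scale * ι (count x ℕ.^ r)
        δ^r x = trans (cong (_^ℚ r) (δ-count x)) (trans (*-^ (recip n ^ℚ k) (ι (count x)) r) (cong (scale *_) (sym (ι-^ (count x) r))))

        E-δ^r : ∀ F → E U (λ x → (δ k x ^ℚ r) * F x) ≡ recip n * (scale * ∑ points F)
        E-δ^r F = cong (recip n *_) (trans (∑-cong (allFin n) (λ x → trans (cong (_* F x) (δ^r x)) (*-assoc scale _ (F x))))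
          (trans (∑-*ˡ (allFin n) scale _) (cong (scale *_) (sym (∑-points F)))))

        Z-p : Z ≡ recip n * (scale * ι p)
        Z-p = trans (E-cong U (λ x → sym (*-identityʳ (δ k x ^ℚ r)))) (trans (E-δ^r (λ _ → 1ℚ)) (cong (λ z → recip n * (scale * z)) (∑-1 points)))

      instance
        p≢0 : NonZero p
        p≢0 = ℕ.≢-nonZero (λ p≡0 → <-irrefl (sym (trans Z-p (trans (cong (λ z → recip n * (scale * z)) (trans (cong ι p≡0) ι-0))
          (trans (cong (recip n *_) (*-zeroʳ scale)) (*-zeroʳ (recip n)))))) Z>0)

      P : Mean (Fin p)
      P = unif p

      E-base : ∀ F → E P (F ∘ base) * Z ≡ E U (λ x → (δ k x ^ℚ r) * F x)
      E-base F = begin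
        recip p * ∑ (allFin p) (F ∘ base) * Z                    ≡⟨ cong₂ (λ a b → recip p * a * b) (∑-lookup points F) Z-p ⟩
        recip p * ∑ points F * (recip n * (scale * ι p))         ≡⟨ eq (recip p) (∑ points F) (recip n) scale (ι p) ⟩
        (recip p * ι p) * (recip n * (scale * ∑ points F))       ≡⟨ trans (cong (_* (recip n * (scale * ∑ points F))) (recip-inverse p)) (*-identityˡ _) ⟩
        recip n * (scale * ∑ points F)                           ≡⟨ sym (E-δ^r F) ⟩
        E U (λ x → (δ k x ^ℚ r) * F x)                           ∎
        where
        open ≡-Reasoning
        eq : ∀ a x n c p → a * x * (n * (c * p)) ≡ (a * p) * (n * (c * x))
        eq = solve-∀ ℚ-ring

      S : Fin p → Fin samples → Fin n
      S σ = sample (base σ)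

      q : Fin p → Fin p → ℚ
      q σ τ = pairDensity (base σ) (base τ)

      density-subdivision-sampled : ∀ {m} (H : Graph m) → IsSimple H → (∀ v → degree H v ≡ r) → ∀ s′ → suc s′ ≡ k ℕ.+ k →
        density (subdivision (suc s′) H) G ≡ E (pow P m) (λ σs → ∏ (edgeList H) (λ ε → q (lookup σs (proj₁ ε)) (lookup σs (proj₂ ε)))) * (Z ^ℚ m)
      density-subdivision-sampled {m} H H-simple regular s′ eq = begin
        density (subdivision (suc s′) H) G
          ≡⟨ SubdivisionHoms.density-subdivision H s′ G simple ⟩
        E (pow U m) (λ x → ∏ es (λ ε → A^ (suc s′) (lookup x (proj₂ ε)) (lookup x (proj₁ ε))))
          ≡⟨ E-cong (pow U m) (λ x → trans (∏-cong es (λ ε → trans (cong (λ j → A^ j (lookup x (proj₂ ε)) (lookup x (proj₁ ε))) eq)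
               (A^-pairDensity (lookup x (proj₁ ε)) (lookup x (proj₂ ε))))) (∏-* es (λ ε → δ k (lookup x (proj₁ ε)) * δ k (lookup x (proj₂ ε))) _)) ⟩
        E (pow U m) (λ x → ∏ es (λ ε → δ k (lookup x (proj₁ ε)) * δ k (lookup x (proj₂ ε))) * F x)
          -- Regularity enters here: the factors at the ends of the edges regroup into the same
          -- power at every vertex, so the weight is that of a product measure.
          ≡⟨ E-cong (pow U m) (λ x → cong (_* F x) (∏-regular H H-simple r regular (λ i → δ k (lookup x i)))) ⟩
        E (pow U m) (λ x → ∏ (allFin m) (λ i → δ k (lookup x i) ^ℚ r) * F x)
          ≡⟨ sym (E-pow-reweight U P base (λ x → δ k x ^ℚ r) Z E-base m F) ⟩
        E (pow P m) (F ∘ Vec.map base) * (Z ^ℚ m)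
          ≡⟨ cong (_* (Z ^ℚ m)) (E-cong (pow P m) (λ σs → ∏-cong es (λ ε →
               cong₂ pairDensity (VecP.lookup-map (proj₁ ε) base σs) (VecP.lookup-map (proj₂ ε) base σs)))) ⟩
        E (pow P m) (λ σs → ∏ es (λ ε → q (lookup σs (proj₁ ε)) (lookup σs (proj₂ ε)))) * (Z ^ℚ m) ∎
        where
        open ≡-Reasoning
        es = edgeList H
        F : Vec (Fin n) m → ℚ
        F x = ∏ es (λ ε → pairDensity (lookup x (proj₁ ε)) (lookup x (proj₂ ε)))

      -- The endpoint distribution of a random walk from a random base point has density at
      -- most 1/κ, so the weighted local density of G applies to it.
      module _ {κ} (0≤κ : 0ℚ ≤ κ) (κ≤Z : κ ≤ Z) (g : Fin p → ℚ) (0≤g : ∀ σ → 0ℚ ≤ g σ) (g≤1 : ∀ σ → g σ ≤ 1ℚ) where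

        private
          -- The density, with respect to the uniform measure, of the point mass at `w`.
          point : Fin n → Fin n → ℚ
          point w v = ι n * χ (eqFin v w)

          0≤point : ∀ w v → 0ℚ ≤ point w v
          0≤point w v = 0≤* (0≤ι n) (0≤χ (eqFin v w))

          push : (Fin n → ℚ) → ℚ
          push φ = E P (λ σ → g σ * E Λ (λ l → φ (S σ l)))

          -- The density of the weight `g` pushed forward to the endpoints of the walks, scaled down
          -- by `κ` so that it becomes an admissible weight on the vertices of `G`.
          f : Fin n → ℚ
          f w = κ * push (point w)

          0≤f : ∀ w → 0ℚ ≤ f w
          0≤f w = 0≤* 0≤κ (0≤E P (λ σ → 0≤* (0≤g σ) (0≤E Λ (λ l → 0≤point w (S σ l)))))

          E-point : ∀ w → E U (point w) ≡ 1ℚ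
          E-point w = trans (E-*ˡ U (ι n) _) (trans (cong (λ z → ι n * (recip n * z)) (trans (∑-cong (allFin n) (λ v → cong χ (eqFin-sym v w))) (∑-eqFin-1 w)))
            (trans (cong (ι n *_) (*-identityʳ (recip n))) (ι-recip n)))

          f≤1 : ∀ w → f w ≤ 1ℚ
          f≤1 w = begin
            κ * push (point w)                             ≤⟨ *-monoˡ 0≤κ (E-mono P (λ σ → *-≤ʳ (0≤h (base σ)) (g≤1 σ))) ⟩
            κ * E P (h ∘ base)                             ≤⟨ *-monoʳ (0≤E P (λ σ → 0≤h (base σ))) κ≤Z ⟩
            Z * E P (h ∘ base)                             ≡⟨ trans (*-comm Z _) (E-base h) ⟩
            -- One of the `r` factors `δ k x` turns the sample mean into `T^ k`, and the others are
            -- bounded by 1; at least one factor must be present, hence `r = suc r′`.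
            E U (λ x → (δ k x ^ℚ r) * h x)                 ≡⟨ E-cong U (λ x → trans (eq (δ k x) (δ k x ^ℚ r′) (h x)) (cong ((δ k x ^ℚ r′) *_) (E-sample x (point w)))) ⟩
            E U (λ x → (δ k x ^ℚ r′) * T^ k (point w) x)   ≤⟨ E-mono U (λ x → *-≤ʳ (0≤T^ k (0≤point w) x) (^-≤1 r′ (0≤δ k x) (δ≤1 k x))) ⟩
            E U (T^ k (point w))                           ≤⟨ E-T^-≤ k (0≤point w) ⟩
            E U (point w)                                  ≡⟨ E-point w ⟩
            1ℚ                                             ∎
            where
            open ≤-Reasoning
            h : Fin n → ℚ
            h x = E Λ (λ l → point w (sample x l))
            0≤h : ∀ x → 0ℚ ≤ h x
            0≤h x = 0≤E Λ (λ l → 0≤point w (sample x l))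
            eq : ∀ d e h → (d * e) * h ≡ e * (d * h)
            eq = solve-∀ ℚ-ring

          E-f : ∀ φ → E U (λ w → f w * φ w) ≡ κ * push φ
          E-f φ = begin
            E U (λ w → κ * push (point w) * φ w)
              ≡⟨ trans (E-cong U (λ w → *-assoc κ (push (point w)) (φ w))) (E-*ˡ U κ _) ⟩
            κ * E U (λ w → push (point w) * φ w)
              ≡⟨ cong (κ *_) (trans (E-cong U (λ w → sym (E-*ʳ P _ (φ w)))) (E-swap U (linear P) _)) ⟩
            κ * E P (λ σ → E U (λ w → g σ * E Λ (λ l → point w (S σ l)) * φ w))
              ≡⟨ cong (κ *_) (E-cong P (λ σ → trans (E-cong U (λ w → *-assoc (g σ) _ (φ w))) (E-*ˡ U (g σ) _))) ⟩
            κ * E P (λ σ → g σ * E U (λ w → E Λ (λ l → point w (S σ l)) * φ w))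
              ≡⟨ cong (κ *_) (E-cong P (λ σ → cong (g σ *_) (trans (E-cong U (λ w → sym (E-*ʳ Λ _ (φ w)))) (E-swap U (linear Λ) _)))) ⟩
            κ * E P (λ σ → g σ * E Λ (λ l → E U (λ w → point w (S σ l) * φ w)))
              ≡⟨ cong (κ *_) (E-cong P (λ σ → cong (g σ *_) (E-cong Λ (λ l → evaluate (S σ l))))) ⟩
            κ * push φ ∎
            where
            open ≡-Reasoning
            evaluate : ∀ v → E U (λ w → point w v * φ w) ≡ φ v
            evaluate v = trans (E-cong U (λ w → *-assoc (ι n) (χ (eqFin v w)) (φ w))) (trans (E-*ˡ U (ι n) _)
              (trans (cong (λ z → ι n * (recip n * z)) (∑-eqFin v φ)) (trans (sym (*-assoc (ι n) (recip n) (φ v)))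
                (trans (cong (_* φ v) (ι-recip n)) (*-identityˡ (φ v))))))

          E-f-1 : E U f ≡ κ * E P g
          E-f-1 = trans (E-cong U (λ w → sym (*-identityʳ (f w)))) (trans (E-f (λ _ → 1ℚ))
            (cong (κ *_) (E-cong P (λ σ → trans (cong (g σ *_) (E-1 Λ)) (*-identityʳ (g σ))))))

          E-f-f : E U (λ u → E U (λ v → f u * f v * A u v)) ≡ κ * κ * E P (λ σ → E P (λ τ → g σ * g τ * q σ τ))
          E-f-f = begin
            E U (λ u → E U (λ v → f u * f v * A u v))
              ≡⟨ E-cong U (λ u → trans (E-cong U (λ v → *-assoc (f u) (f v) (A u v))) (trans (E-*ˡ U (f u) _) (cong (f u *_) (E-f (A u))))) ⟩
            E U (λ u → f u * (κ * push (A u)))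
              ≡⟨ E-f (λ u → κ * push (A u)) ⟩
            κ * E P (λ σ → g σ * E Λ (λ l → κ * push (A (S σ l))))
              ≡⟨ cong (κ *_) (trans (E-cong P (λ σ → trans (cong (g σ *_) (E-*ˡ Λ κ _)) (eq (g σ) κ _))) (E-*ˡ P κ _)) ⟩
            κ * (κ * E P (λ σ → g σ * E Λ (λ l → push (A (S σ l)))))
              ≡⟨ sym (*-assoc κ κ _) ⟩
            κ * κ * E P (λ σ → g σ * E Λ (λ l → push (A (S σ l))))
              ≡⟨ cong (κ * κ *_) (E-cong P (λ σ → trans (cong (g σ *_) (expand σ)) (trans (sym (E-*ˡ P (g σ) _)) (E-cong P (λ τ → sym (*-assoc (g σ) (g τ) (q σ τ))))))) ⟩
            κ * κ * E P (λ σ → E P (λ τ → g σ * g τ * q σ τ)) ∎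
            where
            open ≡-Reasoning
            eq : ∀ g κ x → g * (κ * x) ≡ κ * (g * x)
            eq = solve-∀ ℚ-ring
            expand : ∀ σ → E Λ (λ l → push (A (S σ l))) ≡ E P (λ τ → g τ * q σ τ)
            expand σ = trans (E-swap Λ (linear P) _) (E-cong P (λ τ → trans (E-*ˡ Λ (g τ) _) (cong (g τ *_) (E-swap Λ (linear Λ) _))))

        sampled-weighted-density : ∀ {ρ d} → LocallyDense ρ d G →
          d * ((κ * E P g) * (κ * E P g) - ρ * ρ) ≤ κ * κ * E P (λ σ → E P (λ τ → g σ * g τ * q σ τ))
        sampled-weighted-density {ρ} {d} dense = subst₂ _≤_ (cong (λ z → d * (z * z - ρ * ρ)) E-f-1) E-f-f
          (dense f 0≤f f≤1)

-- Choice of parameters and the KNRS property of the subdivision.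

module KNRSSubdivisions where
  open import Data.Empty using (⊥-elim)
  open import Data.Fin using (zero; suc)
  open import Data.Fin.Subset using (∣_∣; ⊤)
  open import Data.Fin.Subset.Properties using (∣⊤∣≡n)
  open import Data.List using ([]; allFin; length)
  open import Data.Nat as ℕ using (ℕ; zero; suc; NonZero)
  import Data.Nat.Properties as ℕP
  open import Data.Product using (_×_; _,_; proj₁; proj₂; ∃-syntax)
  open import Data.Rational hiding (NonZero; ∣_∣)
  open import Data.Rational.Properties
  open import Data.Sum using (inj₁; inj₂)
  open import Data.Vec using (lookup)
  open import Relation.Binary.PropositionalEquality
  open import Relation.Nullary using (yes; no)
  open import Tactic.RingSolver using (solve-∀)
  open Rationals
  open Means
  open WeightedDensity
  open Walks
  open HomDensities
  open SampledGraph using (order; sampled; sampled-simple; sampled-dense; sampled-count)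
  open EdgeCounts
  open WalkSamples

  KNRS′ : ∀ {m} → Graph m → Set
  KNRS′ H = (d ε : ℚ) → 0ℚ < d → 0ℚ < ε →
    ∃[ ρ ] (0ℚ < ρ × ∃[ N ] (∀ (n : ℕ) → N ℕ.≤ n → (G : Graph n) → IsSimple G →
      Dense ρ d G → (1ℚ - ε) * (d ^ℚ numEdges H) ≤ density H G))

  opaque
    unfolding Dense density

    knrs⁻ : ∀ {m} {H : Graph m} → KNRS H → KNRS′ H
    knrs⁻ h = h

    knrs⁺ : ∀ {m} {H : Graph m} → KNRS′ H → KNRS H
    knrs⁺ h = h

  -- The density condition is tested on the whole vertex set. This makes the case `d > 1` of the
  -- KNRS property vacuous.
  dense⇒≤1 : ∀ {ρ d n} .{{_ : NonZero n}} {G : Graph n} → IsSimple G → Dense ρ d G → ρ ≤ 1ℚ → d ≤ 1ℚ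
  dense⇒≤1 {ρ} {d} {n} {G} simple dense ρ≤1 = *-cancelˡ-≤ (0<* (0<ι n) (0<ι n)) (begin
    ι n * ι n * d
      ≡⟨ *-comm (ι n * ι n) d ⟩
    d * (ι n * ι n)
      ≡⟨ cong (λ j → d * (ι j * ι j)) (sym (∣⊤∣≡n n)) ⟩
    d * (ι ∣ ⊤ {n} ∣ * ι ∣ ⊤ {n} ∣)
      ≤⟨ dense-∑∑ ρ d simple dense ⊤ (subst (λ j → ρ * ι n ≤ ι j) (sym (∣⊤∣≡n n)) (*-≤ʳ (0≤ι n) ρ≤1)) ⟩
    ∑ (allFin n) (λ i → ∑ (allFin n) (λ j → χ (lookup ⊤ i) * χ (lookup ⊤ j) * χ (G i j)))
      ≤⟨ ∑-mono (allFin n) (λ i → ∑-mono (allFin n) (λ j → *-≤1 (0≤* (0≤χ (lookup ⊤ i)) (0≤χ (lookup ⊤ j)))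
           (*-≤1 (0≤χ (lookup ⊤ i)) (χ≤1 (lookup ⊤ i)) (0≤χ (lookup ⊤ j)) (χ≤1 (lookup ⊤ j))) (0≤χ (G i j)) (χ≤1 (G i j)))) ⟩
    ∑ (allFin n) (λ i → ∑ (allFin n) (λ j → 1ℚ))
      ≡⟨ trans (∑-cong (allFin n) (λ _ → ∑-allFin-1 n)) (∑-const n (ι n)) ⟩
    ι n * ι n
      ≡⟨ sym (*-identityʳ (ι n * ι n)) ⟩
    ι n * ι n * 1ℚ ∎)
    where open ≤-Reasoning

  density-edgeless : ∀ {m n} .{{_ : NonZero n}} (H : Graph m) (G : Graph n) → numEdges H ≡ 0 → density H G ≡ 1ℚ
  density-edgeless {m} {n} H G no-edges = trans (density-E H G) (trans (E-cong (pow (unif n) m) (λ v →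
    trans (χ-isHom H G (lookup v)) (empty (edgeList H) no-edges))) (E-1 (pow (unif n) m)))
    where
    empty : ∀ {A : Set} {f : A → ℚ} xs → length xs ≡ 0 → ∏ xs f ≡ 1ℚ
    empty [] _ = refl

  0<⊓ : ∀ {a b} → 0ℚ < a → 0ℚ < b → 0ℚ < a ⊓ b
  0<⊓ {a} {b} 0<a 0<b with ≤-total a b
  ... | inj₁ a≤b = subst (0ℚ <_) (sym (p≤q⇒p⊓q≡p a≤b)) 0<a
  ... | inj₂ b≤a = subst (0ℚ <_) (sym (p≥q⇒p⊓q≡q b≤a)) 0<b

  0<recip : ∀ n .{{_ : NonZero n}} → 0ℚ < recip n
  0<recip n = *-cancelˡ-<-nonNeg (ι n) {{nonNegative (0≤ι n)}} (subst₂ _<_ (sym (*-zeroʳ (ι n))) (sym (ι-recip n)) (positive⁻¹ 1ℚ))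

  recip≤1 : ∀ n .{{_ : NonZero n}} → recip n ≤ 1ℚ
  recip≤1 n@(suc _) = subst (recip n ≤_) recip-1 (recip-antitone {1} {n} (ℕ.s≤s ℕ.z≤n))

  ι*recip-suc≤1 : ∀ n → ι n * recip (suc n) ≤ 1ℚ
  ι*recip-suc≤1 n = subst (ι n * recip (suc n) ≤_) (ι-recip (suc n)) (*-monoʳ (0≤recip (suc n)) (ι-mono (ℕP.n≤1+n n)))

  module Parameters {m} (H : Graph m) (knrs : KNRS′ H) (k r′ : ℕ)
    {d ε : ℚ} (0<d : 0ℚ < d) (d≤1 : d ≤ 1ℚ) (0<ε : 0ℚ < ε) (ε≤1 : ε ≤ 1ℚ) where

    r e edges : ℕ
    r     = suc r′
    e     = numEdges H
    edges = suc (2 ℕ.* k) ℕ.* e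

    -- Half of `ε` pays, through Bernoulli, for lowering `d` to `d₁` in all `edges` factors. The
    -- other half is split evenly: one `ε′` is the loss in KNRS for `H`, the other covers repeated
    -- labels. The successor keeps `θ` positive when there are no edges.
    θ d₁ ε′ : ℚ
    θ  = ε * ½ * recip (suc edges)
    d₁ = d * (1ℚ - θ)
    ε′ = ε * ½ * ½

    ½≤1 : ½ ≤ 1ℚ
    ½≤1 = ≤-add 0≤½ refl

    0<ε½ : 0ℚ < ε * ½
    0<ε½ = 0<* 0<ε 0<½

    ε½≤½ : ε * ½ ≤ ½
    ε½≤½ = *-≤ʳ 0≤½ ε≤1

    0<θ : 0ℚ < θ
    0<θ = 0<* 0<ε½ (0<recip (suc edges))

    θ≤½ : θ ≤ ½
    θ≤½ = ≤-trans (*-≤ˡ (<⇒≤ 0<ε½) (recip≤1 (suc edges))) ε½≤½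

    θ≤1 : θ ≤ 1ℚ
    θ≤1 = ≤-trans θ≤½ ½≤1

    edges-θ : ι edges * θ ≤ ε * ½
    edges-θ = subst (_≤ ε * ½) (eq (ι edges) (ε * ½) (recip (suc edges))) (*-≤ˡ (<⇒≤ 0<ε½) (ι*recip-suc≤1 edges))
      where
      eq : ∀ n x r → x * (n * r) ≡ n * (x * r)
      eq = solve-∀ ℚ-ring

    0<1-θ : 0ℚ < 1ℚ - θ
    0<1-θ = <-≤-trans 0<½ (≤-add (0≤- θ≤½) (eq θ))
      where
      eq : ∀ θ → 1ℚ - θ ≡ ½ + (½ - θ)
      eq = solve-∀ ℚ-ring

    0<d₁ : 0ℚ < d₁
    0<d₁ = 0<* 0<d 0<1-θ

    d₁≤1 : d₁ ≤ 1ℚ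
    d₁≤1 = *-≤1 (<⇒≤ 0<d) d≤1 (<⇒≤ 0<1-θ) (≤-add (<⇒≤ 0<θ) (eq θ))
      where
      eq : ∀ θ → 1ℚ ≡ 1ℚ - θ + θ
      eq = solve-∀ ℚ-ring

    0<ε′ : 0ℚ < ε′
    0<ε′ = 0<* 0<ε½ 0<½

    private
      knrs-H = knrs d₁ ε′ 0<d₁ 0<ε′

    ρ₀ : ℚ
    ρ₀ = proj₁ knrs-H

    N₀ : ℕ
    N₀ = proj₁ (proj₂ (proj₂ knrs-H))

    t-H : ∀ n → N₀ ℕ.≤ n → (G : Graph n) → IsSimple G → Dense ρ₀ d₁ G → (1ℚ - ε′) * (d₁ ^ℚ e) ≤ density H G
    t-H = proj₂ (proj₂ (proj₂ knrs-H))

    ρ₁ : ℚ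
    ρ₁ = ρ₀ ⊓ 1ℚ

    0<ρ₁ : 0ℚ < ρ₁
    0<ρ₁ = 0<⊓ (proj₁ (proj₂ knrs-H)) (positive⁻¹ 1ℚ)

    -- `c` bounds the mean of `δ k` from below, and `κ` the mean of its power `r`. `ρ` is a product
    -- of two factors, both at most 1: `θ * (c * c)` serves the walk counts, and the other factor,
    -- times `θ`, serves the density of the sampled graph. As `ρ * ρ` is at most `ρ`, one choice
    -- meets both demands.
    c κ ρ η : ℚ
    c = d₁ ^ℚ k
    κ = c ^ℚ r
    ρ = θ * (c * c) * (½ * (ρ₁ * ρ₁) * (κ * κ))
    η = ½ * ½ * (d * θ * (ρ₁ * ρ₁))

    0<c : 0ℚ < c
    0<c = 0<^ k 0<d₁

    c≤1 : c ≤ 1ℚ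
    c≤1 = ^-≤1 k (<⇒≤ 0<d₁) d₁≤1

    0<κ : 0ℚ < κ
    0<κ = 0<^ r 0<c

    κ≤1 : κ ≤ 1ℚ
    κ≤1 = ^-≤1 r (<⇒≤ 0<c) c≤1

    private
      sq-pos : ∀ {x} → 0ℚ < x → 0ℚ < x * x
      sq-pos 0<x = 0<* 0<x 0<x

      sq-≤1 : ∀ {x} → 0ℚ < x → x ≤ 1ℚ → x * x ≤ 1ℚ
      sq-≤1 0<x x≤1 = *-≤1 (<⇒≤ 0<x) x≤1 (<⇒≤ 0<x) x≤1

      0<θc : 0ℚ < θ * (c * c)
      0<θc = 0<* 0<θ (sq-pos 0<c)

      θc≤θ : θ * (c * c) ≤ θ
      θc≤θ = *-≤ˡ (<⇒≤ 0<θ) (sq-≤1 0<c c≤1)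

      0<tail : 0ℚ < ½ * (ρ₁ * ρ₁) * (κ * κ)
      0<tail = 0<* (0<* 0<½ (sq-pos 0<ρ₁)) (sq-pos 0<κ)

      tail≤1 : ½ * (ρ₁ * ρ₁) * (κ * κ) ≤ 1ℚ
      tail≤1 = *-≤1 (<⇒≤ (0<* 0<½ (sq-pos 0<ρ₁)))
        (*-≤1 0≤½ ½≤1 (<⇒≤ (sq-pos 0<ρ₁)) (sq-≤1 0<ρ₁ (p⊓q≤q ρ₀ 1ℚ)))
        (<⇒≤ (sq-pos 0<κ)) (sq-≤1 0<κ κ≤1)

    0<ρ : 0ℚ < ρ
    0<ρ = 0<* 0<θc 0<tail

    ρ≤1 : ρ ≤ 1ℚ
    ρ≤1 = *-≤1 (<⇒≤ 0<θc) (≤-trans θc≤θ θ≤1) (<⇒≤ 0<tail) tail≤1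

    ρ²≤ρ : ρ * ρ ≤ ρ
    ρ²≤ρ = *-≤ˡ (<⇒≤ 0<ρ) ρ≤1

    ρ²-walks : ∀ j → j ℕ.≤ k → ρ * ρ ≤ θ * ((d₁ ^ℚ j) * (d₁ ^ℚ j))
    ρ²-walks j j≤k = ≤-trans ρ²≤ρ (≤-trans (*-≤ˡ (<⇒≤ 0<θc) tail≤1)
      (*-monoˡ (<⇒≤ 0<θ) (*-mono (<⇒≤ 0<c) c≤ (<⇒≤ 0<c) c≤)))
      where
      c≤ : c ≤ d₁ ^ℚ j
      c≤ = ^-antitone (<⇒≤ 0<d₁) d₁≤1 j≤k

    ρ²-density : ρ * ρ ≤ θ * (½ * (ρ₁ * ρ₁) * (κ * κ))
    ρ²-density = ≤-trans ρ²≤ρ (*-monoʳ (<⇒≤ 0<tail) θc≤θ)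

    0<η : 0ℚ < η
    0<η = 0<* (0<* 0<½ 0<½) (0<* (0<* 0<d 0<θ) (sq-pos 0<ρ₁))

    private
      collisionBound : ℚ
      collisionBound = ε′ * (d₁ ^ℚ e) * recip (suc (m ℕ.* m))

      0<collisionBound : 0ℚ < collisionBound
      0<collisionBound = 0<* (0<* 0<ε′ (0<^ e 0<d₁)) (0<recip (suc (m ℕ.* m)))

      s₁ = archimedean (sq-pos 0<η)
      s₂ = archimedean 0<collisionBound

    -- Large for three purposes: the sampling error, the label collisions, and `N₀`. Since the
    -- sampled graph has at least `s` vertices, KNRS applies to it however small `G` is.
    s : ℕ
    s = suc (proj₁ s₁ ℕ.+ (proj₁ s₂ ℕ.+ N₀))

    recip-s≤η² : recip s ≤ η * η
    recip-s≤η² = ≤-trans (recip-antitone {suc (proj₁ s₁)} {s} (ℕ.s≤s (ℕP.m≤m+n _ _))) (proj₂ s₁)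

    collisions-s : ι (m ℕ.* m) * recip s ≤ ε′ * (d₁ ^ℚ e)
    collisions-s = begin
      ι (m ℕ.* m) * recip s
        ≤⟨ *-monoˡ (0≤ι (m ℕ.* m)) (≤-trans (recip-antitone {suc (proj₁ s₂)} {s} (ℕ.s≤s (ℕP.≤-trans (ℕP.m≤m+n _ N₀) (ℕP.m≤n+m _ (proj₁ s₁))))) (proj₂ s₂)) ⟩
      ι (m ℕ.* m) * (ε′ * (d₁ ^ℚ e) * recip (suc (m ℕ.* m)))
        ≡⟨ eq (ι (m ℕ.* m)) (ε′ * (d₁ ^ℚ e)) (recip (suc (m ℕ.* m))) ⟩
      ε′ * (d₁ ^ℚ e) * (ι (m ℕ.* m) * recip (suc (m ℕ.* m)))
        ≤⟨ *-≤ˡ (<⇒≤ (0<* 0<ε′ (0<^ e 0<d₁))) (ι*recip-suc≤1 (m ℕ.* m)) ⟩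
      ε′ * (d₁ ^ℚ e) ∎
      where
      open ≤-Reasoning
      eq : ∀ n x r → n * (x * r) ≡ x * (n * r)
      eq = solve-∀ ℚ-ring

    N₀≤s : N₀ ℕ.≤ s
    N₀≤s = ℕP.≤-trans (ℕP.m≤n+m N₀ (proj₁ s₂)) (ℕP.≤-trans (ℕP.m≤n+m _ (proj₁ s₁)) (ℕP.n≤1+n _))

    -- The losses d ρ² and 2 η κ² are each at most half of d θ κ² ρ₁².
    transfer : ∀ {x y} → ρ₀ ≤ x → d * ((κ * x) * (κ * x) - ρ * ρ) ≤ κ * κ * y → d₁ * (x * x) + (η + η) ≤ y
    transfer {x} {y} ρ₀≤x h = *-cancelˡ-≤ (sq-pos 0<κ) (≤-add
      (0≤+ (0≤+ (0≤- h) (0≤* (<⇒≤ 0<d) (0≤- ρ²-density)))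
           (0≤* (0≤* (<⇒≤ (sq-pos 0<κ)) (<⇒≤ (0<* 0<d 0<θ))) (0≤- (*-mono (<⇒≤ 0<ρ₁) ρ₁≤x (<⇒≤ 0<ρ₁) ρ₁≤x))))
      (eq κ d θ x y ρ₁ ρ))
      where
      ρ₁≤x : ρ₁ ≤ x
      ρ₁≤x = ≤-trans (p⊓q≤p ρ₀ 1ℚ) ρ₀≤x
      eq : ∀ κ d θ x y ρ₁ ρ → κ * κ * y ≡
        κ * κ * (d * (1ℚ - θ) * (x * x) + (½ * ½ * (d * θ * (ρ₁ * ρ₁)) + ½ * ½ * (d * θ * (ρ₁ * ρ₁))))
        + (κ * κ * y - d * ((κ * x) * (κ * x) - ρ * ρ) + d * (θ * (½ * (ρ₁ * ρ₁) * (κ * κ)) - ρ * ρ) + κ * κ * (d * θ) * (x * x - ρ₁ * ρ₁))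
      eq = solve-∀ ℚ-ring

    final-estimate : 2 ℕ.* e ≡ m ℕ.* r → (1ℚ - ε) * (d ^ℚ edges) ≤ (1ℚ - ε * ½) * (d₁ ^ℚ e) * (κ ^ℚ m)
    final-estimate 2e≡mr = begin
      (1ℚ - ε) * (d ^ℚ edges)
        ≤⟨ *-monoʳ (0≤^ edges (<⇒≤ 0<d)) (≤-add {1ℚ - ε} (0≤* (0≤* 0≤½ 0≤½) (0≤² ε)) (eq ε)) ⟩
      (1ℚ - ε * ½) * (1ℚ - ε * ½) * (d ^ℚ edges)
        ≤⟨ *-monoʳ (0≤^ edges (<⇒≤ 0<d)) (*-monoˡ 0≤1-ε½ (≤-trans (+-monoʳ-≤ 1ℚ (neg-antimono-≤ edges-θ)) (bernoulli (<⇒≤ 0<θ) θ≤1 edges))) ⟩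
      (1ℚ - ε * ½) * ((1ℚ - θ) ^ℚ edges) * (d ^ℚ edges)
        ≡⟨ trans (*-assoc (1ℚ - ε * ½) _ _) (cong ((1ℚ - ε * ½) *_) (trans (*-comm ((1ℚ - θ) ^ℚ edges) (d ^ℚ edges)) (sym (*-^ d (1ℚ - θ) edges)))) ⟩
      (1ℚ - ε * ½) * (d₁ ^ℚ edges)
        ≡⟨ cong ((1ℚ - ε * ½) *_) powers ⟩
      (1ℚ - ε * ½) * ((d₁ ^ℚ e) * (κ ^ℚ m))
        ≡⟨ sym (*-assoc (1ℚ - ε * ½) (d₁ ^ℚ e) (κ ^ℚ m)) ⟩
      (1ℚ - ε * ½) * (d₁ ^ℚ e) * (κ ^ℚ m) ∎
      where
      open ≤-Reasoning
      eq : ∀ ε → (1ℚ - ε * ½) * (1ℚ - ε * ½) ≡ 1ℚ - ε + ½ * ½ * (ε * ε)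
      eq = solve-∀ ℚ-ring
      0≤1-ε½ : 0ℚ ≤ 1ℚ - ε * ½
      0≤1-ε½ = 0≤- (≤-trans ε½≤½ ½≤1)
      -- Of the `2 * k + 1` edges on each path one is the middle edge. The remaining `2 * k * e` are
      -- walk steps, and by `2 * e ≡ m * r` they are shared out as `r * k` for each of the `m`
      -- vertices, which is what `κ ^ m` contains.
      exponents : 2 ℕ.* k ℕ.* e ≡ m ℕ.* (r ℕ.* k)
      exponents = trans (cong (ℕ._* e) (ℕP.*-comm 2 k)) (trans (ℕP.*-assoc k 2 e) (trans (cong (k ℕ.*_) 2e≡mr)
        (trans (ℕP.*-comm k (m ℕ.* r)) (ℕP.*-assoc m r k))))
      powers : d₁ ^ℚ edges ≡ (d₁ ^ℚ e) * (κ ^ℚ m)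
      powers = trans (^-+ d₁ e (2 ℕ.* k ℕ.* e)) (cong ((d₁ ^ℚ e) *_) (trans (cong (d₁ ^ℚ_) exponents)
        (trans (^-* d₁ m (r ℕ.* k)) (cong (_^ℚ m) (^-* d₁ r k)))))

  subdivision-density : ∀ {m} (H : Graph m) → IsSimple H → ∀ r′ → (∀ v → degree H v ≡ suc r′) → (knrs : KNRS′ H) → ∀ k s′ → suc s′ ≡ 2 ℕ.* k →
    ∀ {d ε} (0<d : 0ℚ < d) (d≤1 : d ≤ 1ℚ) (0<ε : 0ℚ < ε) (ε≤1 : ε ≤ 1ℚ) →
    let open Parameters H knrs k r′ 0<d d≤1 0<ε ε≤1 in
    ∀ n .{{_ : NonZero n}} (G : Graph n) → IsSimple G → Dense ρ d G →
    (1ℚ - ε) * (d ^ℚ edges) ≤ density (subdivision (suc s′) H) G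
  subdivision-density {m} H H-simple r′ regular knrs k s′ s≡2k {d} {ε} 0<d d≤1 0<ε ε≤1 n G simple dense = begin
      (1ℚ - ε) * (d ^ℚ edges)
        ≤⟨ final-estimate (numEdges-regular H H-simple r regular) ⟩
      (1ℚ - ε * ½) * (d₁ ^ℚ e) * (κ ^ℚ m)
        ≤⟨ *-mono (0≤* (0≤- (≤-trans ε½≤½ ½≤1)) (0≤^ e (<⇒≤ 0<d₁))) Q-bound (0≤^ m (<⇒≤ 0<κ)) (^-mono m (<⇒≤ 0<κ) κ≤Z) ⟩
      Q * (Z ^ℚ m)
        ≡⟨ sym (density-subdivision-sampled H H-simple regular s′ (trans s≡2k (cong (k ℕ.+_) (ℕP.+-identityʳ k)))) ⟩
      density (subdivision (suc s′) H) G ∎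
    where
    open ≤-Reasoning
    open Parameters H knrs k r′ 0<d d≤1 0<ε ε≤1 hiding (r)
    open WalkOperator G simple
    open WalkMeasure G simple k
    locallyDense : LocallyDense ρ d G
    locallyDense = dense⇒locallyDense G simple (<⇒≤ 0<d) dense
    κ≤ : κ ≤ E U (λ x → δ k x ^ℚ suc r′)
    κ≤ = ^-mean U (0≤δ k) (<⇒≤ 0<c) (walk-density {ρ} {d} {θ} {k} locallyDense (<⇒≤ 0<d) (<⇒≤ 0<d₁) ρ²-walks k k ℕP.≤-refl ℕP.≤-refl) (suc r′)
    open Weighted r′ (<-≤-trans 0<κ κ≤)
    κ≤Z : κ ≤ Z
    κ≤Z = κ≤
    Q : ℚ
    Q = E (pow P m) (λ σs → ∏ (edgeList H) (λ ε → q (lookup σs (proj₁ ε)) (lookup σs (proj₂ ε))))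
    G′ : Graph (order G simple {p} {samples} {s} S)
    G′ = sampled G simple {p} {samples} {s} S
    G′-dense : Dense ρ₀ d₁ G′
    G′-dense = sampled-dense G simple {p} {samples} {s} S {ρ₀} {d₁} {η} 0<η recip-s≤η² (λ g 0≤g g≤1 ρ₀≤ →
      transfer ρ₀≤ (sampled-weighted-density (<⇒≤ 0<κ) κ≤Z g 0≤g g≤1 {ρ} {d} locallyDense))
    large : N₀ ℕ.≤ order G simple {p} {samples} {s} S
    large = ℕP.≤-trans N₀≤s (ℕP.≤-trans (ℕP.m≤m*n s (samples ℕ.^ s) {{ℕP.m^n≢0 samples s}}) (ℕP.m≤n*m (s ℕ.* samples ℕ.^ s) p))
    Q-bound : (1ℚ - ε * ½) * (d₁ ^ℚ e) ≤ Q
    Q-bound = begin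
      (1ℚ - ε * ½) * (d₁ ^ℚ e)                                  ≡⟨ eq ε (d₁ ^ℚ e) ⟩
      (1ℚ - ε′) * (d₁ ^ℚ e) - ε′ * (d₁ ^ℚ e)                    ≤⟨ +-mono-≤ (≤-trans (t-H (order G simple {p} {samples} {s} S) large G′ (sampled-simple G simple {p} {samples} {s} S) G′-dense) (sampled-count G simple {p} {samples} {s} S H)) (neg-antimono-≤ collisions-s) ⟩
      Q + ι (m ℕ.* m) * recip s - ι (m ℕ.* m) * recip s          ≡⟨ eq′ Q (ι (m ℕ.* m) * recip s) ⟩
      Q                                                         ∎
      where
      eq : ∀ ε x → (1ℚ - ε * ½) * x ≡ (1ℚ - ε * ½ * ½) * x - ε * ½ * ½ * x
      eq = solve-∀ ℚ-ring
      eq′ : ∀ x y → x + y - y ≡ x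
      eq′ = solve-∀ ℚ-ring

  subdivision-knrs : (k : ℕ) → 1 ℕ.≤ k → ∀ {m} (H : Graph m) → IsSimple H → IsRegular H →
    KNRS′ H → KNRS′ (subdivision (2 ℕ.* k) H)
  subdivision-knrs k@(suc k′) _ {m} H H-simple (r , regular) knrs d ε 0<d 0<ε = go r regular
    where
    -- Chosen so that `suc s′` is the normal form of `2 * k`, and the required equation holds by
    -- `refl`.
    s′ : ℕ
    s′ = k′ ℕ.+ suc (k′ ℕ.+ 0)
    edges : numEdges (subdivision (2 ℕ.* k) H) ≡ suc (2 ℕ.* k) ℕ.* numEdges H
    edges = subst (λ s → numEdges (subdivision s H) ≡ suc s ℕ.* numEdges H) (cong suc (sym (ℕP.+-suc k′ (k′ ℕ.+ 0))))
      (numEdges-subdivision H (k′ ℕ.+ (k′ ℕ.+ 0)))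
    -- The estimate is proved for `ε ⊓ 1ℚ`, where the parameters behave, and weakens to larger `ε`.
    relax : ∀ {n} {G : Graph n} → (1ℚ - (ε ⊓ 1ℚ)) * (d ^ℚ (suc (2 ℕ.* k) ℕ.* numEdges H)) ≤ density (subdivision (2 ℕ.* k) H) G →
      (1ℚ - ε) * (d ^ℚ numEdges (subdivision (2 ℕ.* k) H)) ≤ density (subdivision (2 ℕ.* k) H) G
    relax {G = G} h = ≤-trans (*-monoʳ (0≤^ (numEdges (subdivision (2 ℕ.* k) H)) (<⇒≤ 0<d)) (+-monoʳ-≤ 1ℚ (neg-antimono-≤ (p⊓q≤p ε 1ℚ))))
      (subst (λ j → (1ℚ - (ε ⊓ 1ℚ)) * (d ^ℚ j) ≤ density (subdivision (2 ℕ.* k) H) G) (sym edges) h)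
    Goal : Set
    Goal = ∃[ ρ ] (0ℚ < ρ × ∃[ N ] (∀ (n : ℕ) → N ℕ.≤ n → (G : Graph n) → IsSimple G →
      Dense ρ d G → (1ℚ - ε) * (d ^ℚ numEdges (subdivision (2 ℕ.* k) H)) ≤ density (subdivision (2 ℕ.* k) H) G))
    go : ∀ r → (∀ v → degree H v ≡ r) → Goal
    -- For `r = 0` no factor `δ` is available to normalise the walk endpoints, but then `H` and its
    -- subdivision have no edges and the density is 1.
    go zero regular = 1ℚ , positive⁻¹ 1ℚ , 1 , λ n 1≤n G simple dense → subst₂ _≤_
        (sym (trans (cong (λ j → (1ℚ - ε) * (d ^ℚ j)) none) (*-identityʳ (1ℚ - ε))))
        (sym (density-edgeless {{ℕ.>-nonZero 1≤n}} (subdivision (2 ℕ.* k) H) G none))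
        (≤-add (<⇒≤ 0<ε) (eq ε))
      where
      eq : ∀ ε → 1ℚ ≡ 1ℚ - ε + ε
      eq = solve-∀ ℚ-ring
      H-none : numEdges H ≡ 0
      H-none = ℕP.*-cancelˡ-≡ (numEdges H) 0 2 (trans (numEdges-regular H H-simple 0 regular) (ℕP.*-zeroʳ m))
      none : numEdges (subdivision (2 ℕ.* k) H) ≡ 0
      none = trans edges (trans (cong (suc (2 ℕ.* k) ℕ.*_) H-none) (ℕP.*-zeroʳ (suc (2 ℕ.* k))))
    go (suc r′) regular with d ≤? 1ℚ
    ... | no d≰1 = 1ℚ , positive⁻¹ 1ℚ , 1 , λ n 1≤n G simple dense → ⊥-elim (d≰1 (dense⇒≤1 {{ℕ.>-nonZero 1≤n}} simple dense ≤-refl))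
    -- The threshold 1 only excludes the empty graph; the size demanded by KNRS for `H` is supplied
    -- by the sampled graph.
    ... | yes d≤1 = ρ , 0<ρ , 1 , λ n 1≤n G simple dense →
        relax (subdivision-density H H-simple r′ regular knrs k s′ refl 0<d d≤1 (0<⊓ 0<ε (positive⁻¹ 1ℚ)) (p⊓q≤q ε 1ℚ) n {{ℕ.>-nonZero 1≤n}} G simple dense)
      where open Parameters H knrs k r′ 0<d d≤1 (0<⊓ 0<ε (positive⁻¹ 1ℚ)) (p⊓q≤q ε 1ℚ)

open import Data.Nat using (ℕ; _≤_; _*_)

theorem1p6 : (k : ℕ) → 1 ≤ k → ∀ {m} (H : Graph m) → IsSimple H → IsRegular H →
    KNRS H → KNRS (subdivision (2 * k) H)
theorem1p6 k 1≤k H simple regular knrs =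
  knrs⁺ {H = subdivision (2 * k) H} (subdivision-knrs k 1≤k H simple regular (knrs⁻ {H = H} knrs))
  where open KNRSSubdivisions
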